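{- For every $s\in\mathbb C$ and every $z\in\mathbb C$ with $|z|<1$, $$z\frac{d}{dz}\log G_{s+1}(z)=\log G_s(z).$$
   Context: $\zeta$ is the Riemann zeta function. For $s\in\mathbb C$ and $|z|<1$ the polylogarithmic gamma function is $$G_s(z):=\exp\left(\sum_{r=2}^{\infty}\frac{\zeta(r)}{r^s}z^r\right),$$ and $\log G_s(z)$ denotes the series $\sum_{r=2}^{\infty}\frac{\zeta(r)}{r^s}z^r$ in the exponent. -}

module Defs where

open import Algebra.Bundles.Raw using (RawRing)
open import Data.Integer.Base as ℤ using (+_)
open import Data.Nat.Base as ℕ using (ℕ; zero; suc; _!; _⊔_)
import Data.Nat.Properties as ℕₚ
open import Data.Product using (∃-syntax; Σ-syntax; _×_; _,_)
open import Data.Rational.Base as ℚ using (ℚ; 0ℚ; 1ℚ; ½; ∣_∣)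
import Data.Rational.Properties as ℚₚ
open import Data.Rational.Solver using (module +-*-Solver)
open import Level using (0ℓ)
open import Relation.Binary.PropositionalEquality using (_≡_; refl; sym; trans; cong; cong₂; subst)
import Algebra.Definitions.RawSemiring as RawSemiringDefs

private
  module ℚ-estimates where
    open import Data.Rational.Base
    open +-*-Solver

    sum-diff : ∀ a b c d → (a + b) - (c + d) ≡ (a - c) + (b - d)
    sum-diff = solve 4 (λ a b c d → (a :+ b) :- (c :+ d) := (a :- c) :+ (b :- d)) refl

    neg-diff : ∀ a b → (- a) - (- b) ≡ - (a - b)
    neg-diff = solve 2 (λ a b → (:- a) :- (:- b) := :- (a :- b)) refl

    prod-diff : ∀ a b c d → a * b - c * d ≡ a * (b - d) + d * (a - c)
    prod-diff = solve 4 (λ a b c d →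
      a :* b :- c :* d := a :* (b :- d) :+ d :* (a :- c)) refl

    split : ∀ a b → a ≡ (a - b) + b
    split = solve 2 (λ a b → a := (a :- b) :+ b) refl

    halves : ∀ ε → ½ * ε + ½ * ε ≡ ε
    halves ε = trans (sym (ℚₚ.*-distribʳ-+ ε ½ ½)) (ℚₚ.*-identityˡ ε)

    half>0 : ∀ {ε} → 0ℚ < ε → 0ℚ < ½ * ε
    half>0 {ε} ε>0 = ℚₚ.positive⁻¹ _ {{ℚₚ.pos*pos⇒pos ½ ε {{ℚ.positive ε>0}}}}

    shrink : ∀ {ε B} → 0ℚ < ε → 0ℚ < B → ∃[ η ] 0ℚ < η × B * η ≡ ε
    shrink {ε} {B} ε>0 B>0 = η , η>0 , eq
      where
      instance
        B⁺ = ℚ.positive B>0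
        B≢0 = ℚₚ.pos⇒nonZero B
      η = 1/ B * ε
      η>0 = ℚₚ.positive⁻¹ η {{ℚₚ.pos*pos⇒pos (1/ B) {{ℚₚ.1/pos⇒pos B}} ε {{ℚ.positive ε>0}}}}
      eq = trans (sym (ℚₚ.*-assoc B (1/ B) ε))
          (trans (cong (_* ε) (ℚₚ.*-inverseʳ B)) (ℚₚ.*-identityˡ ε))

    -- |u| ≤ B and |v| < η give |u v| ≤ B η
    prod-bound : ∀ {B η} u v → ∣ u ∣ ≤ B → ∣ v ∣ < η → ∣ u * v ∣ ≤ B * η
    prod-bound {B} {η} u v u≤B v<η = begin
      ∣ u * v ∣      ≡⟨ ℚₚ.∣p*q∣≡∣p∣*∣q∣ u v ⟩
      ∣ u ∣ * ∣ v ∣  ≤⟨ ℚₚ.*-monoʳ-≤-nonNeg ∣ v ∣ {{ℚ.nonNegative (ℚₚ.0≤∣p∣ v)}} u≤B ⟩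
      B * ∣ v ∣      ≤⟨ ℚₚ.*-monoˡ-≤-nonNeg B {{ℚ.nonNegative (ℚₚ.≤-trans (ℚₚ.0≤∣p∣ u) u≤B)}} (ℚₚ.<⇒≤ v<η) ⟩
      B * η          ∎
      where open ℚₚ.≤-Reasoning

    half< : ∀ {ε} → 0ℚ < ε → ½ * ε < ε
    half< {ε} ε>0 = begin-strict
      ½ * ε          ≡⟨ sym (ℚₚ.+-identityʳ (½ * ε)) ⟩
      ½ * ε + 0ℚ     <⟨ ℚₚ.+-monoʳ-< (½ * ε) (half>0 {ε} ε>0) ⟩
      ½ * ε + ½ * ε  ≡⟨ halves ε ⟩
      ε              ∎
      where open ℚₚ.≤-Reasoning

    add-close : ∀ {ε} a b c d → ∣ a - c ∣ < ½ * ε → ∣ b - d ∣ < ½ * ε →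
      ∣ (a + b) - (c + d) ∣ < ε
    add-close {ε} a b c d ac bd = begin-strict
      ∣ (a + b) - (c + d) ∣    ≡⟨ cong ∣_∣ (sum-diff a b c d) ⟩
      ∣ (a - c) + (b - d) ∣    ≤⟨ ℚₚ.∣p+q∣≤∣p∣+∣q∣ (a - c) (b - d) ⟩
      ∣ a - c ∣ + ∣ b - d ∣    <⟨ ℚₚ.+-mono-< ac bd ⟩
      ½ * ε + ½ * ε            ≡⟨ halves ε ⟩
      ε                        ∎
      where open ℚₚ.≤-Reasoning

    mul-close : ∀ {ε A B α β} a b c d → A * α ≡ ½ * ε → B * β ≡ ½ * ε →
      ∣ a ∣ ≤ A → ∣ d ∣ ≤ B → ∣ a - c ∣ < β → ∣ b - d ∣ < α →
      ∣ a * b - c * d ∣ ≤ ε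
    mul-close {ε} {A} {B} {α} {β} a b c d Aα Bβ a≤A d≤B ac bd = begin
      ∣ a * b - c * d ∣                      ≡⟨ cong ∣_∣ (prod-diff a b c d) ⟩
      ∣ a * (b - d) + d * (a - c) ∣          ≤⟨ ℚₚ.∣p+q∣≤∣p∣+∣q∣ (a * (b - d)) (d * (a - c)) ⟩
      ∣ a * (b - d) ∣ + ∣ d * (a - c) ∣      ≤⟨ ℚₚ.+-mono-≤ (prod-bound a (b - d) a≤A bd)
                                                            (prod-bound d (a - c) d≤B ac) ⟩
      A * α + B * β                          ≡⟨ cong₂ _+_ Aα Bβ ⟩
      ½ * ε + ½ * ε                          ≡⟨ halves ε ⟩
      ε                                      ∎
      where open ℚₚ.≤-Reasoning

IsCauchy : (ℕ → ℚ) → Set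
IsCauchy x = ∀ ε → 0ℚ ℚ.< ε → ∃[ N ] ∀ m n → N ℕ.≤ m → N ℕ.≤ n → ∣ x m ℚ.- x n ∣ ℚ.< ε

private
  open ℚ-estimates

  const-cauchy : ∀ q → IsCauchy (λ _ → q)
  const-cauchy q ε ε>0 = 0 , λ _ _ _ _ →
    subst (ℚ._< ε) (sym (cong ∣_∣ (ℚₚ.+-inverseʳ q))) ε>0

  neg-cauchy : ∀ {x} → IsCauchy x → IsCauchy (λ n → ℚ.- x n)
  neg-cauchy {x} cx ε ε>0 with N , h ← cx ε ε>0 = N , λ m n N≤m N≤n →
    subst (ℚ._< ε)
      (sym (trans (cong ∣_∣ (neg-diff (x m) (x n))) (ℚₚ.∣-p∣≡∣p∣ (x m ℚ.- x n))))
      (h m n N≤m N≤n)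

  add-cauchy : ∀ {x y} → IsCauchy x → IsCauchy y → IsCauchy (λ n → x n ℚ.+ y n)
  add-cauchy {x} {y} cx cy ε ε>0
    with M , hx ← cx (½ ℚ.* ε) (half>0 {ε} ε>0) | N , hy ← cy (½ ℚ.* ε) (half>0 {ε} ε>0) =
    M ⊔ N , λ m n ≤m ≤n → add-close {ε} (x m) (y m) (x n) (y n)
      (hx m n (ℕₚ.m⊔n≤o⇒m≤o M N ≤m) (ℕₚ.m⊔n≤o⇒m≤o M N ≤n))
      (hy m n (ℕₚ.m⊔n≤o⇒n≤o M N ≤m) (ℕₚ.m⊔n≤o⇒n≤o M N ≤n))

  eventually-bounded : ∀ {x} → IsCauchy x →
    ∃[ B ] 0ℚ ℚ.< B × ∃[ N ] ∀ n → N ℕ.≤ n → ∣ x n ∣ ℚ.≤ B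
  eventually-bounded {x} cx with N , h ← cx 1ℚ (ℚₚ.positive⁻¹ 1ℚ) =
    1ℚ ℚ.+ ∣ x N ∣ , ℚₚ.+-mono-<-≤ (ℚₚ.positive⁻¹ 1ℚ) (ℚₚ.0≤∣p∣ (x N)) , N , λ n N≤n → begin
      ∣ x n ∣                         ≡⟨ cong ∣_∣ (split (x n) (x N)) ⟩
      ∣ (x n ℚ.- x N) ℚ.+ x N ∣       ≤⟨ ℚₚ.∣p+q∣≤∣p∣+∣q∣ (x n ℚ.- x N) (x N) ⟩
      ∣ x n ℚ.- x N ∣ ℚ.+ ∣ x N ∣     ≤⟨ ℚₚ.+-monoˡ-≤ ∣ x N ∣ (ℚₚ.<⇒≤ (h n N N≤n ℕₚ.≤-refl)) ⟩
      1ℚ ℚ.+ ∣ x N ∣                  ∎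
    where open ℚₚ.≤-Reasoning

  mul-cauchy : ∀ {x y} → IsCauchy x → IsCauchy y → IsCauchy (λ n → x n ℚ.* y n)
  mul-cauchy {x} {y} cx cy ε ε>0 =
    let η = ½ ℚ.* ε
        η>0 = half>0 {ε} ε>0
        A , A>0 , K , xb = eventually-bounded {x} cx
        B , B>0 , L , yb = eventually-bounded {y} cy
        α , α>0 , Aα = shrink {½ ℚ.* η} {A} (half>0 {η} η>0) A>0
        β , β>0 , Bβ = shrink {½ ℚ.* η} {B} (half>0 {η} η>0) B>0
        M , hx = cx β β>0
        N , hy = cy α α>0
    in (K ⊔ L) ⊔ (M ⊔ N) , λ m n ≤m ≤n →
      let KL≤m = ℕₚ.m⊔n≤o⇒m≤o (K ⊔ L) (M ⊔ N) ≤m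
          KL≤n = ℕₚ.m⊔n≤o⇒m≤o (K ⊔ L) (M ⊔ N) ≤n
          MN≤m = ℕₚ.m⊔n≤o⇒n≤o (K ⊔ L) (M ⊔ N) ≤m
          MN≤n = ℕₚ.m⊔n≤o⇒n≤o (K ⊔ L) (M ⊔ N) ≤n
      in ℚₚ.≤-<-trans
           (mul-close {η} {A} {B} {α} {β} (x m) (y m) (x n) (y n) Aα Bβ
             (xb m (ℕₚ.m⊔n≤o⇒m≤o K L KL≤m))
             (yb n (ℕₚ.m⊔n≤o⇒n≤o K L KL≤n))
             (hx m n (ℕₚ.m⊔n≤o⇒m≤o M N MN≤m) (ℕₚ.m⊔n≤o⇒m≤o M N MN≤n))
             (hy m n (ℕₚ.m⊔n≤o⇒n≤o M N MN≤m) (ℕₚ.m⊔n≤o⇒n≤o M N MN≤n)))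
           (half< {ε} ε>0)

-- Real numbers are Cauchy sequences of rationals, compared up to _≈ʳ_.

record ℝ : Set where
  constructor mkℝ
  field
    seq    : ℕ → ℚ
    cauchy : IsCauchy seq
open ℝ public

infix  4 _≈ʳ_ _<ʳ_ _≤ʳ_
infixl 6 _+ʳ_
infixl 7 _*ʳ_
infix  8 -ʳ_

_≈ʳ_ _<ʳ_ _≤ʳ_ : ℝ → ℝ → Set
x ≈ʳ y = ∀ ε → 0ℚ ℚ.< ε → ∃[ N ] ∀ n → N ℕ.≤ n → ∣ seq x n ℚ.- seq y n ∣ ℚ.< ε
x <ʳ y = ∃[ ε ] 0ℚ ℚ.< ε × ∃[ N ] ∀ n → N ℕ.≤ n → seq x n ℚ.+ ε ℚ.< seq y n
x ≤ʳ y = ∀ ε → 0ℚ ℚ.< ε → ∃[ N ] ∀ n → N ℕ.≤ n → seq x n ℚ.< seq y n ℚ.+ ε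

fromℚ : ℚ → ℝ
fromℚ q = mkℝ (λ _ → q) (const-cauchy q)

_+ʳ_ _*ʳ_ : ℝ → ℝ → ℝ
x +ʳ y = mkℝ (λ n → seq x n ℚ.+ seq y n) (add-cauchy {seq x} {seq y} (cauchy x) (cauchy y))
x *ʳ y = mkℝ (λ n → seq x n ℚ.* seq y n) (mul-cauchy {seq x} {seq y} (cauchy x) (cauchy y))

-ʳ_ : ℝ → ℝ
-ʳ x = mkℝ (λ n → ℚ.- seq x n) (neg-cauchy {seq x} (cauchy x))

record ℂ : Set where
  constructor _+i_
  field
    re im : ℝ
open ℂ public

infix  4 _≈_
infixl 6 _+_ _-_
infixl 7 _*_
infix  8 -_

_≈_ : ℂ → ℂ → Set
z ≈ w = re z ≈ʳ re w × im z ≈ʳ im w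

_+_ _*_ : ℂ → ℂ → ℂ
z + w = (re z +ʳ re w) +i (im z +ʳ im w)
z * w = (re z *ʳ re w +ʳ -ʳ (im z *ʳ im w)) +i (re z *ʳ im w +ʳ im z *ʳ re w)

-_ : ℂ → ℂ
- z = (-ʳ re z) +i (-ʳ im z)

_-_ : ℂ → ℂ → ℂ
z - w = z + (- w)

fromℝ : ℝ → ℂ
fromℝ x = x +i fromℚ 0ℚ

ofℚ : ℚ → ℂ
ofℚ q = fromℝ (fromℚ q)

ofℕ : ℕ → ℂ
ofℕ n = ofℚ (+ n ℚ./ 1)

0ℂ 1ℂ : ℂ
0ℂ = ofℚ 0ℚ
1ℂ = ofℚ 1ℚ

ℂ-rawRing : RawRing 0ℓ 0ℓ
ℂ-rawRing = record
  { Carrier = ℂ ; _≈_ = _≈_ ; _+_ = _+_ ; _*_ = _*_ ; -_ = -_ ; 0# = 0ℂ ; 1# = 1ℂ }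

open RawSemiringDefs (RawRing.rawSemiring ℂ-rawRing) public using (_^_)

-- The modulus enters only through the comparisons |z| < ε with ε a positive rational
-- and |u| ≤ ε |v|, which are stated with squares to avoid square roots.

∣_∣² : ℂ → ℝ
∣ z ∣² = re z *ʳ re z +ʳ im z *ʳ im z

∣_∣<_ : ℂ → ℚ → Set
∣ z ∣< ε = ∣ z ∣² <ʳ fromℚ (ε ℚ.* ε)

∣_∣≤_·∣_∣ : ℂ → ℚ → ℂ → Set
∣ u ∣≤ ε ·∣ v ∣ = ∣ u ∣² ≤ʳ fromℚ (ε ℚ.* ε) *ʳ ∣ v ∣²

partialSum : (ℕ → ℂ) → ℕ → ℂ
partialSum a zero    = 0ℂ
partialSum a (suc n) = partialSum a n + a n

HasSum : (ℕ → ℂ) → ℂ → Set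
HasSum a w = ∀ ε → 0ℚ ℚ.< ε → ∃[ N ] ∀ n → N ℕ.≤ n → ∣ partialSum a n - w ∣< ε

-- The quantities below are limits, so each is given by its graph: "IsF x y" reads
-- "F x is defined and equals y".

IsExp : ℂ → ℂ → Set
IsExp w = HasSum (λ k → ofℚ ((+ 1 ℚ./ (k !)) {{k ℕₚ.!≢0}}) * w ^ k)

-- The real logarithm.
IsLog : ℕ → ℝ → Set
IsLog r l = IsExp (fromℝ l) (ofℕ r)

-- r ^ s = exp (s log r)
IsPow : ℕ → ℂ → ℂ → Set
IsPow r s p = ∃[ l ] IsLog r l × IsExp (s * fromℝ l) p

-- ζ is only needed at integers r ≥ 2, where it is the sum of its Dirichlet series;
-- the index is shifted so that summation starts at n = 1.
IsZeta : ℕ → ℂ → Set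
IsZeta r = HasSum (λ n → ofℚ ((+ 1 ℚ./ (suc n ℕ.^ r)) {{ℕₚ.m^n≢0 (suc n) r}}))

-- c = ζ(r) / r ^ s; the equation determines c because r ^ s, an exponential, is invertible.
IsCoeff : ℂ → ℕ → ℂ → Set
IsCoeff s r c = ∃[ ζr ] ∃[ p ] IsZeta r ζr × IsPow r s p × c * p ≈ ζr

record 𝔻 : Set where
  constructor mk𝔻
  field
    point   : ℂ
    ∣point∣<1 : ∣ point ∣< 1ℚ
open 𝔻 public

-- f is the function log G_s on the unit disc.
IsLogG : ℂ → (𝔻 → ℂ) → Set
IsLogG s f = Σ[ c ∈ (ℕ → ℂ) ] (∀ r → 2 ℕ.≤ r → IsCoeff s r (c r)) ×
  (∀ (z : 𝔻) → HasSum (λ k → c (2 ℕ.+ k) * point z ^ (2 ℕ.+ k)) (f z))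

HasDerivAt : (𝔻 → ℂ) → 𝔻 → ℂ → Set
HasDerivAt f z d = ∀ ε → 0ℚ ℚ.< ε → ∃[ δ ] 0ℚ ℚ.< δ ×
  (∀ (w : 𝔻) → ∣ point w - point z ∣< δ →
    ∣ (f w - f z) - d * (point w - point z) ∣≤ ε ·∣ point w - point z ∣)

-- Put c(s, r) = ζ(r) / rˢ.  Since rˢ⁺¹ = r · rˢ, we have r c(s + 1, r) = c(s, r), so
-- differentiating log G_{s+1} term by term and multiplying by z gives log G_s.
--
-- The real logarithm of r is a sum of numbers log ((k + 1) / k) with k ≥ 8, each found by
-- a contraction from the power series of exp; it is unique because exp d ≥ 1 + d for
-- d ≥ 0.  The same decomposition shows that r ↦ |exp (− s log r)| grows at most
-- polynomially: the factor belonging to k is at most 1 + O(1 / k).  Hence the series for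
-- log G_s is dominated by a geometric one on each disc |z| ≤ θ < 1, and so is the series
-- τ in f(w) − f(z) − d (w − z) = (w − z)² τ, where d is the termwise derivative at z.
--
-- This argument only uses that ℂ is a complete normed ℚ-algebra with a notion of (positive)
-- real element.  A complex number is here a sequence of Gaussian rationals, so the ring laws
-- hold term by term.

module Submission where

open import Algebra.Bundles using (CommutativeRing)
import Algebra.Properties.CommutativeSemiring.Exp
import Algebra.Solver.Ring
import Algebra.Solver.Ring.AlmostCommutativeRing as ACR
import Data.Integer.Base as ℤ
import Data.Integer.Properties as ℤₚ
open import Data.Maybe.Base using (Maybe; just; nothing)
open import Data.Nat.Base as ℕ using (ℕ; zero; suc; _!; _⊔_)
import Data.Nat.Properties as ℕₚ
open import Data.Product using (∃-syntax; Σ-syntax; _×_; _,_; proj₁; proj₂)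
open import Data.Rational.Base as ℚ using (ℚ; 0ℚ; 1ℚ; ½; ∣_∣)
import Data.Rational.Properties as ℚₚ
open import Data.Rational.Solver using (module +-*-Solver)
import Data.Rational.Unnormalised.Base as ℚᵘ
import Data.Rational.Unnormalised.Properties as ℚᵘₚ
open import Data.Sum.Base using (_⊎_; inj₁; inj₂)
open import Function.Base using (_∘_; _$_)
open import Level using (0ℓ)
open import Relation.Binary.PropositionalEquality as ≡ using (_≡_)
open import Relation.Nullary using (yes; no; contradiction)

-- The definitions are graphs: `IsLogG` accepts any witnesses for ζ(r), log r and rˢ. The sign of a
-- real number cannot be decided, so that uniqueness rests on a sign test up to ε.
--
-- The number 8 comes from the contraction: log (1 + 1 / k) is sought in the disc of radius 2 / k,
-- and for k ≥ 8 this lies in the disc of radius ¼, where the divided differences of exp are within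
-- ½ of 1. Small r are reached by writing r = 8 r / 8, so that log r is the sum over 8 ≤ k < 8 r.
--
-- A crude exponent in the polynomial bound is good enough, because any power of r is absorbed by a
-- slightly larger geometric ratio. The modulus of rˢ is therefore never computed.
--
-- Since the norm is accessible only through rational upper bounds, all estimates are inequalities
-- in ℚ, and neither square roots nor an order on the reals is involved in them.

module Rational where
  open import Data.Rational.Base
  open import Data.Rational.Properties
  open import Algebra.Properties.Semiring.Exp (CommutativeRing.semiring +-*-commutativeRing) public using (_^_)
  open import Algebra.Properties.CommutativeSemiring.Exp (CommutativeRing.commutativeSemiring +-*-commutativeRing) using (^-distrib-*)
  open ≡ using (refl; sym; trans; cong; cong₂; subst; module ≡-Reasoning)
  open +-*-Solver using (solve; _:+_; _:*_; _:-_; :-_; _:=_; con)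

  -- Inequalities and quotients in ℚ.

  ≤-by : ∀ {a b} d → 0ℚ ≤ d → a + d ≡ b → a ≤ b
  ≤-by {a} d 0≤d refl = subst (_≤ a + d) (+-identityʳ a) (+-monoʳ-≤ a 0≤d)

  <-by : ∀ {a b} d → 0ℚ < d → a + d ≡ b → a < b
  <-by {a} d 0<d refl = subst (_< a + d) (+-identityʳ a) (+-monoʳ-< a 0<d)

  ≤⇒0≤ : ∀ {a b} → a ≤ b → 0ℚ ≤ b - a
  ≤⇒0≤ {a} {b} a≤b = subst (_≤ b - a) (+-inverseʳ a) (+-monoˡ-≤ (- a) a≤b)

  <⇒0< : ∀ {a b} → a < b → 0ℚ < b - a
  <⇒0< {a} {b} a<b = subst (_< b - a) (+-inverseʳ a) (+-monoˡ-< (- a) a<b)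

  0≤1 : 0ℚ ≤ 1ℚ
  0≤1 = <⇒≤ (positive⁻¹ 1ℚ)

  0<1 : 0ℚ < 1ℚ
  0<1 = positive⁻¹ 1ℚ

  0≤½ : 0ℚ ≤ ½
  0≤½ = <⇒≤ (positive⁻¹ ½)

  ½<1 : ½ < 1ℚ
  ½<1 = <-by ½ (positive⁻¹ ½) refl

  0≤+ : ∀ {a b} → 0ℚ ≤ a → 0ℚ ≤ b → 0ℚ ≤ a + b
  0≤+ = +-mono-≤

  0≤* : ∀ {a b} → 0ℚ ≤ a → 0ℚ ≤ b → 0ℚ ≤ a * b
  0≤* {a} {b} p q = nonNegative⁻¹ _ {{nonNeg*nonNeg⇒nonNeg a {{nonNegative p}} b {{nonNegative q}}}}

  0<+ : ∀ {a b} → 0ℚ < a → 0ℚ ≤ b → 0ℚ < a + b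
  0<+ = +-mono-<-≤

  0<* : ∀ {a b} → 0ℚ < a → 0ℚ < b → 0ℚ < a * b
  0<* {a} {b} p q = positive⁻¹ _ {{pos*pos⇒pos a {{positive p}} b {{positive q}}}}

  0<½* : ∀ {a} → 0ℚ < a → 0ℚ < ½ * a
  0<½* = 0<* (positive⁻¹ ½)

  ½+½ : ∀ a → ½ * a + ½ * a ≡ a
  ½+½ = solve 1 (λ a → con ½ :* a :+ con ½ :* a := a) refl

  ½*<  : ∀ {a} → 0ℚ < a → ½ * a < a
  ½*< {a} p = <-by (½ * a) (0<½* p) (½+½ a)

  *-monoˡ : ∀ c {a b} → 0ℚ ≤ c → a ≤ b → c * a ≤ c * b
  *-monoˡ c p = *-monoˡ-≤-nonNeg c {{nonNegative p}}

  *-monoʳ : ∀ c {a b} → 0ℚ ≤ c → a ≤ b → a * c ≤ b * c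
  *-monoʳ c p = *-monoʳ-≤-nonNeg c {{nonNegative p}}

  *-mono : ∀ {a b c d} → 0ℚ ≤ b → 0ℚ ≤ c → a ≤ b → c ≤ d → a * c ≤ b * d
  *-mono {a} {b} {c} 0≤b 0≤c a≤b c≤d = ≤-trans (*-monoʳ c 0≤c a≤b) (*-monoˡ b 0≤b c≤d)

  square-mono : ∀ {a b} → 0ℚ ≤ a → a ≤ b → a * a ≤ b * b
  square-mono 0≤a a≤b = *-mono (≤-trans 0≤a a≤b) 0≤a a≤b a≤b

  square-cancel-≤ : ∀ {a b} → 0ℚ ≤ b → a * a ≤ b * b → a ≤ b
  square-cancel-≤ {a} {b} 0≤b aa≤bb with a ≤? b
  ... | yes p = p
  ... | no a≰b = contradiction (<-≤-trans bb<aa aa≤bb) (<-irrefl refl)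
    where
    b<a = ≰⇒> a≰b
    bb<aa : b * b < a * a
    bb<aa = ≤-<-trans (*-monoˡ b 0≤b (<⇒≤ b<a))
      (*-monoˡ-<-pos a {{positive (≤-<-trans 0≤b b<a)}} b<a)

  0≤square : ∀ a → 0ℚ ≤ a * a
  0≤square a with ≤-total 0ℚ a
  ... | inj₁ p = 0≤* p p
  ... | inj₂ p = subst (0ℚ ≤_) (solve 1 (λ a → (:- a) :* (:- a) := a :* a) refl a) (0≤* q q)
    where q = neg-antimono-≤ p

  ≤-from-ε : ∀ {a b} → (∀ ε → 0ℚ < ε → a ≤ b + ε) → a ≤ b
  ≤-from-ε {a} {b} h with a ≤? b
  ... | yes p = p
  ... | no a≰b = contradiction (≤-<-trans (h ε 0<ε) b+ε<a) (<-irrefl refl)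
    where
    ε = ½ * (a - b)
    0<ε = 0<½* (<⇒0< (≰⇒> a≰b))
    b+ε<a : b + ε < a
    b+ε<a = <-by ε 0<ε
      (solve 2 (λ a b → b :+ con ½ :* (a :- b) :+ con ½ :* (a :- b) := a) refl a b)

  quotient : ∀ {B} → 0ℚ < B → ∀ a → ∃[ q ] B * q ≡ a
  quotient {B} 0<B a = 1/ B * a , (begin
    B * (1/ B * a)   ≡⟨ *-assoc B (1/ B) a ⟨
    B * 1/ B * a     ≡⟨ cong (_* a) (*-inverseʳ B) ⟩
    1ℚ * a           ≡⟨ *-identityˡ a ⟩
    a                ∎)
    where
    open ≡-Reasoning
    instance B≢0 = >-nonZero 0<B

  *-cancelˡ-0< : ∀ {B q} → 0ℚ < B → 0ℚ < B * q → 0ℚ < q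
  *-cancelˡ-0< {B} {q} 0<B p =
    *-cancelˡ-<-nonNeg B {{nonNegative (<⇒≤ 0<B)}} (subst (_< B * q) (sym (*-zeroʳ B)) p)

  opaque
    quotient-pos : ∀ {B ε} → 0ℚ < B → 0ℚ < ε → ∃[ q ] 0ℚ < q × B * q ≡ ε
    quotient-pos 0<B 0<ε with q , eq ← quotient 0<B _ =
      q , *-cancelˡ-0< 0<B (subst (0ℚ <_) (sym eq) 0<ε) , eq

  -- Natural numbers in ℚ

  opaque
    fromℕ : ℕ → ℚ
    fromℕ n = ℤ.+ n / 1

    recip : (m : ℕ) .{{_ : ℕ.NonZero m}} → ℚ
    recip m = ℤ.+ 1 / m

    fromℕ-≡ : ∀ n → fromℕ n ≡ ℤ.+ n / 1
    fromℕ-≡ n = refl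

    recip-≡ : ∀ m .{{_ : ℕ.NonZero m}} → recip m ≡ ℤ.+ 1 / m
    recip-≡ m = refl

  private
    toℚᵘ-fromℕ : ∀ n → toℚᵘ (fromℕ n) ℚᵘ.≃ ℚᵘ.mkℚᵘ (ℤ.+ n) 0
    toℚᵘ-fromℕ n = subst (λ q → toℚᵘ q ℚᵘ.≃ ℚᵘ.mkℚᵘ (ℤ.+ n) 0) (sym (fromℕ-≡ n)) (toℚᵘ-fromℚᵘ (ℚᵘ.mkℚᵘ (ℤ.+ n) 0))

    toℚᵘ-recip : ∀ d → toℚᵘ (recip (suc d)) ℚᵘ.≃ ℚᵘ.mkℚᵘ (ℤ.+ 1) d
    toℚᵘ-recip d = subst (λ q → toℚᵘ q ℚᵘ.≃ ℚᵘ.mkℚᵘ (ℤ.+ 1) d) (sym (recip-≡ (suc d))) (toℚᵘ-fromℚᵘ (ℚᵘ.mkℚᵘ (ℤ.+ 1) d))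

  fromℕ-0 : fromℕ 0 ≡ 0ℚ
  fromℕ-0 = fromℕ-≡ 0

  fromℕ-1 : fromℕ 1 ≡ 1ℚ
  fromℕ-1 = fromℕ-≡ 1

  fromℕ-+ : ∀ m n → fromℕ (m ℕ.+ n) ≡ fromℕ m + fromℕ n
  fromℕ-+ m n = toℚᵘ-injective (begin
    toℚᵘ (fromℕ (m ℕ.+ n))                    ≈⟨ toℚᵘ-fromℕ (m ℕ.+ n) ⟩
    ℚᵘ.mkℚᵘ (ℤ.+ (m ℕ.+ n)) 0                   ≈⟨ ℚᵘ.*≡* (cong (ℤ._* ℤ.+ 1) (sym (cong₂ ℤ._+_ (ℤₚ.*-identityʳ (ℤ.+ m)) (ℤₚ.*-identityʳ (ℤ.+ n))))) ⟩
    ℚᵘ.mkℚᵘ (ℤ.+ m) 0 ℚᵘ.+ ℚᵘ.mkℚᵘ (ℤ.+ n) 0      ≈⟨ ℚᵘₚ.+-cong (toℚᵘ-fromℕ m) (toℚᵘ-fromℕ n) ⟨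
    toℚᵘ (fromℕ m) ℚᵘ.+ toℚᵘ (fromℕ n)        ≈⟨ toℚᵘ-homo-+ (fromℕ m) (fromℕ n) ⟨
    toℚᵘ (fromℕ m + fromℕ n)                  ∎)
    where open import Relation.Binary.Reasoning.Setoid ℚᵘₚ.≃-setoid

  fromℕ-suc : ∀ n → fromℕ (suc n) ≡ 1ℚ + fromℕ n
  fromℕ-suc n = trans (fromℕ-+ 1 n) (cong (_+ fromℕ n) fromℕ-1)

  fromℕ-* : ∀ m n → fromℕ (m ℕ.* n) ≡ fromℕ m * fromℕ n
  fromℕ-* zero n = trans fromℕ-0 (sym (trans (cong (_* fromℕ n) fromℕ-0) (*-zeroˡ (fromℕ n))))
  fromℕ-* (suc m) n = begin
    fromℕ (n ℕ.+ m ℕ.* n)          ≡⟨ fromℕ-+ n (m ℕ.* n) ⟩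
    fromℕ n + fromℕ (m ℕ.* n)      ≡⟨ cong (fromℕ n +_) (fromℕ-* m n) ⟩
    fromℕ n + fromℕ m * fromℕ n    ≡⟨ solve 2 (λ m n → n :+ m :* n := (con 1ℚ :+ m) :* n) refl (fromℕ m) (fromℕ n) ⟩
    (1ℚ + fromℕ m) * fromℕ n       ≡⟨ cong (_* fromℕ n) (fromℕ-suc m) ⟨
    fromℕ (suc m) * fromℕ n        ∎
    where open ≡-Reasoning

  fromℕ-^ : ∀ m n → fromℕ (m ℕ.^ n) ≡ fromℕ m ^ n
  fromℕ-^ m zero = fromℕ-1
  fromℕ-^ m (suc n) = trans (fromℕ-* m (m ℕ.^ n)) (cong (fromℕ m *_) (fromℕ-^ m n))

  0≤fromℕ : ∀ n → 0ℚ ≤ fromℕ n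
  0≤fromℕ zero = ≤-reflexive (sym fromℕ-0)
  0≤fromℕ (suc n) = subst (0ℚ ≤_) (sym (fromℕ-suc n)) (0≤+ 0≤1 (0≤fromℕ n))

  0<fromℕ-suc : ∀ n → 0ℚ < fromℕ (suc n)
  0<fromℕ-suc n = subst (0ℚ <_) (sym (fromℕ-suc n)) (0<+ 0<1 (0≤fromℕ n))

  1≤fromℕ-suc : ∀ n → 1ℚ ≤ fromℕ (suc n)
  1≤fromℕ-suc n = ≤-by (fromℕ n) (0≤fromℕ n) (sym (fromℕ-suc n))

  fromℕ-mono : ∀ {m n} → m ℕ.≤ n → fromℕ m ≤ fromℕ n
  fromℕ-mono {m} {n} m≤n = ≤-by (fromℕ (n ℕ.∸ m)) (0≤fromℕ _)
    (trans (sym (fromℕ-+ m (n ℕ.∸ m))) (cong fromℕ (ℕₚ.m+[n∸m]≡n m≤n)))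

  opaque
    archimedean : ∀ q → ∃[ n ] q ≤ fromℕ n
    archimedean (mkℚ (ℤ.+ n) d c) = n , toℚᵘ-cancel-≤ (ℚᵘₚ.≤-trans
      (ℚᵘ.*≤* (ℤₚ.≤-trans (ℤₚ.≤-reflexive (ℤₚ.*-identityʳ (ℤ.+ n)))
        (ℤₚ.≤-trans (ℤ.+≤+ (ℕₚ.m≤m*n n (suc d))) (ℤₚ.≤-reflexive (ℤₚ.pos-* n (suc d))))))
      (ℚᵘₚ.≤-reflexive (ℚᵘₚ.≃-sym (toℚᵘ-fromℕ n))))
    archimedean q@(mkℚ (ℤ.-[1+ _ ]) _ _) = 0 , subst (q ≤_) (sym fromℕ-0) (<⇒≤ (negative⁻¹ q))

  recip-inverse : ∀ m .{{_ : ℕ.NonZero m}} → recip m * fromℕ m ≡ 1ℚ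
  recip-inverse (suc d) = toℚᵘ-injective (begin
    toℚᵘ (recip (suc d) * fromℕ (suc d))                ≈⟨ toℚᵘ-homo-* (recip (suc d)) (fromℕ (suc d)) ⟩
    toℚᵘ (recip (suc d)) ℚᵘ.* toℚᵘ (fromℕ (suc d))      ≈⟨ ℚᵘₚ.*-cong (toℚᵘ-recip d) (toℚᵘ-fromℕ (suc d)) ⟩
    ℚᵘ.mkℚᵘ (ℤ.+ 1) d ℚᵘ.* ℚᵘ.mkℚᵘ (ℤ.+ suc d) 0            ≈⟨ ℚᵘ.*≡* (ℤₚ.*-assoc (ℤ.+ 1) (ℤ.+ suc d) (ℤ.+ 1)) ⟩
    ℚᵘ.1ℚᵘ                                              ∎)
    where open import Relation.Binary.Reasoning.Setoid ℚᵘₚ.≃-setoid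

  0<recip : ∀ m .{{_ : ℕ.NonZero m}} → 0ℚ < recip m
  0<recip m@(suc d) = *-cancelˡ-0< (0<fromℕ-suc d)
    (subst (0ℚ <_) (sym (trans (*-comm (fromℕ m) (recip m)) (recip-inverse m))) 0<1)

  0≤recip : ∀ m .{{_ : ℕ.NonZero m}} → 0ℚ ≤ recip m
  0≤recip m = <⇒≤ (0<recip m)

  recip-unique : ∀ m .{{_ : ℕ.NonZero m}} {q} → q * fromℕ m ≡ 1ℚ → recip m ≡ q
  recip-unique m {q} eq = begin
    recip m                     ≡⟨ *-identityˡ (recip m) ⟨
    1ℚ * recip m                ≡⟨ cong (_* recip m) eq ⟨
    q * fromℕ m * recip m       ≡⟨ solve 3 (λ q m r → q :* m :* r := q :* (r :* m)) refl q (fromℕ m) (recip m) ⟩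
    q * (recip m * fromℕ m)     ≡⟨ cong (q *_) (recip-inverse m) ⟩
    q * 1ℚ                      ≡⟨ *-identityʳ q ⟩
    q                           ∎
    where open ≡-Reasoning

  recip-* : ∀ m n .{{_ : ℕ.NonZero m}} .{{_ : ℕ.NonZero n}} .{{_ : ℕ.NonZero (m ℕ.* n)}} →
    recip (m ℕ.* n) ≡ recip m * recip n
  recip-* m n = recip-unique (m ℕ.* n) (begin
    recip m * recip n * fromℕ (m ℕ.* n)            ≡⟨ cong (recip m * recip n *_) (fromℕ-* m n) ⟩
    recip m * recip n * (fromℕ m * fromℕ n)        ≡⟨ solve 4 (λ a b c d → a :* b :* (c :* d) := (a :* c) :* (b :* d)) refl (recip m) (recip n) (fromℕ m) (fromℕ n) ⟩
    (recip m * fromℕ m) * (recip n * fromℕ n)      ≡⟨ cong₂ _*_ (recip-inverse m) (recip-inverse n) ⟩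
    1ℚ                                             ∎)
    where open ≡-Reasoning

  recip-antimono : ∀ {m n} .{{_ : ℕ.NonZero m}} .{{_ : ℕ.NonZero n}} → m ℕ.≤ n → recip n ≤ recip m
  recip-antimono {m} {n} m≤n = ≤-by (recip m * recip n * (fromℕ n - fromℕ m))
    (0≤* (0≤* (0≤recip m) (0≤recip n)) (≤⇒0≤ (fromℕ-mono m≤n)))
    (begin
      recip n + recip m * recip n * (fromℕ n - fromℕ m)
        ≡⟨ solve 4 (λ a b c d → b :+ a :* b :* (d :- c) := b :+ (b :* d) :* a :- (a :* c) :* b) refl (recip m) (recip n) (fromℕ m) (fromℕ n) ⟩
      recip n + (recip n * fromℕ n) * recip m - (recip m * fromℕ m) * recip n
        ≡⟨ cong₂ (λ u v → recip n + u * recip m - v * recip n) (recip-inverse n) (recip-inverse m) ⟩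
      recip n + 1ℚ * recip m - 1ℚ * recip n
        ≡⟨ solve 2 (λ a b → b :+ con 1ℚ :* a :- con 1ℚ :* b := a) refl (recip m) (recip n) ⟩
      recip m ∎)
    where open ≡-Reasoning

  recip-telescoping : ∀ n → recip (suc n ℕ.* suc (suc n)) ≡ recip (suc n) - recip (suc (suc n))
  recip-telescoping n = begin
    recip (suc n ℕ.* suc (suc n))            ≡⟨ recip-* (suc n) (suc (suc n)) ⟩
    a * b                                    ≡⟨ solve 3 (λ a b m → a :* b := a :* ((con 1ℚ :+ m) :* b) :- a :* m :* b) refl a b (fromℕ (suc n)) ⟩
    a * ((1ℚ + m) * b) - a * m * b           ≡⟨ cong₂ (λ u v → a * u - v * b) (trans (cong (_* b) (sym (fromℕ-suc (suc n)))) (trans (*-comm _ b) (recip-inverse (suc (suc n))))) (recip-inverse (suc n)) ⟩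
    a * 1ℚ - 1ℚ * b                          ≡⟨ cong₂ _-_ (*-identityʳ a) (*-identityˡ b) ⟩
    a - b                                    ∎
    where
    open ≡-Reasoning
    a = recip (suc n)
    b = recip (suc (suc n))
    m = fromℕ (suc n)

  recip≤1 : ∀ m .{{_ : ℕ.NonZero m}} → recip m ≤ 1ℚ
  recip≤1 m@(suc _) = ≤-trans (recip-antimono {1} {m} (ℕ.s≤s ℕ.z≤n)) (≤-reflexive (recip-≡ 1))

  -- Sequences tending to zero

  Null : (ℕ → ℚ) → Set
  Null t = ∀ ε → 0ℚ < ε → ∃[ N ] ∀ n → N ℕ.≤ n → t n ≤ ε

  Null-mono : ∀ {s t} → (∀ n → s n ≤ t n) → Null t → Null s
  Null-mono s≤t h ε 0<ε with N , k ← h ε 0<ε = N , λ n N≤n → ≤-trans (s≤t n) (k n N≤n)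

  Null-*ˡ : ∀ {t} c → 0ℚ ≤ c → Null t → Null (λ n → c * t n)
  Null-*ˡ {t} c 0≤c h ε 0<ε =
    let η , 0<η , eq = quotient-pos {1ℚ + c} (0<+ {1ℚ} {c} 0<1 0≤c) 0<ε
        N , k = h η 0<η
    in N , λ n N≤n → begin
      c * t n          ≤⟨ *-monoˡ c 0≤c (k n N≤n) ⟩
      c * η            ≤⟨ ≤-by η (<⇒≤ 0<η) (solve 2 (λ c η → c :* η :+ η := (con 1ℚ :+ c) :* η) refl c η) ⟩
      (1ℚ + c) * η     ≡⟨ eq ⟩
      ε                ∎
    where open ≤-Reasoning

  Null-recip : Null (λ n → recip (suc n))
  Null-recip ε 0<ε =
    let q , eq = quotient 0<ε 1ℚ
        N , q≤N = archimedean q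
    in N , λ n N≤n →
      let q≤n : q ≤ fromℕ (suc n)
          q≤n = ≤-trans q≤N (fromℕ-mono (ℕₚ.m≤n⇒m≤1+n N≤n)) in begin
      recip (suc n)                              ≡⟨ *-identityˡ _ ⟨
      1ℚ * recip (suc n)                         ≡⟨ cong (_* recip (suc n)) eq ⟨
      ε * q * recip (suc n)                      ≤⟨ *-monoʳ _ (0≤recip (suc n)) (*-monoˡ ε (<⇒≤ 0<ε) q≤n) ⟩
      ε * fromℕ (suc n) * recip (suc n)          ≡⟨ solve 3 (λ e m r → e :* m :* r := e :* (r :* m)) refl ε (fromℕ (suc n)) (recip (suc n)) ⟩
      ε * (recip (suc n) * fromℕ (suc n))        ≡⟨ cong (ε *_) (recip-inverse (suc n)) ⟩
      ε * 1ℚ                                     ≡⟨ *-identityʳ ε ⟩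
      ε                                          ∎
    where open ≤-Reasoning

  -- Powers

  0≤^ : ∀ {q} → 0ℚ ≤ q → ∀ n → 0ℚ ≤ q ^ n
  0≤^ 0≤q zero = 0≤1
  0≤^ 0≤q (suc n) = 0≤* 0≤q (0≤^ 0≤q n)

  ^-mono : ∀ {p q} → 0ℚ ≤ p → p ≤ q → ∀ n → p ^ n ≤ q ^ n
  ^-mono 0≤p p≤q zero = ≤-refl
  ^-mono 0≤p p≤q (suc n) = *-mono (≤-trans 0≤p p≤q) (0≤^ 0≤p n) p≤q (^-mono 0≤p p≤q n)

  ^≤1 : ∀ {q} → 0ℚ ≤ q → q ≤ 1ℚ → ∀ n → q ^ n ≤ 1ℚ
  ^≤1 0≤q q≤1 zero = ≤-refl
  ^≤1 0≤q q≤1 (suc n) = *-mono 0≤1 (0≤^ 0≤q n) q≤1 (^≤1 0≤q q≤1 n)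

  1≤^ : ∀ {q} → 1ℚ ≤ q → ∀ n → 1ℚ ≤ q ^ n
  1≤^ 1≤q zero = ≤-refl
  1≤^ {q} 1≤q (suc n) = *-mono (≤-trans 0≤1 1≤q) 0≤1 1≤q (1≤^ 1≤q n)

  -- Serves with y = 1 / k: a factor 1 + D / k is at most ((k + 1) / k)^D, and a product of such
  -- factors telescopes.
  bernoulli : ∀ {y} → 0ℚ ≤ y → ∀ n → 1ℚ + fromℕ n * y ≤ (1ℚ + y) ^ n
  bernoulli {y} 0≤y zero = ≤-reflexive (trans (cong (λ m → 1ℚ + m * y) fromℕ-0)
    (solve 1 (λ y → con 1ℚ :+ con 0ℚ :* y := con 1ℚ) refl y))
  bernoulli {y} 0≤y (suc n) = begin
    1ℚ + fromℕ (suc n) * y            ≡⟨ cong (λ m → 1ℚ + m * y) (fromℕ-suc n) ⟩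
    1ℚ + (1ℚ + fromℕ n) * y           ≤⟨ ≤-by (fromℕ n * (y * y)) (0≤* (0≤fromℕ n) (0≤square y))
                                          (solve 2 (λ m y → con 1ℚ :+ (con 1ℚ :+ m) :* y :+ m :* (y :* y) := (con 1ℚ :+ y) :* (con 1ℚ :+ m :* y)) refl (fromℕ n) y) ⟩
    (1ℚ + y) * (1ℚ + fromℕ n * y)     ≤⟨ *-monoˡ (1ℚ + y) (0≤+ 0≤1 0≤y) (bernoulli 0≤y n) ⟩
    (1ℚ + y) * (1ℚ + y) ^ n           ∎
    where open ≤-Reasoning

  -- For 0 ≤ θ ≤ τ, the mean value inequality τⁿ⁺¹ − θⁿ⁺¹ ≥ (n + 1) θⁿ (τ − θ).
  ^-tangent : ∀ {θ τ} → 0ℚ ≤ θ → θ ≤ τ → ∀ n →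
    fromℕ (suc n) * θ ^ n * (τ - θ) + θ ^ suc n ≤ τ ^ suc n
  ^-tangent {θ} {τ} 0≤θ θ≤τ zero = ≤-reflexive (trans
    (cong (λ m → m * 1ℚ * (τ - θ) + θ * 1ℚ) fromℕ-1)
    (solve 2 (λ θ τ → con 1ℚ :* con 1ℚ :* (τ :- θ) :+ θ :* con 1ℚ := τ :* con 1ℚ) refl θ τ))
  ^-tangent {θ} {τ} 0≤θ θ≤τ (suc n) = begin
    fromℕ (suc (suc n)) * (θ * θ ^ n) * (τ - θ) + θ * (θ * θ ^ n)
      ≡⟨ cong (λ m → m * (θ * θ ^ n) * (τ - θ) + θ * (θ * θ ^ n)) (fromℕ-suc (suc n)) ⟩
    (1ℚ + fromℕ (suc n)) * (θ * θ ^ n) * (τ - θ) + θ * (θ * θ ^ n)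
      ≡⟨ solve 4 (λ m θ t τ → (con 1ℚ :+ m) :* (θ :* t) :* (τ :- θ) :+ θ :* (θ :* t)
           := θ :* (m :* t :* (τ :- θ) :+ θ :* t) :+ (τ :- θ) :* (θ :* t)) refl (fromℕ (suc n)) θ (θ ^ n) τ ⟩
    θ * (fromℕ (suc n) * θ ^ n * (τ - θ) + θ ^ suc n) + (τ - θ) * θ ^ suc n
      ≤⟨ +-mono-≤ (*-monoˡ θ 0≤θ (^-tangent 0≤θ θ≤τ n)) (*-monoˡ (τ - θ) (≤⇒0≤ θ≤τ) (^-mono 0≤θ θ≤τ (suc n))) ⟩
    θ * τ ^ suc n + (τ - θ) * τ ^ suc n
      ≡⟨ solve 3 (λ θ τ t → θ :* t :+ (τ :- θ) :* t := τ :* t) refl θ τ (τ ^ suc n) ⟩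
    τ * τ ^ suc n ∎
    where open ≤-Reasoning

  -- Drop the term θⁿ⁺¹ from the mean value inequality and divide by τ - θ. So M = 1 / (τ - θ), and
  -- the surplus factor τ on the right is at most 1.
  linear*geometric : ∀ {θ τ} → 0ℚ ≤ θ → θ < τ → τ ≤ 1ℚ →
    ∃[ M ] 0ℚ ≤ M × ∀ n → fromℕ (suc n) * θ ^ n ≤ M * τ ^ n
  linear*geometric {θ} {τ} 0≤θ θ<τ τ≤1 =
    let M , 0<M , eq = quotient-pos (<⇒0< θ<τ) 0<1
    in M , <⇒≤ 0<M , λ n → begin
      fromℕ (suc n) * θ ^ n
        ≡⟨ *-identityˡ _ ⟨
      1ℚ * (fromℕ (suc n) * θ ^ n)
        ≡⟨ cong (_* (fromℕ (suc n) * θ ^ n)) eq ⟨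
      (τ - θ) * M * (fromℕ (suc n) * θ ^ n)
        ≡⟨ solve 4 (λ d M m t → d :* M :* (m :* t) := M :* (m :* t :* d)) refl (τ - θ) M (fromℕ (suc n)) (θ ^ n) ⟩
      M * (fromℕ (suc n) * θ ^ n * (τ - θ))
        ≤⟨ *-monoˡ M (<⇒≤ 0<M) (≤-by (θ ^ suc n) (0≤^ 0≤θ (suc n)) refl) ⟩
      M * (fromℕ (suc n) * θ ^ n * (τ - θ) + θ ^ suc n)
        ≤⟨ *-monoˡ M (<⇒≤ 0<M) (^-tangent 0≤θ (<⇒≤ θ<τ) n) ⟩
      M * τ ^ suc n
        ≤⟨ *-monoˡ M (<⇒≤ 0<M) (*-monoʳ (τ ^ n) (0≤^ (≤-trans 0≤θ (<⇒≤ θ<τ)) n) τ≤1) ⟩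
      M * (1ℚ * τ ^ n)
        ≡⟨ cong (M *_) (*-identityˡ (τ ^ n)) ⟩
      M * τ ^ n ∎
    where open ≤-Reasoning

  -- With τ = 1 the previous estimate bounds (n + 1) θⁿ, so θⁿ is at most a multiple of 1 / (n + 1).
  Null-geometric : ∀ {θ} → 0ℚ ≤ θ → θ < 1ℚ → Null (θ ^_)
  Null-geometric {θ} 0≤θ θ<1 = Null-mono bound (Null-*ˡ M 0≤M Null-recip)
    where
    open ≤-Reasoning
    L = linear*geometric 0≤θ θ<1 ≤-refl
    M = proj₁ L
    0≤M = proj₁ (proj₂ L)
    h = proj₂ (proj₂ L)
    1^n : ∀ n → 1ℚ ^ n ≤ 1ℚ
    1^n = ^≤1 0≤1 ≤-refl
    bound : ∀ n → θ ^ n ≤ M * recip (suc n)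
    bound n = begin
      θ ^ n                                         ≡⟨ *-identityˡ _ ⟨
      1ℚ * θ ^ n                                    ≡⟨ cong (_* θ ^ n) (recip-inverse (suc n)) ⟨
      recip (suc n) * fromℕ (suc n) * θ ^ n         ≡⟨ *-assoc (recip (suc n)) _ _ ⟩
      recip (suc n) * (fromℕ (suc n) * θ ^ n)       ≤⟨ *-monoˡ _ (0≤recip (suc n)) (≤-trans (h n) (*-monoˡ M 0≤M (1^n n))) ⟩
      recip (suc n) * (M * 1ℚ)                      ≡⟨ solve 2 (λ r M → r :* (M :* con 1ℚ) := M :* r) refl (recip (suc n)) M ⟩
      M * recip (suc n)                             ∎

  midpoint : ∀ {θ} → 0ℚ ≤ θ → θ < 1ℚ → ∃[ τ ] 0ℚ ≤ τ × θ < τ × τ < 1ℚ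
  midpoint {θ} 0≤θ θ<1 = τ , ≤-trans 0≤θ (<⇒≤ θ<τ) , θ<τ ,
    <-by δ 0<δ (solve 1 (λ θ → θ :+ con ½ :* (con 1ℚ :- θ) :+ con ½ :* (con 1ℚ :- θ) := con 1ℚ) refl θ)
    where
    δ = ½ * (1ℚ - θ)
    0<δ = 0<½* (<⇒0< θ<1)
    τ = θ + δ
    θ<τ = <-by δ 0<δ refl

  Null-linear*geometric : ∀ {θ} → 0ℚ ≤ θ → θ < 1ℚ → Null (λ n → fromℕ n * θ ^ n)
  Null-linear*geometric {θ} 0≤θ θ<1 =
    let τ , 0≤τ , θ<τ , τ<1 = midpoint 0≤θ θ<1
        M , 0≤M , h = linear*geometric 0≤θ θ<τ (<⇒≤ τ<1)
    in
    Null-mono (λ n → ≤-trans (*-monoʳ _ (0≤^ 0≤θ n) (fromℕ-mono (ℕₚ.n≤1+n n))) (h n))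
      (Null-*ˡ M 0≤M (Null-geometric 0≤τ τ<1))

  -- Subexponential growth, in the form in which it is applied: β is absorbed by any geometric
  -- sequence at the cost of a constant and of a larger ratio that is still below 1.
  Slow : (ℕ → ℚ) → Set
  Slow β = ∀ θ → 0ℚ ≤ θ → θ < 1ℚ →
    ∃[ C ] ∃[ τ ] 0ℚ ≤ C × 0ℚ ≤ τ × τ < 1ℚ × (∀ n → β n * θ ^ n ≤ C * τ ^ n)

  Slow-linear : ∀ {β} → (∀ n → 0ℚ ≤ β n) → Slow β → Slow (λ n → β n * fromℕ (suc n))
  Slow-linear {β} 0≤β slow θ 0≤θ θ<1 =
    let τ , 0≤τ , θ<τ , τ<1 = midpoint 0≤θ θ<1
        M , 0≤M , h = linear*geometric 0≤θ θ<τ (<⇒≤ τ<1)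
        C , σ , 0≤C , 0≤σ , σ<1 , k = slow τ 0≤τ τ<1
    in
    M * C , σ , 0≤* 0≤M 0≤C , 0≤σ , σ<1 , λ n → begin
      β n * fromℕ (suc n) * θ ^ n       ≡⟨ *-assoc (β n) _ _ ⟩
      β n * (fromℕ (suc n) * θ ^ n)     ≤⟨ *-monoˡ (β n) (0≤β n) (h n) ⟩
      β n * (M * τ ^ n)                 ≡⟨ solve 3 (λ b M t → b :* (M :* t) := M :* (b :* t)) refl (β n) M (τ ^ n) ⟩
      M * (β n * τ ^ n)                 ≤⟨ *-monoˡ M 0≤M (k n) ⟩
      M * (C * σ ^ n)                   ≡⟨ *-assoc M C (σ ^ n) ⟨
      M * C * σ ^ n                     ∎
    where open ≤-Reasoning

  opaque
    Slow-polynomial : ∀ {C} → 0ℚ ≤ C → ∀ d → Slow (λ n → C * fromℕ (suc n) ^ d)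
    Slow-polynomial {C} 0≤C zero θ 0≤θ θ<1 = C , θ , 0≤C , 0≤θ , θ<1 ,
      λ n → ≤-reflexive (cong (_* θ ^ n) (*-identityʳ C))
    Slow-polynomial {C} 0≤C (suc d) θ 0≤θ θ<1 =
      let B , σ , 0≤B , 0≤σ , σ<1 , k = Slow-linear (λ n → 0≤* 0≤C (0≤^ (0≤fromℕ (suc n)) d)) (Slow-polynomial 0≤C d) θ 0≤θ θ<1
      in
      B , σ , 0≤B , 0≤σ , σ<1 , λ n → ≤-trans (≤-reflexive (cong (_* θ ^ n)
        (solve 3 (λ C m p → C :* (m :* p) := C :* p :* m) refl C (fromℕ (suc n)) (fromℕ (suc n) ^ d)))) (k n)

  -- Factorials dominate powers

  -- Up to exponent n the factor `n ℕ.^ n` alone suffices; from there on every new factor n on the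
  -- left meets a factor at least n of the factorial.
  ^≤^*! : ∀ n k → n ℕ.^ k ℕ.≤ n ℕ.^ n ℕ.* k !
  ^≤^*! zero zero = ℕₚ.≤-refl
  ^≤^*! zero (suc k) = ℕ.z≤n
  ^≤^*! n@(suc m) zero = ℕₚ.≤-trans (ℕₚ.m^n>0 n n) (ℕₚ.≤-reflexive (sym (ℕₚ.*-identityʳ (n ℕ.^ n))))
  ^≤^*! n@(suc m) (suc k) with ℕₚ.≤-total (suc k) n
  ... | inj₁ k<n = ℕₚ.≤-trans (ℕₚ.^-monoʳ-≤ n k<n) (ℕₚ.m≤m*n (n ℕ.^ n) (suc k !) {{suc k ℕₚ.!≢0}})
  ... | inj₂ n≤k = begin
    n ℕ.* n ℕ.^ k                      ≤⟨ ℕₚ.*-mono-≤ n≤k (^≤^*! n k) ⟩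
    suc k ℕ.* (n ℕ.^ n ℕ.* k !)        ≡⟨ ℕₚ.*-assoc (suc k) (n ℕ.^ n) (k !) ⟨
    suc k ℕ.* n ℕ.^ n ℕ.* k !          ≡⟨ cong (ℕ._* k !) (ℕₚ.*-comm (suc k) (n ℕ.^ n)) ⟩
    n ℕ.^ n ℕ.* suc k ℕ.* k !          ≡⟨ ℕₚ.*-assoc (n ℕ.^ n) (suc k) (k !) ⟩
    n ℕ.^ n ℕ.* (suc k ℕ.* k !)        ∎
    where open ℕₚ.≤-Reasoning

  recip! : ℕ → ℚ
  recip! k = recip (k !) {{k ℕₚ.!≢0}}

  0≤recip! : ∀ k → 0ℚ ≤ recip! k
  0≤recip! k = 0≤recip (k !) {{k ℕₚ.!≢0}}

  recip!≤1 : ∀ k → recip! k ≤ 1ℚ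
  recip!≤1 k = recip≤1 (k !) {{k ℕₚ.!≢0}}

  recip!-suc : ∀ k → fromℕ (suc k) * recip! (suc k) ≡ recip! k
  recip!-suc k = begin
    fromℕ (suc k) * recip! (suc k)
      ≡⟨ cong (fromℕ (suc k) *_) (recip-* (suc k) (k !) {{_}} {{k ℕₚ.!≢0}} {{suc k ℕₚ.!≢0}}) ⟩
    fromℕ (suc k) * (recip (suc k) * recip! k)
      ≡⟨ solve 3 (λ a b c → a :* (b :* c) := (b :* a) :* c) refl (fromℕ (suc k)) (recip (suc k)) (recip! k) ⟩
    recip (suc k) * fromℕ (suc k) * recip! k
      ≡⟨ cong (_* recip! k) (recip-inverse (suc k)) ⟩
    1ℚ * recip! k
      ≡⟨ *-identityˡ (recip! k) ⟩
    recip! k ∎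
    where open ≡-Reasoning

  -- Since (2 n)ᵏ / k! is at most (2 n)^(2 n), the terms nᵏ / k! decay like ½ᵏ from the very start.
  -- The price for a ratio that does not depend on n is this large constant.
  expBound : ℕ → ℚ
  expBound n = fromℕ ((2 ℕ.* n) ℕ.^ (2 ℕ.* n))

  recip!*^≤ : ∀ n k → recip! k * fromℕ n ^ k ≤ expBound n * ½ ^ k
  recip!*^≤ n k = begin
    recip! k * fromℕ n ^ k                             ≡⟨ cong (λ m → recip! k * m ^ k) (trans (solve 1 (λ m → m := (con (1ℚ + 1ℚ) :* m) :* con ½) refl (fromℕ n))
                                                           (cong (λ t → t * fromℕ n * ½) (sym (fromℕ-≡ 2)))) ⟩
    recip! k * (fromℕ 2 * fromℕ n * ½) ^ k             ≡⟨ cong (λ m → recip! k * (m * ½) ^ k) (fromℕ-* 2 n) ⟨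
    recip! k * (fromℕ (2 ℕ.* n) * ½) ^ k               ≡⟨ cong (recip! k *_) (^-distrib-* (fromℕ (2 ℕ.* n)) ½ k) ⟩
    recip! k * (fromℕ (2 ℕ.* n) ^ k * ½ ^ k)           ≡⟨ cong (λ m → recip! k * (m * ½ ^ k)) (fromℕ-^ (2 ℕ.* n) k) ⟨
    recip! k * (fromℕ ((2 ℕ.* n) ℕ.^ k) * ½ ^ k)       ≤⟨ *-monoˡ (recip! k) (0≤recip! k) (*-monoʳ (½ ^ k) (0≤^ 0≤½ k) (fromℕ-mono (^≤^*! (2 ℕ.* n) k))) ⟩
    recip! k * (fromℕ ((2 ℕ.* n) ℕ.^ (2 ℕ.* n) ℕ.* k !) * ½ ^ k)
      ≡⟨ cong (λ m → recip! k * (m * ½ ^ k)) (fromℕ-* ((2 ℕ.* n) ℕ.^ (2 ℕ.* n)) (k !)) ⟩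
    recip! k * (expBound n * fromℕ (k !) * ½ ^ k)
      ≡⟨ solve 4 (λ r e f h → r :* (e :* f :* h) := (r :* f) :* (e :* h)) refl (recip! k) (expBound n) (fromℕ (k !)) (½ ^ k) ⟩
    recip! k * fromℕ (k !) * (expBound n * ½ ^ k)      ≡⟨ cong (_* (expBound n * ½ ^ k)) (recip-inverse (k !) {{k ℕₚ.!≢0}}) ⟩
    1ℚ * (expBound n * ½ ^ k)                          ≡⟨ *-identityˡ _ ⟩
    expBound n * ½ ^ k                                 ∎
    where open ≤-Reasoning

open Rational renaming (_^_ to _^ℚ_)

-- Axioms of a complete normed ℚ-algebra with real elements.

-- The norm is given by its rational upper bounds: ‖ x ‖≤ q says that the norm of x is at most q.
record CompleteNormedAlgebra : Set₁ where
  infix 4 ‖_‖≤_ _⟶_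
  field
    commutativeRing : CommutativeRing 0ℓ 0ℓ
  open CommutativeRing commutativeRing public
  field
    ι     : ℚ → Carrier
    ι-+   : ∀ p q → ι (p ℚ.+ q) ≈ ι p + ι q
    ι-*   : ∀ p q → ι (p ℚ.* q) ≈ ι p * ι q
    ι-neg : ∀ p → ι (ℚ.- p) ≈ - ι p
    ι-0   : ι 0ℚ ≈ 0#
    ι-1   : ι 1ℚ ≈ 1#

    ‖_‖≤_     : Carrier → ℚ → Set
    ‖‖-nonNeg : ∀ {x q} → ‖ x ‖≤ q → 0ℚ ℚ.≤ q
    ‖‖-resp   : ∀ {x y q} → x ≈ y → ‖ x ‖≤ q → ‖ y ‖≤ q
    ‖‖-mono   : ∀ {x p q} → p ℚ.≤ q → ‖ x ‖≤ p → ‖ x ‖≤ q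
    ‖‖-+      : ∀ {x y p q} → ‖ x ‖≤ p → ‖ y ‖≤ q → ‖ x + y ‖≤ p ℚ.+ q
    ‖‖-*      : ∀ {x y p q} → ‖ x ‖≤ p → ‖ y ‖≤ q → ‖ x * y ‖≤ p ℚ.* q
    ‖‖-ι      : ∀ q → ‖ ι q ‖≤ ∣ q ∣
    ‖‖-closed : ∀ {x q} → (∀ ε → 0ℚ ℚ.< ε → ‖ x ‖≤ q ℚ.+ ε) → ‖ x ‖≤ q
    ‖‖-finite : ∀ x → ∃[ q ] ‖ x ‖≤ q
    ‖‖-zero   : ∀ {x} → ‖ x ‖≤ 0ℚ → x ≈ 0#

  _⟶_ : (ℕ → Carrier) → Carrier → Set
  x ⟶ y = ∀ ε → 0ℚ ℚ.< ε → ∃[ N ] ∀ n → N ℕ.≤ n → ‖ x n - y ‖≤ ε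

  field
    complete : ∀ x → (∀ ε → 0ℚ ℚ.< ε → ∃[ N ] ∀ m n → N ℕ.≤ m → N ℕ.≤ n → ‖ x m - x n ‖≤ ε) →
      ∃[ y ] x ⟶ y

    Real      : Carrier → Set
    Real-resp : ∀ {x y} → x ≈ y → Real x → Real y
    Real-+    : ∀ {x y} → Real x → Real y → Real (x + y)
    Real-*    : ∀ {x y} → Real x → Real y → Real (x * y)
    Real-ι    : ∀ q → Real (ι q)
    Real-lim  : ∀ {x y} → (∀ n → Real (x n)) → x ⟶ y → Real y

    NonNeg       : Carrier → Set
    NonNeg-+     : ∀ {x y} → NonNeg x → NonNeg y → NonNeg (x + y)
    NonNeg-*     : ∀ {x y} → NonNeg x → NonNeg y → NonNeg (x * y)
    NonNeg-ι     : ∀ {q} → 0ℚ ℚ.≤ q → NonNeg (ι q)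
    NonNeg-resp  : ∀ {x y} → x ≈ y → NonNeg x → NonNeg y
    -- Monotonicity of the norm on nonnegative elements; it lets the excess exp d - 1 bound its
    -- summand d.
    ‖‖-NonNeg    : ∀ {x y q} → NonNeg x → NonNeg y → ‖ x + y ‖≤ q → ‖ x ‖≤ q
    -- Constructive substitute for the trichotomy: elements too close to zero for their sign to be
    -- seen fall under the first alternative.
    Real-sign    : ∀ {x} → Real x → ∀ ε → 0ℚ ℚ.< ε → ‖ x ‖≤ ε ⊎ NonNeg x ⊎ NonNeg (- x)

-- Limits and series in a complete normed algebra.

module Analysis (A : CompleteNormedAlgebra) where
  open CompleteNormedAlgebra A public
  open Algebra.Properties.CommutativeSemiring.Exp commutativeSemiring public
    using (_^_; ^-congˡ; ^-distrib-*)
  open import Relation.Binary.Reasoning.Setoid setoid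

  private
    almostCommutativeRing = ACR.fromCommutativeRing commutativeRing

    ι-morphism : CommutativeRing.rawRing ℚₚ.+-*-commutativeRing ACR.-Raw-AlmostCommutative⟶ almostCommutativeRing
    ι-morphism = record
      { ⟦_⟧ = ι ; +-homo = ι-+ ; *-homo = ι-* ; -‿homo = ι-neg ; 0-homo = ι-0 ; 1-homo = ι-1 }

    ι-≟ : ∀ p q → Maybe (ι p ≈ ι q)
    ι-≟ p q with p ℚₚ.≟ q
    ... | yes p≡q = just (reflexive (≡.cong ι p≡q))
    ... | no _ = nothing

  open Algebra.Solver.Ring (CommutativeRing.rawRing ℚₚ.+-*-commutativeRing) almostCommutativeRing ι-morphism ι-≟ public
    using (solve; _:+_; _:*_; _:-_; :-_; _:=_; con; _:^_; Polynomial)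

  -- The literal 1#, which differs syntactically from con 1ℚ.
  one : ∀ {n} → Polynomial n
  one = con 0ℚ :^ 0

  private module ℚS = +-*-Solver

  ι-cong : ∀ {p q} → p ≡ q → ι p ≈ ι q
  ι-cong p≡q = reflexive (≡.cong ι p≡q)

  ‖ι‖ : ∀ {q} → 0ℚ ℚ.≤ q → ‖ ι q ‖≤ q
  ‖ι‖ {q} 0≤q = ≡.subst (‖ ι q ‖≤_) (ℚₚ.0≤p⇒∣p∣≡p 0≤q) (‖‖-ι q)

  ‖1‖ : ‖ 1# ‖≤ 1ℚ
  ‖1‖ = ‖‖-resp ι-1 (‖ι‖ 0≤1)

  ‖0‖ : ∀ {q} → 0ℚ ℚ.≤ q → ‖ 0# ‖≤ q
  ‖0‖ 0≤q = ‖‖-mono 0≤q (‖‖-resp ι-0 (‖ι‖ ℚₚ.≤-refl))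

  ‖‖-neg : ∀ {x q} → ‖ x ‖≤ q → ‖ - x ‖≤ q
  ‖‖-neg {x} {q} h = ‖‖-resp (solve 1 (λ x → con (ℚ.- 1ℚ) :* x := :- x) refl x)
    (‖‖-mono (ℚₚ.≤-reflexive (ℚₚ.*-identityˡ q)) (‖‖-* (‖‖-ι (ℚ.- 1ℚ)) h))

  ‖‖-- : ∀ {x y p q} → ‖ x ‖≤ p → ‖ y ‖≤ q → ‖ x - y ‖≤ p ℚ.+ q
  ‖‖-- h k = ‖‖-+ h (‖‖-neg k)

  ‖‖-swap : ∀ {x y q} → ‖ x - y ‖≤ q → ‖ y - x ‖≤ q
  ‖‖-swap {x} {y} h = ‖‖-resp (solve 2 (λ x y → :- (x :- y) := y :- x) refl x y) (‖‖-neg h)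

  ‖‖-triangle : ∀ {x z p q} y → ‖ x - y ‖≤ p → ‖ y - z ‖≤ q → ‖ x - z ‖≤ p ℚ.+ q
  ‖‖-triangle {x} {z} y h k =
    ‖‖-resp (solve 3 (λ x y z → (x :- y) :+ (y :- z) := x :- z) refl x y z) (‖‖-+ h k)

  ‖‖-^ : ∀ {x q} → ‖ x ‖≤ q → ∀ n → ‖ x ^ n ‖≤ q ^ℚ n
  ‖‖-^ h zero = ‖1‖
  ‖‖-^ h (suc n) = ‖‖-* h (‖‖-^ h n)

  ‖‖-finiteℕ : ∀ x → ∃[ n ] ‖ x ‖≤ fromℕ n
  ‖‖-finiteℕ x = let q , h = ‖‖-finite x
                     n , q≤n = archimedean q
                 in n , ‖‖-mono q≤n h

  x-y≈0⇒x≈y : ∀ {x y} → x - y ≈ 0# → x ≈ y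
  x-y≈0⇒x≈y {x} {y} h = begin
    x              ≈⟨ solve 2 (λ x y → x := (x :- y) :+ y) refl x y ⟩
    (x - y) + y    ≈⟨ +-congʳ h ⟩
    0# + y         ≈⟨ +-identityˡ y ⟩
    y              ∎

  ≈-from-ε : ∀ {x y} → (∀ ε → 0ℚ ℚ.< ε → ‖ x - y ‖≤ ε) → x ≈ y
  ≈-from-ε {x} {y} h = x-y≈0⇒x≈y (‖‖-zero (‖‖-closed λ ε 0<ε →
    ≡.subst (‖ x - y ‖≤_) (≡.sym (ℚₚ.+-identityˡ ε)) (h ε 0<ε)))

  x-0≈x : ∀ x → x - 0# ≈ x
  x-0≈x x = begin
    x - 0#      ≈⟨ +-congˡ (-‿cong ι-0) ⟨
    x - ι 0ℚ    ≈⟨ solve 1 (λ x → x :- con 0ℚ := x) refl x ⟩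
    x           ∎

  ≈⇒‖-‖≤ : ∀ {x y ε} → x ≈ y → 0ℚ ℚ.< ε → ‖ x - y ‖≤ ε
  ≈⇒‖-‖≤ {x} {y} x≈y 0<ε = ‖‖-resp (begin
    0#     ≈⟨ -‿inverseʳ y ⟨
    y - y  ≈⟨ +-congʳ x≈y ⟨
    x - y  ∎) (‖0‖ (ℚₚ.<⇒≤ 0<ε))

  Real-0 : Real 0#
  Real-0 = Real-resp ι-0 (Real-ι 0ℚ)

  Real-1 : Real 1#
  Real-1 = Real-resp ι-1 (Real-ι 1ℚ)

  Real-neg : ∀ {x} → Real x → Real (- x)
  Real-neg {x} h = Real-resp (solve 1 (λ x → con (ℚ.- 1ℚ) :* x := :- x) refl x) (Real-* (Real-ι (ℚ.- 1ℚ)) h)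

  -- Limits

  ⟶-const : ∀ {x y} → x ≈ y → (λ _ → x) ⟶ y
  ⟶-const x≈y ε 0<ε = 0 , λ _ _ → ≈⇒‖-‖≤ x≈y 0<ε

  ⟶-cong : ∀ {x y a b} → (∀ n → x n ≈ y n) → a ≈ b → x ⟶ a → y ⟶ b
  ⟶-cong x≈y a≈b h ε 0<ε = let N , k = h ε 0<ε in
    N , λ n N≤n → ‖‖-resp (+-cong (x≈y n) (-‿cong a≈b)) (k n N≤n)

  ⟶-unique : ∀ {x a b} → x ⟶ a → x ⟶ b → a ≈ b
  ⟶-unique {x} h k = ≈-from-ε λ ε 0<ε →
    let M , h′ = h (½ ℚ.* ε) (0<½* 0<ε)
        N , k′ = k (½ ℚ.* ε) (0<½* 0<ε)
    in ‖‖-mono (ℚₚ.≤-reflexive (½+½ ε)) (‖‖-triangle (x (M ⊔ N))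
         (‖‖-swap (h′ _ (ℕₚ.m≤m⊔n M N))) (k′ _ (ℕₚ.m≤n⊔m M N)))

  ⟶-+ : ∀ {x y a b} → x ⟶ a → y ⟶ b → (λ n → x n + y n) ⟶ a + b
  ⟶-+ {x} {y} {a} {b} h k ε 0<ε =
    let M , h′ = h (½ ℚ.* ε) (0<½* 0<ε)
        N , k′ = k (½ ℚ.* ε) (0<½* 0<ε)
    in M ⊔ N , λ n N≤n → ‖‖-mono (ℚₚ.≤-reflexive (½+½ ε)) $
         ‖‖-resp (solve 4 (λ x y a b → (x :- a) :+ (y :- b) := (x :+ y) :- (a :+ b)) refl (x n) (y n) a b)
           (‖‖-+ (h′ n (ℕₚ.m⊔n≤o⇒m≤o M N N≤n)) (k′ n (ℕₚ.m⊔n≤o⇒n≤o M N N≤n)))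

  ⟶-null : ∀ {x a t} → Null t → (∀ n → ‖ x n - a ‖≤ t n) → x ⟶ a
  ⟶-null null h ε 0<ε = let N , k = null ε 0<ε in N , λ n N≤n → ‖‖-mono (k n N≤n) (h n)

  ⟶-*ˡ : ∀ {x a} c → x ⟶ a → (λ n → c * x n) ⟶ c * a
  ⟶-*ˡ {x} {a} c h ε 0<ε =
    let B , ‖c‖≤B = ‖‖-finite c
        0≤B = ‖‖-nonNeg ‖c‖≤B
        η , 0<η , eq = quotient-pos {1ℚ ℚ.+ B} (0<+ 0<1 0≤B) 0<ε
        N , k = h η 0<η
        c≤ = ‖‖-mono (≤-by 1ℚ 0≤1 (ℚₚ.+-comm B 1ℚ)) ‖c‖≤B
    in N , λ n N≤n → ‖‖-mono (ℚₚ.≤-reflexive eq) $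
         ‖‖-resp (solve 3 (λ c x a → c :* (x :- a) := c :* x :- c :* a) refl c (x n) a) (‖‖-* c≤ (k n N≤n))

  ⟶-neg : ∀ {x a} → x ⟶ a → (λ n → - x n) ⟶ - a
  ⟶-neg {x} {a} h ε 0<ε = let N , k = h ε 0<ε in N , λ n N≤n →
    ‖‖-resp (solve 2 (λ x a → :- (x :- a) := (:- x) :- (:- a)) refl (x n) a) (‖‖-neg (k n N≤n))

  ⟶-suc : ∀ {x a} → x ⟶ a → (x ∘ suc) ⟶ a
  ⟶-suc h ε 0<ε = let N , k = h ε 0<ε in N , λ n N≤n → k (suc n) (ℕₚ.m≤n⇒m≤1+n N≤n)

  ‖‖-lim : ∀ {x a b q} N → (∀ n → N ℕ.≤ n → ‖ x n - b ‖≤ q) → x ⟶ a → ‖ a - b ‖≤ q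
  ‖‖-lim {x} {q = q} N h k = ‖‖-closed λ ε 0<ε →
    let M , k′ = k ε 0<ε
        n = N ⊔ M
    in ‖‖-mono (ℚₚ.≤-reflexive (ℚₚ.+-comm ε q))
         (‖‖-triangle (x n) (‖‖-swap (k′ n (ℕₚ.m≤n⊔m N M))) (h n (ℕₚ.m≤m⊔n N M)))

  -- Series

  partialSum : (ℕ → Carrier) → ℕ → Carrier
  partialSum a zero    = 0#
  partialSum a (suc n) = partialSum a n + a n

  -- A record, so that the type checker compares such statements without unfolding them.
  record HasSum (a : ℕ → Carrier) (w : Carrier) : Set where
    constructor hasSum
    field partialSum⟶ : partialSum a ⟶ w
  open HasSum public

  partialSum-cong : ∀ {a b} → (∀ k → a k ≈ b k) → ∀ n → partialSum a n ≈ partialSum b n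
  partialSum-cong a≈b zero = refl
  partialSum-cong a≈b (suc n) = +-cong (partialSum-cong a≈b n) (a≈b n)

  partialSum-+ : ∀ a b n → partialSum (λ k → a k + b k) n ≈ partialSum a n + partialSum b n
  partialSum-+ a b zero = sym (+-identityˡ 0#)
  partialSum-+ a b (suc n) = trans (+-congʳ (partialSum-+ a b n))
    (solve 4 (λ A B a b → (A :+ B) :+ (a :+ b) := (A :+ a) :+ (B :+ b)) refl (partialSum a n) (partialSum b n) (a n) (b n))

  partialSum-*ˡ : ∀ c a n → partialSum (λ k → c * a k) n ≈ c * partialSum a n
  partialSum-*ˡ c a zero = sym (zeroʳ c)
  partialSum-*ˡ c a (suc n) = trans (+-congʳ (partialSum-*ˡ c a n)) (sym (distribˡ c (partialSum a n) (a n)))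

  partialSum-suc : ∀ a n → partialSum a (suc n) ≈ a 0 + partialSum (a ∘ suc) n
  partialSum-suc a zero = +-comm 0# (a 0)
  partialSum-suc a (suc n) = trans (+-congʳ (partialSum-suc a n)) (+-assoc (a 0) _ _)

  HasSum-cong : ∀ {a b v w} → (∀ k → a k ≈ b k) → v ≈ w → HasSum a v → HasSum b w
  HasSum-cong a≈b v≈w (hasSum h) = hasSum (⟶-cong (partialSum-cong a≈b) v≈w h)

  HasSum-unique : ∀ {a v w} → HasSum a v → HasSum a w → v ≈ w
  HasSum-unique (hasSum h) (hasSum k) = ⟶-unique h k

  HasSum-+ : ∀ {a b v w} → HasSum a v → HasSum b w → HasSum (λ k → a k + b k) (v + w)
  HasSum-+ {a} {b} (hasSum h) (hasSum k) = hasSum (⟶-cong (λ n → sym (partialSum-+ a b n)) refl (⟶-+ h k))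

  HasSum-*ˡ : ∀ {a w} c → HasSum a w → HasSum (λ k → c * a k) (c * w)
  HasSum-*ˡ {a} c (hasSum h) = hasSum (⟶-cong (λ n → sym (partialSum-*ˡ c a n)) refl (⟶-*ˡ c h))

  HasSum-neg : ∀ {a w} → HasSum a w → HasSum (λ k → - a k) (- w)
  HasSum-neg {a} {w} h = HasSum-cong
    (λ k → solve 1 (λ x → con (ℚ.- 1ℚ) :* x := :- x) refl (a k))
    (solve 1 (λ x → con (ℚ.- 1ℚ) :* x := :- x) refl w) (HasSum-*ˡ (ι (ℚ.- 1ℚ)) h)

  HasSum-- : ∀ {a b v w} → HasSum a v → HasSum b w → HasSum (λ k → a k - b k) (v - w)
  HasSum-- h k = HasSum-+ h (HasSum-neg k)

  -- Comparison with the telescoping series ∑ (tₖ − tₖ₊₁).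
  telescoping-test : ∀ {a} (t : ℕ → ℚ) → Null t → (∀ k → 0ℚ ℚ.≤ t k) →
    (∀ k → ‖ a k ‖≤ t k ℚ.- t (suc k)) →
    ∃[ w ] HasSum a w × (∀ n → ‖ w - partialSum a n ‖≤ t n)
  telescoping-test {a} t null 0≤t h = w , hasSum S⟶w , λ n → ‖‖-lim n (λ m n≤m → tail n≤m) S⟶w
    where
    S = partialSum a

    tail-+ : ∀ n j → ‖ S (j ℕ.+ n) - S n ‖≤ t n ℚ.- t (j ℕ.+ n)
    tail-+ n zero = ‖‖-resp (sym (-‿inverseʳ (S n))) (‖0‖ (ℚₚ.≤-reflexive (≡.sym (ℚₚ.+-inverseʳ (t n)))))
    tail-+ n (suc j) = ‖‖-resp
      (solve 3 (λ x y z → (x :- z) :+ y := (x :+ y) :- z) refl (S (j ℕ.+ n)) (a (j ℕ.+ n)) (S n))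
      (‖‖-mono (ℚₚ.≤-reflexive (ℚS.solve 3 (λ x y z → (x ℚS.:- y) ℚS.:+ (y ℚS.:- z) ℚS.:= x ℚS.:- z) ≡.refl (t n) (t (j ℕ.+ n)) (t (suc j ℕ.+ n))))
        (‖‖-+ (tail-+ n j) (h (j ℕ.+ n))))

    tail : ∀ {n m} → n ℕ.≤ m → ‖ S m - S n ‖≤ t n
    tail {n} {m} n≤m = ≡.subst (λ i → ‖ S i - S n ‖≤ t n) (ℕₚ.m∸n+n≡m n≤m)
      (‖‖-mono (≤-by (t (m ℕ.∸ n ℕ.+ n)) (0≤t _) (ℚS.solve 2 (λ x y → x ℚS.:- y ℚS.:+ y ℚS.:= x) ≡.refl (t n) (t (m ℕ.∸ n ℕ.+ n))))
        (tail-+ n (m ℕ.∸ n)))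

    limit = complete S λ ε 0<ε →
      let N , t≤ = null (½ ℚ.* ε) (0<½* 0<ε) in
      N , λ m n N≤m N≤n → ‖‖-mono (ℚₚ.≤-reflexive (½+½ ε)) (‖‖-triangle (S N)
        (‖‖-mono (t≤ N ℕₚ.≤-refl) (tail N≤m)) (‖‖-swap (‖‖-mono (t≤ N ℕₚ.≤-refl) (tail N≤n))))

    w = proj₁ limit
    S⟶w = proj₂ limit

  -- The tail estimates at index 0 concern w minus the empty partial sum; this turns them into
  -- bounds on w.
  ‖sum‖≤ : ∀ {w q} → ‖ w - 0# ‖≤ q → ‖ w ‖≤ q
  ‖sum‖≤ {w = w} = ‖‖-resp (x-0≈x w)

  -- The factor 1 - θ in the hypothesis is what makes C θᵏ - C θᵏ⁺¹ the majorant. Thus C bounds the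
  -- whole sum, not the single terms.
  geometric-test : ∀ {a C θ} → 0ℚ ℚ.≤ C → 0ℚ ℚ.≤ θ → θ ℚ.< 1ℚ →
    (∀ k → ‖ a k ‖≤ C ℚ.* (1ℚ ℚ.- θ) ℚ.* θ ^ℚ k) →
    ∃[ w ] HasSum a w × (∀ n → ‖ w - partialSum a n ‖≤ C ℚ.* θ ^ℚ n)
  geometric-test {a} {C} {θ} 0≤C 0≤θ θ<1 h = telescoping-test (λ n → C ℚ.* θ ^ℚ n)
    (Null-*ˡ C 0≤C (Null-geometric 0≤θ θ<1)) (λ n → 0≤* 0≤C (0≤^ 0≤θ n))
    (λ k → ‖‖-mono (ℚₚ.≤-reflexive (ℚS.solve 3 (λ C θ t →
        C ℚS.:* (ℚS.con 1ℚ ℚS.:- θ) ℚS.:* t ℚS.:= C ℚS.:* t ℚS.:- C ℚS.:* (θ ℚS.:* t)) ≡.refl C θ (θ ^ℚ k)))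
      (h k))

  halving-test : ∀ {a C} → 0ℚ ℚ.≤ C → (∀ k → ‖ a k ‖≤ C ℚ.* ½ ^ℚ k) →
    ∃[ w ] HasSum a w × (∀ n → ‖ w - partialSum a n ‖≤ (C ℚ.+ C) ℚ.* ½ ^ℚ n)
  halving-test {a} {C} 0≤C h = geometric-test (0≤+ 0≤C 0≤C) 0≤½ ½<1 λ k → ‖‖-mono (ℚₚ.≤-reflexive
    (ℚS.solve 2 (λ C t → C ℚS.:* t ℚS.:= (C ℚS.:+ C) ℚS.:* (ℚS.con 1ℚ ℚS.:- ℚS.con ½) ℚS.:* t) ≡.refl C (½ ^ℚ k)))
    (h k)

¼ : ℚ
¼ = ½ ℚ.* ½

¼<1 : ¼ ℚ.< 1ℚ
¼<1 = ℚₚ.<-trans (½*< (ℚₚ.positive⁻¹ ½)) ½<1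

¼≤1 : ¼ ℚ.≤ 1ℚ
¼≤1 = ℚₚ.<⇒≤ ¼<1

-- The exponential series and its functional equation.

module Exponential (A : CompleteNormedAlgebra) where
  open Analysis A
  open import Relation.Binary.Reasoning.Setoid setoid
  private module ℚS = +-*-Solver

  ν : ℕ → Carrier
  ν n = ι (fromℕ n)

  ν-0 : ν 0 ≈ 0#
  ν-0 = trans (ι-cong fromℕ-0) ι-0

  ν-suc : ∀ n → ν (suc n) ≈ ι 1ℚ + ν n
  ν-suc n = trans (ι-cong (fromℕ-suc n)) (ι-+ 1ℚ (fromℕ n))

  recip-ν : ∀ n → ι (recip (suc n)) * ν (suc n) ≈ ι 1ℚ
  recip-ν n = trans (sym (ι-* _ _)) (ι-cong (recip-inverse (suc n)))

  ν-cancel : ∀ n {x y} → ν (suc n) * x ≈ ν (suc n) * y → x ≈ y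
  ν-cancel n {x} {y} h = begin
    x                                         ≈⟨ unscale x ⟩
    ι (recip (suc n)) * (ν (suc n) * x)       ≈⟨ *-congˡ h ⟩
    ι (recip (suc n)) * (ν (suc n) * y)       ≈⟨ unscale y ⟨
    y                                         ∎
    where
    unscale : ∀ x → x ≈ ι (recip (suc n)) * (ν (suc n) * x)
    unscale x = begin
      x                                         ≈⟨ solve 1 (λ x → x := con 1ℚ :* x) refl x ⟩
      ι 1ℚ * x                                  ≈⟨ *-congʳ (recip-ν n) ⟨
      ι (recip (suc n)) * ν (suc n) * x         ≈⟨ *-assoc _ _ x ⟩
      ι (recip (suc n)) * (ν (suc n) * x)       ∎

  -- Cauchy products

  -- The sum of x i · y (n - i), unfolded along x. Recursive calls shift x and leave y alone, so the
  -- inductions below generalise over x only.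
  conv : (ℕ → Carrier) → (ℕ → Carrier) → ℕ → Carrier
  conv x y zero    = x 0 * y 0
  conv x y (suc n) = x 0 * y (suc n) + conv (x ∘ suc) y n

  partialSum-conv : ∀ x y n → partialSum (conv x y) (suc n) ≈
    x 0 * partialSum y (suc n) + partialSum (conv (x ∘ suc) y) n
  partialSum-conv x y zero =
    trans (solve 3 (λ o x y → o :+ x :* y := x :* y :+ o) refl 0# (x 0) (y 0))
      (+-congʳ (*-congˡ (sym (+-identityˡ (y 0)))))
  partialSum-conv x y (suc n) = trans (+-congʳ (partialSum-conv x y n))
    (solve 5 (λ x S P y c → (x :* S :+ P) :+ (x :* y :+ c) := x :* (S :+ y) :+ (P :+ c)) refl
      (x 0) (partialSum y (suc n)) (partialSum (conv (x ∘ suc) y) n) (y (suc n)) (conv (x ∘ suc) y n))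

  -- The defect equals the sum over i < n of x i times the tail of y beyond its first n - i terms.
  -- Each of these n products is at most C ½ⁱ · E ½ⁿ⁻ⁱ = C E ½ⁿ. In the induction the shifted x
  -- satisfies its bound with C / 2.
  conv-defect : ∀ {x y b C E} n → (∀ i → ‖ x i ‖≤ C ℚ.* ½ ^ℚ i) →
    (∀ i → ‖ b - partialSum y i ‖≤ E ℚ.* ½ ^ℚ i) →
    ‖ partialSum x n * b - partialSum (conv x y) n ‖≤ fromℕ n ℚ.* ((C ℚ.* E) ℚ.* ½ ^ℚ n)
  conv-defect {b = b} {C} {E} zero hx hy = ‖‖-resp
    (trans (sym (-‿inverseʳ 0#)) (+-congʳ (sym (zeroˡ b))))
    (‖0‖ (ℚₚ.≤-reflexive (≡.sym (≡.trans (≡.cong (ℚ._* ((C ℚ.* E) ℚ.* 1ℚ)) fromℕ-0) (ℚₚ.*-zeroˡ (C ℚ.* E ℚ.* 1ℚ))))))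
  conv-defect {x} {y} {b} {C} {E} (suc n) hx hy = ‖‖-resp (begin
      x 0 * (b - Sy) + (Sx * b - P)             ≈⟨ solve 5 (λ x b Sy Sx P → x :* (b :- Sy) :+ (Sx :* b :- P) := (x :+ Sx) :* b :- (x :* Sy :+ P)) refl (x 0) b Sy Sx P ⟩
      (x 0 + Sx) * b - (x 0 * Sy + P)           ≈⟨ +-cong (*-congʳ (partialSum-suc x n)) (-‿cong (partialSum-conv x y n)) ⟨
      partialSum x (suc n) * b - partialSum (conv x y) (suc n) ∎)
    (‖‖-mono (ℚₚ.≤-reflexive bound)
      (‖‖-+ (‖‖-* (hx 0) (hy (suc n))) (conv-defect {C = C ℚ.* ½} {E} n hx′ hy)))
    where
    Sy = partialSum y (suc n)
    Sx = partialSum (x ∘ suc) n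
    P  = partialSum (conv (x ∘ suc) y) n
    hx′ : ∀ i → ‖ x (suc i) ‖≤ C ℚ.* ½ ℚ.* ½ ^ℚ i
    hx′ i = ‖‖-mono (ℚₚ.≤-reflexive (≡.sym (ℚₚ.*-assoc C ½ (½ ^ℚ i)))) (hx (suc i))
    bound : (C ℚ.* 1ℚ) ℚ.* (E ℚ.* (½ ℚ.* ½ ^ℚ n)) ℚ.+ fromℕ n ℚ.* ((C ℚ.* ½ ℚ.* E) ℚ.* ½ ^ℚ n)
      ≡ fromℕ (suc n) ℚ.* ((C ℚ.* E) ℚ.* (½ ℚ.* ½ ^ℚ n))
    bound = ≡.trans
      (ℚS.solve 4 (λ C E h m → (C ℚS.:* ℚS.con 1ℚ) ℚS.:* (E ℚS.:* (ℚS.con ½ ℚS.:* h)) ℚS.:+ m ℚS.:* ((C ℚS.:* ℚS.con ½ ℚS.:* E) ℚS.:* h)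
        ℚS.:= (ℚS.con 1ℚ ℚS.:+ m) ℚS.:* ((C ℚS.:* E) ℚS.:* (ℚS.con ½ ℚS.:* h))) ≡.refl C E (½ ^ℚ n) (fromℕ n))
      (≡.cong (ℚ._* ((C ℚ.* E) ℚ.* (½ ℚ.* ½ ^ℚ n))) (≡.sym (fromℕ-suc n)))

  -- The partial sums of the Cauchy product differ from `partialSum x n * b` by the defect, which is
  -- of order n / 2ⁿ.
  HasSum-conv : ∀ {x y a b C E} → 0ℚ ℚ.≤ C → 0ℚ ℚ.≤ E →
    HasSum x a → (∀ i → ‖ x i ‖≤ C ℚ.* ½ ^ℚ i) → (∀ i → ‖ b - partialSum y i ‖≤ E ℚ.* ½ ^ℚ i) →
    HasSum (conv x y) (a * b)
  HasSum-conv {x} {y} {a} {b} {C} {E} 0≤C 0≤E Σx hx hy = hasSum (⟶-cong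
    (λ n → solve 2 (λ u v → u :+ :- (u :- v) := v) refl (partialSum x n * b) (partialSum (conv x y) n))
    (begin
      b * a - 0#    ≈⟨ x-0≈x (b * a) ⟩
      b * a         ≈⟨ *-comm b a ⟩
      a * b         ∎)
    (⟶-+ (⟶-cong (λ n → *-comm b (partialSum x n)) refl (⟶-*ˡ b (partialSum⟶ Σx))) (⟶-neg defect⟶0)))
    where
    defect⟶0 : (λ n → partialSum x n * b - partialSum (conv x y) n) ⟶ 0#
    defect⟶0 = ⟶-null {t = λ n → (C ℚ.* E) ℚ.* (fromℕ n ℚ.* ½ ^ℚ n)}
      (Null-*ˡ (C ℚ.* E) (0≤* 0≤C 0≤E) (Null-linear*geometric 0≤½ ½<1))
      λ n → ‖‖-resp (sym (x-0≈x _))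
        (‖‖-mono (ℚₚ.≤-reflexive (ℚS.solve 4 (λ m C E h → m ℚS.:* ((C ℚS.:* E) ℚS.:* h) ℚS.:= (C ℚS.:* E) ℚS.:* (m ℚS.:* h)) ≡.refl (fromℕ n) C E (½ ^ℚ n)))
          (conv-defect {C = C} {E} n hx hy))

  -- A series xₖ with (m + k + 1) xₖ₊₁ = a xₖ behaves like ∑ aᵏ⁺ᵐ / (k + m)!; the
  -- offset m is what makes the induction go through.
  conv-step : ∀ a b {y} → (∀ j → ν (suc j) * y (suc j) ≈ b * y j) → ∀ n m {x} →
    (∀ i → (ν m + ν (suc i)) * x (suc i) ≈ a * x i) →
    (ν m + ν (suc n)) * conv x y (suc n) ≈ (a + b) * conv x y n + ν m * (x 0 * y (suc n))
  conv-step a b {y} hy zero m {x} hx = begin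
    (ν m + ν 1) * (x 0 * y 1 + x 1 * y 0)
      ≈⟨ solve 6 (λ m o x y x′ y′ → (m :+ o) :* (x :* y′ :+ x′ :* y) := x :* (o :* y′) :+ ((m :+ o) :* x′) :* y :+ m :* (x :* y′))
           refl (ν m) (ν 1) (x 0) (y 0) (x 1) (y 1) ⟩
    x 0 * (ν 1 * y 1) + ((ν m + ν 1) * x 1) * y 0 + ν m * (x 0 * y 1)
      ≈⟨ +-congʳ (+-cong (*-congˡ (hy 0)) (*-congʳ (hx 0))) ⟩
    x 0 * (b * y 0) + (a * x 0) * y 0 + ν m * (x 0 * y 1)
      ≈⟨ solve 5 (λ a b x y z → x :* (b :* y) :+ (a :* x) :* y :+ z := (a :+ b) :* (x :* y) :+ z) refl a b (x 0) (y 0) (ν m * (x 0 * y 1)) ⟩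
    (a + b) * (x 0 * y 0) + ν m * (x 0 * y 1) ∎
  conv-step a b {y} hy (suc n) m {x} hx = begin
    (ν m + ν (2 ℕ.+ n)) * (x 0 * y (2 ℕ.+ n) + c′)
      ≈⟨ solve 5 (λ m k x y c → (m :+ k) :* (x :* y :+ c) := x :* (k :* y) :+ m :* (x :* y) :+ (m :+ k) :* c)
           refl (ν m) (ν (2 ℕ.+ n)) (x 0) (y (2 ℕ.+ n)) c′ ⟩
    x 0 * (ν (2 ℕ.+ n) * y (2 ℕ.+ n)) + ν m * (x 0 * y (2 ℕ.+ n)) + (ν m + ν (2 ℕ.+ n)) * c′
      -- The weight m + (n + 2) is read as (m + 1) + (n + 1), so that the induction hypothesis
      -- applies to the shifted x with offset m + 1.
      ≈⟨ +-cong (+-congʳ (*-congˡ (hy (suc n)))) (*-congʳ (offset m (suc n))) ⟩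
    x 0 * (b * y (suc n)) + ν m * (x 0 * y (2 ℕ.+ n)) + (ν (suc m) + ν (suc n)) * c′
      ≈⟨ +-congˡ (conv-step a b hy n (suc m) (λ i → trans (*-congʳ (sym (offset m (suc i)))) (hx (suc i)))) ⟩
    x 0 * (b * y (suc n)) + ν m * (x 0 * y (2 ℕ.+ n)) + ((a + b) * c + ν (suc m) * (x 1 * y (suc n)))
      -- The recursion for x at index 0 replaces (m + 1) x₁ by a x₀; this supplies the a-part of (a
      -- + b) x₀ yₙ₊₁.
      ≈⟨ +-congˡ (+-congˡ (trans (sym (*-assoc _ (x 1) (y (suc n)))) (*-congʳ (trans (*-congʳ (trans (ν-suc m) m+1)) (hx 0))))) ⟩
    x 0 * (b * y (suc n)) + ν m * (x 0 * y (2 ℕ.+ n)) + ((a + b) * c + a * x 0 * y (suc n))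
      ≈⟨ solve 6 (λ a b x y z c → x :* (b :* y) :+ z :+ ((a :+ b) :* c :+ a :* x :* y) := (a :+ b) :* (x :* y :+ c) :+ z)
           refl a b (x 0) (y (suc n)) (ν m * (x 0 * y (2 ℕ.+ n))) c ⟩
    (a + b) * (x 0 * y (suc n) + c) + ν m * (x 0 * y (2 ℕ.+ n)) ∎
    where
    c  = conv (x ∘ suc) y n
    c′ = conv (x ∘ suc) y (suc n)
    m+1 : ι 1ℚ + ν m ≈ ν m + ν 1
    m+1 = trans (+-comm _ _) (+-congˡ (ι-cong (≡.sym fromℕ-1)))
    offset : ∀ m n → ν m + ν (suc n) ≈ ν (suc m) + ν n
    offset m n = begin
      ν m + ν (suc n)        ≈⟨ +-congˡ (ν-suc n) ⟩
      ν m + (ι 1ℚ + ν n)     ≈⟨ solve 2 (λ m n → m :+ (con 1ℚ :+ n) := (con 1ℚ :+ m) :+ n) refl (ν m) (ν n) ⟩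
      (ι 1ℚ + ν m) + ν n     ≈⟨ +-congʳ (ν-suc m) ⟨
      ν (suc m) + ν n        ∎

  opaque
    expTerm : Carrier → ℕ → Carrier
    expTerm w k = ι (recip! k) * w ^ k

    expTerm-≡ : ∀ w k → expTerm w k ≡ ι (recip! k) * w ^ k
    expTerm-≡ w k = ≡.refl

  expTerm-≈ : ∀ w k → expTerm w k ≈ ι (recip! k) * w ^ k
  expTerm-≈ w k = reflexive (expTerm-≡ w k)

  expTerm-0 : ∀ w → expTerm w 0 ≈ 1#
  expTerm-0 w = trans (expTerm-≈ w 0) (trans (*-identityʳ _) (trans (ι-cong (recip-≡ 1)) ι-1))

  expTerm-1 : ∀ w → expTerm w 1 ≈ w
  expTerm-1 w = trans (expTerm-≈ w 1) (trans (*-cong (trans (ι-cong (recip-≡ 1)) ι-1) (*-identityʳ w)) (*-identityˡ w))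

  expTerm-suc : ∀ w k → ν (suc k) * expTerm w (suc k) ≈ w * expTerm w k
  expTerm-suc w k = begin
    ν (suc k) * expTerm w (suc k)
      ≈⟨ *-congˡ (expTerm-≈ w (suc k)) ⟩
    ν (suc k) * (ι (recip! (suc k)) * (w * w ^ k))
      ≈⟨ solve 4 (λ n r w p → n :* (r :* (w :* p)) := w :* ((n :* r) :* p)) refl (ν (suc k)) (ι (recip! (suc k))) w (w ^ k) ⟩
    w * ((ν (suc k) * ι (recip! (suc k))) * w ^ k)
      ≈⟨ *-congˡ (*-congʳ (trans (sym (ι-* _ _)) (ι-cong (recip!-suc k)))) ⟩
    w * (ι (recip! k) * w ^ k)
      ≈⟨ *-congˡ (expTerm-≈ w k) ⟨
    w * expTerm w k ∎

  -- Both sides start with 1 and satisfy (n + 1) cₙ₊₁ = (a + b) cₙ, where n + 1 can be cancelled.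
  -- This takes the place of the binomial theorem.
  conv-expTerm : ∀ a b n → conv (expTerm a) (expTerm b) n ≈ expTerm (a + b) n
  conv-expTerm a b zero = trans (*-cong (expTerm-0 a) (expTerm-0 b)) (trans (*-identityˡ 1#) (sym (expTerm-0 (a + b))))
  conv-expTerm a b (suc n) = ν-cancel n (begin
    ν (suc n) * conv (expTerm a) (expTerm b) (suc n)
      ≈⟨ *-congʳ (drop (suc n)) ⟨
    (ν 0 + ν (suc n)) * conv (expTerm a) (expTerm b) (suc n)
      ≈⟨ conv-step a b (expTerm-suc b) n 0 (λ i → trans (*-congʳ (drop (suc i))) (expTerm-suc a i)) ⟩
    (a + b) * conv (expTerm a) (expTerm b) n + ν 0 * (expTerm a 0 * expTerm b (suc n))
      ≈⟨ +-congˡ (trans (*-congʳ ν-0) (zeroˡ _)) ⟩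
    (a + b) * conv (expTerm a) (expTerm b) n + 0#
      ≈⟨ +-identityʳ _ ⟩
    (a + b) * conv (expTerm a) (expTerm b) n
      ≈⟨ *-congˡ (conv-expTerm a b n) ⟩
    (a + b) * expTerm (a + b) n
      ≈⟨ expTerm-suc (a + b) n ⟨
    ν (suc n) * expTerm (a + b) (suc n) ∎)
    where
    drop : ∀ n → ν 0 + ν n ≈ ν n
    drop n = trans (+-congʳ ν-0) (+-identityˡ (ν n))

  expTerm-cong : ∀ {v w} → v ≈ w → ∀ k → expTerm v k ≈ expTerm w k
  expTerm-cong {v} {w} v≈w k = trans (expTerm-≈ v k) (trans (*-congˡ (^-congˡ k v≈w)) (sym (expTerm-≈ w k)))

  expTerm-bound : ∀ {w} n → ‖ w ‖≤ fromℕ n → ∀ k → ‖ expTerm w k ‖≤ expBound n ℚ.* ½ ^ℚ k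
  expTerm-bound {w} n h k = ‖‖-resp (sym (expTerm-≈ w k)) $ ‖‖-mono (recip!*^≤ n k) (‖‖-* (‖ι‖ (0≤recip! k)) (‖‖-^ h k))

  private
    exp-series : ∀ w → ∃[ C ] 0ℚ ℚ.≤ C × (∀ k → ‖ expTerm w k ‖≤ C ℚ.* ½ ^ℚ k) ×
      ∃[ v ] HasSum (expTerm w) v × (∀ n → ‖ v - partialSum (expTerm w) n ‖≤ (C ℚ.+ C) ℚ.* ½ ^ℚ n)
    exp-series w = let n , h = ‖‖-finiteℕ w in
      expBound n , 0≤fromℕ _ , expTerm-bound n h , halving-test (0≤fromℕ _) (expTerm-bound n h)

  opaque
    exp : Carrier → Carrier
    exp w = proj₁ (proj₂ (proj₂ (proj₂ (exp-series w))))

    exp-bounds : ∀ w → ∃[ C ] 0ℚ ℚ.≤ C × (∀ k → ‖ expTerm w k ‖≤ C ℚ.* ½ ^ℚ k) ×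
      HasSum (expTerm w) (exp w) × (∀ n → ‖ exp w - partialSum (expTerm w) n ‖≤ (C ℚ.+ C) ℚ.* ½ ^ℚ n)
    exp-bounds w = let C , 0≤C , h , _ , k = exp-series w in C , 0≤C , h , k

  exp-HasSum : ∀ w → HasSum (expTerm w) (exp w)
  exp-HasSum w = let _ , _ , _ , h , _ = exp-bounds w in h

  HasSum⇒≈exp : ∀ {w p} → HasSum (expTerm w) p → p ≈ exp w
  HasSum⇒≈exp {w} h = HasSum-unique h (exp-HasSum w)

  exp-cong : ∀ {v w} → v ≈ w → exp v ≈ exp w
  exp-cong {v} v≈w = HasSum⇒≈exp (HasSum-cong (expTerm-cong v≈w) refl (exp-HasSum v))

  exp-+ : ∀ a b → exp (a + b) ≈ exp a * exp b
  exp-+ a b =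
    let C , 0≤C , ha , Σa , _ = exp-bounds a
        E , 0≤E , _ , _ , hb = exp-bounds b
    in sym (HasSum⇒≈exp (HasSum-cong (conv-expTerm a b) refl (HasSum-conv {C = C} {E ℚ.+ E} 0≤C (0≤+ 0≤E 0≤E) Σa ha hb)))

  exp-Real : ∀ {w} → Real w → Real (exp w)
  exp-Real {w} r = Real-lim sum-Real (partialSum⟶ (exp-HasSum w))
    where
    ^-Real : ∀ k → Real (w ^ k)
    ^-Real zero = Real-1
    ^-Real (suc k) = Real-* r (^-Real k)
    sum-Real : ∀ n → Real (partialSum (expTerm w) n)
    sum-Real zero = Real-0
    sum-Real (suc n) = Real-+ (sum-Real n) (Real-resp (sym (expTerm-≈ w n)) (Real-* (Real-ι (recip! n)) (^-Real n)))

  -- The divided difference (wⁿ − zⁿ) / (w − z).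
  secant : Carrier → Carrier → ℕ → Carrier
  secant w z zero    = 0#
  secant w z (suc n) = w * secant w z n + z ^ n

  secant-eq : ∀ w z n → w ^ n - z ^ n ≈ (w - z) * secant w z n
  secant-eq w z zero = trans (-‿inverseʳ 1#) (sym (zeroʳ (w - z)))
  secant-eq w z (suc n) = begin
    w * w ^ n - z * z ^ n
      ≈⟨ solve 4 (λ w z p q → w :* p :- z :* q := w :* (p :- q) :+ (w :- z) :* q) refl w z (w ^ n) (z ^ n) ⟩
    w * (w ^ n - z ^ n) + (w - z) * z ^ n
      ≈⟨ +-congʳ (*-congˡ (secant-eq w z n)) ⟩
    w * ((w - z) * secant w z n) + (w - z) * z ^ n
      ≈⟨ solve 4 (λ w z s q → w :* ((w :- z) :* s) :+ (w :- z) :* q := (w :- z) :* (w :* s :+ q)) refl w z (secant w z n) (z ^ n) ⟩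
    (w - z) * (w * secant w z n + z ^ n) ∎

  secant-bound : ∀ {w z ρ} → ‖ w ‖≤ ρ → ‖ z ‖≤ ρ → ∀ n → ‖ secant w z (suc n) ‖≤ fromℕ (suc n) ℚ.* ρ ^ℚ n
  secant-bound {w} {z} hw hz zero = ‖‖-resp (trans (sym (+-identityˡ 1#)) (+-congʳ (sym (zeroʳ w))))
    (‖‖-mono (ℚₚ.≤-reflexive (≡.sym (≡.cong (ℚ._* 1ℚ) fromℕ-1))) ‖1‖)
  secant-bound {ρ = ρ} hw hz (suc n) = ‖‖-mono (ℚₚ.≤-reflexive bound) (‖‖-+ (‖‖-* hw (secant-bound hw hz n)) (‖‖-^ hz (suc n)))
    where
    bound : ρ ℚ.* (fromℕ (suc n) ℚ.* ρ ^ℚ n) ℚ.+ ρ ^ℚ suc n ≡ fromℕ (2 ℕ.+ n) ℚ.* ρ ^ℚ suc n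
    bound = ≡.trans (ℚS.solve 3 (λ r m p → r ℚS.:* (m ℚS.:* p) ℚS.:+ r ℚS.:* p ℚS.:= (ℚS.con 1ℚ ℚS.:+ m) ℚS.:* (r ℚS.:* p)) ≡.refl ρ (fromℕ (suc n)) (ρ ^ℚ n))
      (≡.cong (ℚ._* ρ ^ℚ suc n) (≡.sym (fromℕ-suc (suc n))))

  HasSum-suc : ∀ {a w} → HasSum a w → HasSum (a ∘ suc) (w - a 0)
  HasSum-suc {a} {w} (hasSum h) = hasSum $ ⟶-cong
    (λ n → trans (+-congʳ (partialSum-suc a n)) (solve 2 (λ x y → (x :+ y) :- x := y) refl (a 0) (partialSum (a ∘ suc) n)))
    refl (⟶-+ (⟶-suc h) (⟶-const (refl {x = - a 0})))

  expSecantTerm : Carrier → Carrier → ℕ → Carrier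
  expSecantTerm w z k = ι (recip! (suc k)) * secant w z (suc k)

  -- The n + 1 summands of a divided difference cancel one factor of the factorial, which leaves the
  -- terms of the series for exp ρ.
  expSecantTerm-bound : ∀ {w z ρ} → ‖ w ‖≤ ρ → ‖ z ‖≤ ρ → ∀ k → ‖ expSecantTerm w z k ‖≤ recip! k ℚ.* ρ ^ℚ k
  expSecantTerm-bound {ρ = ρ} hw hz k = ‖‖-mono
    (ℚₚ.≤-reflexive (≡.trans
      (ℚS.solve 3 (λ r m p → r ℚS.:* (m ℚS.:* p) ℚS.:= (m ℚS.:* r) ℚS.:* p) ≡.refl (recip! (suc k)) (fromℕ (suc k)) (ρ ^ℚ k))
      (≡.cong (ℚ._* ρ ^ℚ k) (recip!-suc k))))
    (‖‖-* (‖ι‖ (0≤recip! (suc k))) (secant-bound hw hz k))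

  exp-secant : ∀ {w z v} → HasSum (expSecantTerm w z) v → exp w - exp z ≈ (w - z) * v
  exp-secant {w} {z} {v} h = begin
    exp w - exp z
      -- Subtracting 1 - 1 makes the constant terms of the two series appear, so that `HasSum-suc`
      -- can remove them.
      ≈⟨ solve 2 (λ x e → x := (x :- (e :- e)) ) refl (exp w - exp z) 1# ⟩
    (exp w - exp z) - (1# - 1#)
      ≈⟨ +-congˡ (-‿cong (+-cong (expTerm-0 w) (-‿cong (expTerm-0 z)))) ⟨
    (exp w - exp z) - (expTerm w 0 - expTerm z 0)
      ≈⟨ HasSum-unique (HasSum-suc (HasSum-- (exp-HasSum w) (exp-HasSum z))) (HasSum-cong term refl (HasSum-*ˡ (w - z) h)) ⟩
    (w - z) * v ∎
    where
    term : ∀ k → (w - z) * expSecantTerm w z k ≈ expTerm w (suc k) - expTerm z (suc k)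
    term k = begin
      (w - z) * (ι (recip! (suc k)) * secant w z (suc k))
        ≈⟨ solve 3 (λ d r s → d :* (r :* s) := r :* (d :* s)) refl (w - z) (ι (recip! (suc k))) (secant w z (suc k)) ⟩
      ι (recip! (suc k)) * ((w - z) * secant w z (suc k))
        ≈⟨ *-congˡ (secant-eq w z (suc k)) ⟨
      ι (recip! (suc k)) * (w ^ suc k - z ^ suc k)
        ≈⟨ solve 3 (λ r a b → r :* (a :- b) := r :* a :- r :* b) refl (ι (recip! (suc k))) (w ^ suc k) (z ^ suc k) ⟩
      ι (recip! (suc k)) * w ^ suc k - ι (recip! (suc k)) * z ^ suc k
        ≈⟨ +-cong (expTerm-≈ w (suc k)) (-‿cong (expTerm-≈ z (suc k))) ⟨
      expTerm w (suc k) - expTerm z (suc k) ∎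

  -- A factorization instead of an inequality: v is the divided difference of exp, and any bound on
  -- w - z can be multiplied in afterwards.
  exp-lipschitz : ∀ {w z} n → ‖ w ‖≤ fromℕ n → ‖ z ‖≤ fromℕ n →
    ∃[ v ] exp w - exp z ≈ (w - z) * v × ‖ v ‖≤ expBound n ℚ.+ expBound n
  exp-lipschitz n hw hz =
    let v , h , k = halving-test (0≤fromℕ _) (λ k → ‖‖-mono (recip!*^≤ n k) (expSecantTerm-bound hw hz k))
    in v , exp-secant h , ‖sum‖≤ (‖‖-mono (ℚₚ.≤-reflexive (ℚₚ.*-identityʳ _)) (k 0))

  -- The divided difference begins with the term 1, and its further terms are at most ¼ᵏ. The
  -- constant 2 is generous for their majorant and makes the tail from k = 1 on come out as 2 · ¼ =
  -- ½.
  exp-near-identity : ∀ {w z} → ‖ w ‖≤ ¼ → ‖ z ‖≤ ¼ →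
    ∃[ v ] exp w - exp z ≈ (w - z) * v × ‖ v - 1# ‖≤ ½
  exp-near-identity {w} {z} hw hz =
    let v , h , k = geometric-test {C = 2ℚ} 0≤2 0≤¼ ¼<1
          (λ k → ‖‖-mono (*-monoʳ (¼ ^ℚ k) (0≤^ 0≤¼ k) (ℚₚ.≤-trans (recip!≤1 k) 1≤3/2)) (expSecantTerm-bound hw hz k))
    in v , exp-secant h , ‖‖-resp (+-congˡ (-‿cong first)) (‖‖-mono (ℚₚ.≤-reflexive 2*¼) (k 1))
    where
    2ℚ = 1ℚ ℚ.+ 1ℚ
    0≤2 : 0ℚ ℚ.≤ 2ℚ
    0≤2 = 0≤+ 0≤1 0≤1
    0≤¼ : 0ℚ ℚ.≤ ¼
    0≤¼ = 0≤* 0≤½ 0≤½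
    1≤3/2 : 1ℚ ℚ.≤ 2ℚ ℚ.* (1ℚ ℚ.- ¼)
    1≤3/2 = ≤-by ½ 0≤½ ≡.refl
    2*¼ : 2ℚ ℚ.* (¼ ℚ.* 1ℚ) ≡ ½
    2*¼ = ≡.refl
    first : 0# + ι (recip! 1) * (w * 0# + 1#) ≈ 1#
    first = begin
      0# + ι (recip! 1) * (w * 0# + 1#)    ≈⟨ +-identityˡ _ ⟩
      ι (recip! 1) * (w * 0# + 1#)         ≈⟨ *-cong (trans (ι-cong (recip-≡ 1)) ι-1) (+-congʳ (zeroʳ w)) ⟩
      1# * (0# + 1#)                       ≈⟨ *-identityˡ _ ⟩
      0# + 1#                              ≈⟨ +-identityˡ 1# ⟩
      1#                                   ∎

  exp-0 : exp 0# ≈ 1#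
  exp-0 = x-y≈0⇒x≈y (begin
    exp 0# - 1#                        ≈⟨ +-congˡ (-‿cong (expTerm-0 0#)) ⟨
    exp 0# - expTerm 0# 0              ≈⟨ HasSum-unique (HasSum-suc (exp-HasSum 0#)) (HasSum-cong (λ k → term k) (zeroˡ 0#) (HasSum-*ˡ 0# (HasSum-0))) ⟩
    0#                                 ∎)
    where
    HasSum-0 : HasSum (λ _ → 0#) 0#
    HasSum-0 = hasSum $ ⟶-cong zeros refl (⟶-const refl)
      where
      zeros : ∀ n → 0# ≈ partialSum (λ _ → 0#) n
      zeros zero = refl
      zeros (suc n) = trans (zeros n) (sym (+-identityʳ _))
    term : ∀ k → 0# * 0# ≈ expTerm 0# (suc k)
    term k = trans (zeroˡ 0#) (sym (trans (trans (expTerm-≈ 0# (suc k)) (*-congˡ (zeroˡ (0# ^ k)))) (zeroʳ _)))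

  exp-neg : ∀ a → exp (- a) * exp a ≈ 1#
  exp-neg a = begin
    exp (- a) * exp a   ≈⟨ exp-+ (- a) a ⟨
    exp (- a + a)       ≈⟨ exp-cong (-‿inverseˡ a) ⟩
    exp 0#              ≈⟨ exp-0 ⟩
    1#                  ∎

  -- Two bounds on the same w: n only fixes the Lipschitz constant, while q measures how far exp w
  -- is from 1. Keeping them apart is what yields factors 1 + O(1 / k).
  ‖exp‖≤ : ∀ {w q} n → ‖ w ‖≤ fromℕ n → ‖ w ‖≤ q → ‖ exp w ‖≤ 1ℚ ℚ.+ q ℚ.* (expBound n ℚ.+ expBound n)
  ‖exp‖≤ {w} {q} n h k =
    let v , eq , hv = exp-lipschitz n h (‖0‖ (0≤fromℕ n))
    in ‖‖-resp (begin
         1# + (w - 0#) * v              ≈⟨ +-cong exp-0 eq ⟨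
         exp 0# + (exp w - exp 0#)      ≈⟨ solve 2 (λ a b → a :+ (b :- a) := b) refl (exp 0#) (exp w) ⟩
         exp w                          ∎)
       (‖‖-+ ‖1‖ (‖‖-* {p = q} (‖‖-mono (ℚₚ.≤-reflexive (ℚₚ.+-identityʳ _)) (‖‖-- k (‖0‖ ℚₚ.≤-refl))) hv))

-- Existence and uniqueness of the logarithm of a positive integer.

module Logarithm (A : CompleteNormedAlgebra) where
  open Analysis A
  open Exponential A
  open import Relation.Binary.Reasoning.Setoid setoid
  private module ℚS = +-*-Solver

  exp-continuous : ∀ {x a} n → (∀ i → ‖ x i ‖≤ fromℕ n) → ‖ a ‖≤ fromℕ n → x ⟶ a → (exp ∘ x) ⟶ exp a
  exp-continuous {x} {a} n hx ha x⟶a ε 0<ε =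
    let E = expBound n ℚ.+ expBound n
        0≤E : 0ℚ ℚ.≤ E
        0≤E = 0≤+ (0≤fromℕ _) (0≤fromℕ _)
        η , 0<η , eq = quotient-pos {1ℚ ℚ.+ E} (0<+ {1ℚ} {E} 0<1 0≤E) 0<ε
        N , close = x⟶a η 0<η
    in N , λ i N≤i →
      let v , exp-eq , hv = exp-lipschitz n (hx i) ha
      in ‖‖-resp (sym exp-eq) (‖‖-mono (ℚₚ.≤-reflexive (≡.trans (ℚₚ.*-comm η (1ℚ ℚ.+ E)) eq))
           (‖‖-* (close i N≤i) (‖‖-mono (≤-by 1ℚ 0≤1 (ℚₚ.+-comm E 1ℚ)) hv)))

  -- The logarithm of 1 + α is the limit of the iteration y ↦ y + (1 + α − exp y), whose
  -- residual at least halves in each step because exp is close to the identity near 0.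
  module LogNearOne {α β} (‖α‖≤β : ‖ α ‖≤ β) (2β≤¼ : β ℚ.+ β ℚ.≤ ¼) where
    approximation : ℕ → Carrier
    residual : ℕ → Carrier
    approximation zero    = 0#
    approximation (suc n) = approximation n + residual n
    residual n = (1# + α) - exp (approximation n)

    private
      0≤β = ‖‖-nonNeg ‖α‖≤β
      0≤2β = 0≤+ 0≤β 0≤β

      ≤2β : ∀ n → (β ℚ.+ β) ℚ.- (β ℚ.+ β) ℚ.* ½ ^ℚ n ℚ.≤ β ℚ.+ β
      ≤2β n = ≤-by ((β ℚ.+ β) ℚ.* ½ ^ℚ n) (0≤* 0≤2β (0≤^ 0≤½ n))
        (ℚS.solve 2 (λ b h → (b ℚS.:- b ℚS.:* h) ℚS.:+ b ℚS.:* h ℚS.:= b) ≡.refl (β ℚ.+ β) (½ ^ℚ n))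

      -- This is 2 β (1 - ½ⁿ), the sum of the residual bounds β ½ʲ over j < n.
      bound : ℕ → ℚ
      bound n = (β ℚ.+ β) ℚ.- (β ℚ.+ β) ℚ.* ½ ^ℚ n

      bound-0 : 0ℚ ≡ bound 0
      bound-0 = ℚS.solve 1 (λ b → ℚS.con 0ℚ ℚS.:= b ℚS.:- b ℚS.:* ℚS.con 1ℚ) ≡.refl (β ℚ.+ β)

      bound-suc : ∀ n → bound n ℚ.+ β ℚ.* ½ ^ℚ n ≡ bound (suc n)
      bound-suc n = ℚS.solve 2 (λ b h →
        ((b ℚS.:+ b) ℚS.:- (b ℚS.:+ b) ℚS.:* h) ℚS.:+ b ℚS.:* h ℚS.:= (b ℚS.:+ b) ℚS.:- (b ℚS.:+ b) ℚS.:* (ℚS.con ½ ℚS.:* h)) ≡.refl β (½ ^ℚ n)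

      bound≤¼ : ∀ n → bound n ℚ.≤ ¼
      bound≤¼ n = ℚₚ.≤-trans (≤2β n) 2β≤¼

      halve : ∀ n → β ℚ.* ½ ^ℚ n ℚ.* ½ ≡ β ℚ.* ½ ^ℚ suc n
      halve n = ℚS.solve 2 (λ b h → (b ℚS.:* h) ℚS.:* ℚS.con ½ ℚS.:= b ℚS.:* (ℚS.con ½ ℚS.:* h)) ≡.refl β (½ ^ℚ n)

      approximation-suc-bound : ∀ n → ‖ residual n ‖≤ β ℚ.* ½ ^ℚ n → ‖ approximation n ‖≤ bound n →
        ‖ approximation (suc n) ‖≤ bound (suc n)
      approximation-suc-bound n hr hy = ≡.subst (‖ approximation (suc n) ‖≤_) (bound-suc n) (‖‖-+ hy hr)

      -- If v is the divided difference of exp between y and y + r, then the new residual is - r (v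
      -- - 1), and v - 1 has norm at most ½.
      residual-suc-bound : ∀ n → ‖ residual n ‖≤ β ℚ.* ½ ^ℚ n → ‖ approximation n ‖≤ bound n →
        ‖ residual (suc n) ‖≤ β ℚ.* ½ ^ℚ suc n
      residual-suc-bound n hr hy =
        let r = residual n
            y = approximation n
            v , eq , hv = exp-near-identity
              (‖‖-mono (bound≤¼ (suc n)) (approximation-suc-bound n hr hy)) (‖‖-mono (bound≤¼ n) hy)
        in ‖‖-resp (begin
               - (r * (v - 1#))
                 ≈⟨ solve 3 (λ r y v → :- (r :* (v :- one)) := r :- ((y :+ r) :- y) :* v) refl r y v ⟩
               r - ((y + r) - y) * v
                 ≈⟨ +-congˡ (-‿cong eq) ⟨
               r - (exp (y + r) - exp y)
                 ≈⟨ solve 3 (λ a e e′ → (a :- e) :- (e′ :- e) := a :- e′) refl (1# + α) (exp y) (exp (y + r)) ⟩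
               (1# + α) - exp (y + r) ∎)
             (≡.subst (‖ - (r * (v - 1#)) ‖≤_) (halve n) (‖‖-neg (‖‖-* hr hv)))

      invariant : ∀ n → ‖ residual n ‖≤ β ℚ.* ½ ^ℚ n × ‖ approximation n ‖≤ bound n
      invariant zero =
        ‖‖-resp (begin
            α                      ≈⟨ solve 1 (λ a → a := (one :+ a) :- one) refl α ⟩
            (1# + α) - 1#          ≈⟨ +-congˡ (-‿cong exp-0) ⟨
            (1# + α) - exp 0#      ∎)
          (‖‖-mono (ℚₚ.≤-reflexive (≡.sym (ℚₚ.*-identityʳ β))) ‖α‖≤β) ,
        ‖0‖ (ℚₚ.≤-reflexive bound-0)
      invariant (suc n) = let hr , hy = invariant n in
        residual-suc-bound n hr hy , approximation-suc-bound n hr hy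

      ∑residual : ∀ n → partialSum residual n ≈ approximation n
      ∑residual zero = refl
      ∑residual (suc n) = +-congʳ (∑residual n)

      limit = halving-test 0≤β (proj₁ ∘ invariant)

    logarithm : Carrier
    logarithm = proj₁ limit

    approximation⟶logarithm : approximation ⟶ logarithm
    approximation⟶logarithm = ⟶-cong ∑residual refl (partialSum⟶ (proj₁ (proj₂ limit)))

    logarithm-bound : ‖ logarithm ‖≤ β ℚ.+ β
    logarithm-bound = ‖sum‖≤ (‖‖-mono (ℚₚ.≤-reflexive (ℚₚ.*-identityʳ (β ℚ.+ β))) (proj₂ (proj₂ limit) 0))

    -- Two limits of the same sequence: exp of the approximations tends to exp of their limit by
    -- continuity, and to 1 + α because it differs from it by the residual.
    exp-logarithm : exp logarithm ≈ 1# + α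
    exp-logarithm = ⟶-unique
      (exp-continuous 1 (λ n → ‖‖-mono (ℚₚ.≤-trans (≤2β n) 2β≤1) (proj₂ (invariant n))) (‖‖-mono 2β≤1 logarithm-bound) approximation⟶logarithm)
      (⟶-cong (λ n → solve 2 (λ a e → a :- (a :- e) := e) refl (1# + α) (exp (approximation n))) (x-0≈x (1# + α))
        (⟶-+ (⟶-const refl) (⟶-neg residual⟶0)))
      where
      2β≤1 : β ℚ.+ β ℚ.≤ fromℕ 1
      2β≤1 = ℚₚ.≤-trans 2β≤¼ (≡.subst (¼ ℚ.≤_) (≡.sym fromℕ-1) ¼≤1)
      residual⟶0 : residual ⟶ 0#
      residual⟶0 = ⟶-null (Null-*ˡ β 0≤β (Null-geometric 0≤½ ½<1))
        (λ n → ‖‖-resp (sym (x-0≈x (residual n))) (proj₁ (invariant n)))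

    logarithm-Real : Real α → Real logarithm
    logarithm-Real Real-α = Real-lim approximation-Real approximation⟶logarithm
      where
      approximation-Real : ∀ n → Real (approximation n)
      approximation-Real zero = Real-0
      approximation-Real (suc n) = Real-+ (approximation-Real n)
        (Real-+ (Real-+ Real-1 Real-α) (Real-neg (exp-Real (approximation-Real n))))

  -- Sharp at j = 0, which is why the sum of logarithmic steps starts at 8.
  2/[8+j]≤¼ : ∀ j → recip (8 ℕ.+ j) ℚ.+ recip (8 ℕ.+ j) ℚ.≤ ¼
  2/[8+j]≤¼ j = ℚₚ.≤-trans (ℚₚ.+-mono-≤ h h)
    (ℚₚ.≤-reflexive (≡.cong (λ q → q ℚ.+ q) (recip-≡ 8)))
    where
    h : recip (8 ℕ.+ j) ℚ.≤ recip 8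
    h = recip-antimono {8} {8 ℕ.+ j} (ℕₚ.m≤m+n 8 j)

  2/[8+j]≤1 : ∀ j → recip (8 ℕ.+ j) ℚ.+ recip (8 ℕ.+ j) ℚ.≤ 1ℚ
  2/[8+j]≤1 j = ℚₚ.≤-trans (2/[8+j]≤¼ j) ¼≤1

  private
    module LogStep j = LogNearOne (‖ι‖ (0≤recip (8 ℕ.+ j))) (2/[8+j]≤¼ j)

  -- log ((9 + j) / (8 + j))
  logStep : ℕ → Carrier
  logStep = LogStep.logarithm

  logStep-bound : ∀ j → ‖ logStep j ‖≤ recip (8 ℕ.+ j) ℚ.+ recip (8 ℕ.+ j)
  logStep-bound = LogStep.logarithm-bound

  -- The product of the quotients (9 + j) / (8 + j) telescopes; the factor 8 on the left clears the
  -- denominator.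
  exp-∑logStep : ∀ m → ν 8 * exp (partialSum logStep m) ≈ ν (8 ℕ.+ m)
  exp-∑logStep zero = trans (*-congˡ exp-0) (*-identityʳ (ν 8))
  exp-∑logStep (suc m) = begin
    ν 8 * exp (S + logStep m)                         ≈⟨ *-congˡ (exp-+ S (logStep m)) ⟩
    ν 8 * (exp S * exp (logStep m))                   ≈⟨ *-assoc (ν 8) _ _ ⟨
    ν 8 * exp S * exp (logStep m)                     ≈⟨ *-cong (exp-∑logStep m) (LogStep.exp-logarithm m) ⟩
    ν (8 ℕ.+ m) * (1# + ι (recip (8 ℕ.+ m)))          ≈⟨ solve 2 (λ n r → n :* (one :+ r) := r :* n :+ n) refl (ν (8 ℕ.+ m)) (ι (recip (8 ℕ.+ m))) ⟩
    ι (recip (8 ℕ.+ m)) * ν (8 ℕ.+ m) + ν (8 ℕ.+ m)   ≈⟨ +-congʳ (recip-ν (7 ℕ.+ m)) ⟩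
    ι 1ℚ + ν (8 ℕ.+ m)                                ≈⟨ ν-suc (8 ℕ.+ m) ⟨
    ν (9 ℕ.+ m)                                       ≈⟨ reflexive (≡.cong ν (ℕₚ.+-suc 8 m)) ⟨
    ν (8 ℕ.+ suc m)                                   ∎
    where S = partialSum logStep m

  -- log (r + 1)
  opaque
    log1+ : ℕ → Carrier
    log1+ r = partialSum logStep (8 ℕ.* r)

    log1+-≡ : ∀ r → log1+ r ≡ partialSum logStep (8 ℕ.* r)
    log1+-≡ r = ≡.refl

  -- After 8 r steps the telescoping product has reached 8 + 8 r = 8 (r + 1), from which 8 cancels.
  exp-log1+ : ∀ r → exp (log1+ r) ≈ ν (suc r)
  exp-log1+ r = ν-cancel 7 (begin
    ν 8 * exp (log1+ r)      ≈⟨ *-congˡ (exp-cong (reflexive (log1+-≡ r))) ⟩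
    ν 8 * exp (partialSum logStep (8 ℕ.* r)) ≈⟨ exp-∑logStep (8 ℕ.* r) ⟩
    ν (8 ℕ.+ 8 ℕ.* r)        ≈⟨ ι-cong (≡.cong fromℕ (ℕₚ.*-suc 8 r)) ⟨
    ν (8 ℕ.* suc r)          ≈⟨ ι-cong (fromℕ-* 8 (suc r)) ⟩
    ι (fromℕ 8 ℚ.* fromℕ (suc r)) ≈⟨ ι-* (fromℕ 8) (fromℕ (suc r)) ⟩
    ν 8 * ν (suc r)          ∎)

  ∑logStep-Real : ∀ m → Real (partialSum logStep m)
  ∑logStep-Real zero = Real-0
  ∑logStep-Real (suc m) = Real-+ (∑logStep-Real m) (LogStep.logarithm-Real m (Real-ι _))

  log1+-Real : ∀ r → Real (log1+ r)
  log1+-Real r = Real-resp (reflexive (≡.sym (log1+-≡ r))) (∑logStep-Real (8 ℕ.* r))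

  -- A nonnegative real d satisfies exp d ≥ 1 + d.
  exp≈1⇒≈0-NonNeg : ∀ {d} → NonNeg d → exp d ≈ 1# → d ≈ 0#
  exp≈1⇒≈0-NonNeg {d} 0≤d exp≈1 = ≈-from-ε λ ε 0<ε →
    let N , close = partialSum⟶ (exp-HasSum d) ε 0<ε
    in ‖‖-resp (sym (x-0≈x d)) (‖‖-NonNeg 0≤d (rest-NonNeg N)
         -- The partial sum is taken at 2 + N rather than N, so that the terms 1 and d can be split
         -- off.
         (‖‖-resp (excess N) (close (2 ℕ.+ N) (ℕₚ.m≤n+m N 2))))
    where
    rest : ℕ → Carrier
    rest = partialSum (expTerm d ∘ suc ∘ suc)
    ^-NonNeg : ∀ k → NonNeg (d ^ k)
    ^-NonNeg zero = NonNeg-resp ι-1 (NonNeg-ι 0≤1)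
    ^-NonNeg (suc k) = NonNeg-* 0≤d (^-NonNeg k)
    rest-NonNeg : ∀ n → NonNeg (rest n)
    rest-NonNeg zero = NonNeg-resp ι-0 (NonNeg-ι ℚₚ.≤-refl)
    rest-NonNeg (suc n) = NonNeg-+ (rest-NonNeg n) (NonNeg-resp (sym (expTerm-≈ d (2 ℕ.+ n))) (NonNeg-* (NonNeg-ι (0≤recip! (2 ℕ.+ n))) (^-NonNeg (2 ℕ.+ n))))
    excess : ∀ n → partialSum (expTerm d) (2 ℕ.+ n) - exp d ≈ d + rest n
    excess n = begin
      partialSum (expTerm d) (2 ℕ.+ n) - exp d
        ≈⟨ +-cong (trans (partialSum-suc _ (suc n)) (+-cong (expTerm-0 d) (trans (partialSum-suc _ n)
             (+-congʳ (expTerm-1 d))))) (-‿cong exp≈1) ⟩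
      (1# + (d + rest n)) - 1#
        ≈⟨ solve 2 (λ d r → (one :+ (d :+ r)) :- one := d :+ r) refl d (rest n) ⟩
      d + rest n ∎

  -- Equality is tested up to each ε, so the approximate sign is enough. If - d is nonnegative, the
  -- preceding lemma applies to - d, because exp (- d) = 1 as well.
  exp≈1⇒≈0 : ∀ {d} → Real d → exp d ≈ 1# → d ≈ 0#
  exp≈1⇒≈0 {d} Real-d exp≈1 = ≈-from-ε λ ε 0<ε → case ε 0<ε (Real-sign Real-d ε 0<ε)
    where
    exp-neg≈1 : exp (- d) ≈ 1#
    exp-neg≈1 = trans (sym (*-identityʳ _)) (trans (*-congˡ (sym exp≈1)) (exp-neg d))
    case : ∀ ε → 0ℚ ℚ.< ε → ‖ d ‖≤ ε ⊎ NonNeg d ⊎ NonNeg (- d) → ‖ d - 0# ‖≤ ε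
    case ε 0<ε (inj₁ h) = ‖‖-resp (sym (x-0≈x d)) h
    case ε 0<ε (inj₂ (inj₁ h)) = ≈⇒‖-‖≤ (exp≈1⇒≈0-NonNeg h exp≈1) 0<ε
    case ε 0<ε (inj₂ (inj₂ h)) = ≈⇒‖-‖≤ (begin
      d             ≈⟨ solve 1 (λ d → d := :- (:- d)) refl d ⟩
      - (- d)       ≈⟨ -‿cong (exp≈1⇒≈0-NonNeg h exp-neg≈1) ⟩
      - 0#          ≈⟨ +-identityˡ (- 0#) ⟨
      0# - 0#       ≈⟨ x-0≈x 0# ⟩
      0#            ∎) 0<ε

  log-unique : ∀ {l l′} → Real l → Real l′ → exp l ≈ exp l′ → l ≈ l′
  log-unique {l} {l′} Real-l Real-l′ h = x-y≈0⇒x≈y (exp≈1⇒≈0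
    (Real-+ Real-l (Real-neg Real-l′))
    (begin
      exp (l - l′)             ≈⟨ exp-+ l (- l′) ⟩
      exp l * exp (- l′)       ≈⟨ *-comm _ _ ⟩
      exp (- l′) * exp l       ≈⟨ *-congˡ h ⟩
      exp (- l′) * exp l′      ≈⟨ exp-neg l′ ⟩
      1#                       ∎))

-- The coefficients ζ(r) / rˢ: uniqueness, shift in s, polynomial growth.

module Coefficients (A : CompleteNormedAlgebra) where
  open Analysis A
  open Exponential A
  open Logarithm A
  open import Relation.Binary.Reasoning.Setoid setoid
  private
    module ℚS = +-*-Solver
    module ℚ^ = Algebra.Properties.CommutativeSemiring.Exp (CommutativeRing.commutativeSemiring ℚₚ.+-*-commutativeRing)

  opaque
    zetaTerm : ℕ → ℕ → Carrier
    zetaTerm r n = ι (recip (suc n ℕ.^ r) {{ℕₚ.m^n≢0 (suc n) r}})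

    zetaTerm-≡ : ∀ r n → zetaTerm r n ≡ ι (recip (suc n ℕ.^ r) {{ℕₚ.m^n≢0 (suc n) r}})
    zetaTerm-≡ r n = ≡.refl

  private
    -- For n ≥ 1 this is 1 / n, and 1 / (n + 1)² ≤ 1 / n - 1 / (n + 1). The value 2 at n = 0 is
    -- chosen so that 2 - 1 covers the first term 1; it becomes the uniform bound on ζ.
    zetaTail : ℕ → ℚ
    zetaTail zero    = 1ℚ ℚ.+ 1ℚ
    zetaTail (suc n) = recip (suc n)

    zetaTail-Null : Null zetaTail
    zetaTail-Null ε 0<ε = let N , h = Null-recip ε 0<ε in suc N , λ where
      (suc n) (ℕ.s≤s N≤n) → h n N≤n

    0≤zetaTail : ∀ n → 0ℚ ℚ.≤ zetaTail n
    0≤zetaTail zero = 0≤+ 0≤1 0≤1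
    0≤zetaTail (suc n) = 0≤recip (suc n)

    zetaTerm-bound : ∀ r n → recip (suc n ℕ.^ (2 ℕ.+ r)) {{ℕₚ.m^n≢0 (suc n) (2 ℕ.+ r)}} ℚ.≤ zetaTail n ℚ.- zetaTail (suc n)
    zetaTerm-bound r zero = ℚₚ.≤-trans (recip≤1 (1 ℕ.^ (2 ℕ.+ r)) {{ℕₚ.m^n≢0 1 (2 ℕ.+ r)}})
      (ℚₚ.≤-reflexive (≡.cong (λ q → 1ℚ ℚ.+ 1ℚ ℚ.- q) (≡.sym (recip-≡ 1))))
    zetaTerm-bound r (suc n) = ℚₚ.≤-trans
      (recip-antimono {suc n ℕ.* m} {m ℕ.^ (2 ℕ.+ r)} {{_}} {{ℕₚ.m^n≢0 m (2 ℕ.+ r)}}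
        (ℕₚ.≤-trans (ℕₚ.*-monoˡ-≤ m (ℕₚ.n≤1+n (suc n))) (ℕₚ.*-monoʳ-≤ m (ℕₚ.m≤m*n m (m ℕ.^ r) {{ℕₚ.m^n≢0 m r}}))))
      (ℚₚ.≤-reflexive (recip-telescoping n))
      where m = suc (suc n)

    zeta-series : ∀ r → ∃[ w ] HasSum (zetaTerm (2 ℕ.+ r)) w × (∀ n → ‖ w - partialSum (zetaTerm (2 ℕ.+ r)) n ‖≤ zetaTail n)
    zeta-series r = telescoping-test zetaTail zetaTail-Null 0≤zetaTail
      (λ n → ‖‖-resp (reflexive (≡.sym (zetaTerm-≡ (2 ℕ.+ r) n))) $ ‖‖-mono (zetaTerm-bound r n) (‖ι‖ (0≤recip (suc n ℕ.^ (2 ℕ.+ r)) {{ℕₚ.m^n≢0 (suc n) (2 ℕ.+ r)}})))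

  opaque
    -- ζ(r + 2)
    zeta2+ : ℕ → Carrier
    zeta2+ r = proj₁ (zeta-series r)

    zeta-HasSum : ∀ r → HasSum (zetaTerm (2 ℕ.+ r)) (zeta2+ r)
    zeta-HasSum r = proj₁ (proj₂ (zeta-series r))

    zeta-bound : ∀ r → ‖ zeta2+ r ‖≤ 1ℚ ℚ.+ 1ℚ
    zeta-bound r = ‖sum‖≤ (proj₂ (proj₂ (zeta-series r)) 0)

  -- ζ(r + 2) / (r + 2)ˢ
  opaque
    coeff : Carrier → ℕ → Carrier
    coeff s r = zeta2+ r * exp (- (s * log1+ (suc r)))

    coeff-≡ : ∀ s r → coeff s r ≡ zeta2+ r * exp (- (s * log1+ (suc r)))
    coeff-≡ s r = ≡.refl

  coeff-≈ : ∀ s r → coeff s r ≈ zeta2+ r * exp (- (s * log1+ (suc r)))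
  coeff-≈ s r = reflexive (coeff-≡ s r)

  coeff-cong : ∀ {s t} → s ≈ t → ∀ r → coeff s r ≈ coeff t r
  coeff-cong {s} {t} s≈t r = trans (coeff-≈ s r)
    (trans (*-congˡ (exp-cong (-‿cong (*-congʳ s≈t)))) (sym (coeff-≈ t r)))

  -- The equation required by `IsCoeff`, for the existence half; `coeff-unique` is the converse.
  coeff-spec : ∀ s r {q p} → q ≈ s * log1+ (suc r) → HasSum (expTerm q) p → coeff s r * p ≈ zeta2+ r
  coeff-spec s r q≈sL exp-q = trans
    (*-cong (coeff-≈ s r) (trans (HasSum⇒≈exp exp-q) (exp-cong q≈sL)))
    (trans (*-assoc _ _ _) (trans (*-congˡ (exp-neg _)) (*-identityʳ _)))

  -- All witnesses are forced: ζ by uniqueness of sums, l by injectivity of exp on real elements,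
  -- and p through l. Reality of l is essential, as exp is not injective on ℂ. Finally p is
  -- cancelled by multiplying with exp (- s log r).
  coeff-unique : ∀ {s r c l p ζ} → Real l → HasSum (expTerm l) (ν (2 ℕ.+ r)) → HasSum (expTerm (s * l)) p →
    HasSum (zetaTerm (2 ℕ.+ r)) ζ → c * p ≈ ζ → c ≈ coeff s r
  coeff-unique {s} {r} {c} {l} {p} {ζ} Real-l exp-l exp-sl ζ-sum cp≈ζ = begin
    c                                      ≈⟨ *-identityʳ c ⟨
    c * 1#                                 ≈⟨ *-congˡ (trans (sym (exp-neg sL)) (*-comm _ _)) ⟩
    c * (exp sL * exp (- sL))              ≈⟨ *-assoc c _ _ ⟨
    c * exp sL * exp (- sL)                ≈⟨ *-congʳ (*-congˡ p≈) ⟨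
    c * p * exp (- sL)                     ≈⟨ *-congʳ (trans cp≈ζ (HasSum-unique ζ-sum (zeta-HasSum r))) ⟩
    zeta2+ r * exp (- sL)                  ≈⟨ coeff-≈ s r ⟨
    coeff s r                              ∎
    where
    sL = s * log1+ (suc r)
    l≈L : l ≈ log1+ (suc r)
    l≈L = log-unique Real-l (log1+-Real (suc r)) (trans (sym (HasSum⇒≈exp exp-l)) (sym (exp-log1+ (suc r))))
    p≈ : p ≈ exp sL
    p≈ = trans (HasSum⇒≈exp exp-sl) (exp-cong (*-congˡ l≈L))

  -- Write the factor r as exp (log r) and add exponents: - (s + 1) L + L = - s L.
  coeff-shift : ∀ s r → ν (2 ℕ.+ r) * coeff (s + 1#) r ≈ coeff s r
  coeff-shift s r = begin
    ν (2 ℕ.+ r) * coeff (s + 1#) r        ≈⟨ *-congˡ (coeff-≈ (s + 1#) r) ⟩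
    ν (2 ℕ.+ r) * (zeta2+ r * exp e)      ≈⟨ *-congʳ (exp-log1+ (suc r)) ⟨
    exp L * (zeta2+ r * exp e)            ≈⟨ solve 3 (λ x z y → x :* (z :* y) := z :* (y :* x)) refl (exp L) (zeta2+ r) (exp e) ⟩
    zeta2+ r * (exp e * exp L)            ≈⟨ *-congˡ (exp-+ e L) ⟨
    zeta2+ r * exp (e + L)                ≈⟨ *-congˡ (exp-cong (solve 2 (λ s L → :- ((s :+ one) :* L) :+ L := :- (s :* L)) refl s L)) ⟩
    zeta2+ r * exp (- (s * L))            ≈⟨ coeff-≈ s r ⟨
    coeff s r                             ∎
    where
    L = log1+ (suc r)
    e = - ((s + 1#) * L)

  private
    power-step : ∀ m D → fromℕ (8 ℕ.+ m) ^ℚ D ℚ.* (1ℚ ℚ.+ fromℕ D ℚ.* recip (8 ℕ.+ m)) ℚ.≤ fromℕ (9 ℕ.+ m) ^ℚ D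
    power-step m D = ℚₚ.≤-trans
      (*-monoˡ (x ^ℚ D) (0≤^ (0≤fromℕ (8 ℕ.+ m)) D) (bernoulli (0≤recip (8 ℕ.+ m)) D))
      (ℚₚ.≤-reflexive (≡.trans (≡.sym (ℚ^.^-distrib-* x (1ℚ ℚ.+ y) D)) (≡.cong (_^ℚ D) x[1+y])))
      where
      x = fromℕ (8 ℕ.+ m)
      y = recip (8 ℕ.+ m)
      x[1+y] : x ℚ.* (1ℚ ℚ.+ y) ≡ fromℕ (9 ℕ.+ m)
      x[1+y] = ≡.trans (ℚS.solve 2 (λ x y → x ℚS.:* (ℚS.con 1ℚ ℚS.:+ y) ℚS.:= y ℚS.:* x ℚS.:+ x) ≡.refl x y)
        (≡.trans (≡.cong (ℚ._+ x) (recip-inverse (8 ℕ.+ m))) (≡.sym (fromℕ-suc (8 ℕ.+ m))))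

  -- With k = 8 + m, one more step multiplies by a factor of norm at most 1 + D / k ≤ ((k + 1) /
  -- k)^D. The product of these bounds telescopes, starting from 1 ≤ 8^D.
  exp-∑logStep-bound : ∀ s → ∃[ D ] ∀ m → ‖ exp (- (s * partialSum logStep m)) ‖≤ fromℕ (8 ℕ.+ m) ^ℚ D
  exp-∑logStep-bound s = D , bound
    where
    finite = ‖‖-finiteℕ s
    K = proj₁ finite
    ‖s‖≤K = proj₂ finite
    E : ℚ
    -- With k = 8 + m, the exponent is at most 2 K / k and exp has Lipschitz constant 2 ·
    -- `expBound K` on the disc of radius K; their product is E / k.
    E = fromℕ K ℚ.* (1ℚ ℚ.+ 1ℚ) ℚ.* (expBound K ℚ.+ expBound K)
    D = proj₁ (archimedean E)
    E≤D = proj₂ (archimedean E)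

    exponent : ℕ → Carrier
    exponent m = - (s * logStep m)

    exponent-bound : ∀ m → ‖ exponent m ‖≤ fromℕ K ℚ.* (recip (8 ℕ.+ m) ℚ.+ recip (8 ℕ.+ m))
    exponent-bound m = ‖‖-neg (‖‖-* ‖s‖≤K (logStep-bound m))

    exponent-bound-K : ∀ m → ‖ exponent m ‖≤ fromℕ K
    exponent-bound-K m = ≡.subst (‖ exponent m ‖≤_) (ℚₚ.*-identityʳ (fromℕ K))
      (‖‖-mono (*-monoˡ (fromℕ K) (0≤fromℕ K) (2/[8+j]≤1 m)) (exponent-bound m))

    factor-bound : ∀ m → ‖ exp (exponent m) ‖≤ 1ℚ ℚ.+ fromℕ D ℚ.* recip (8 ℕ.+ m)
    factor-bound m = ‖‖-mono (ℚₚ.+-monoʳ-≤ 1ℚ (ℚₚ.≤-trans (ℚₚ.≤-reflexive rearrange) (*-monoʳ y (0≤recip (8 ℕ.+ m)) E≤D)))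
      (‖exp‖≤ K (exponent-bound-K m) (exponent-bound m))
      where
      y = recip (8 ℕ.+ m)
      rearrange : fromℕ K ℚ.* (y ℚ.+ y) ℚ.* (expBound K ℚ.+ expBound K) ≡ E ℚ.* y
      rearrange = ℚS.solve 3 (λ k y e → k ℚS.:* (y ℚS.:+ y) ℚS.:* (e ℚS.:+ e) ℚS.:= k ℚS.:* (ℚS.con 1ℚ ℚS.:+ ℚS.con 1ℚ) ℚS.:* (e ℚS.:+ e) ℚS.:* y)
        ≡.refl (fromℕ K) y (expBound K)

    bound : ∀ m → ‖ exp (- (s * partialSum logStep m)) ‖≤ fromℕ (8 ℕ.+ m) ^ℚ D
    bound zero = ‖‖-resp (sym (trans (exp-cong (begin
        - (s * 0#)   ≈⟨ -‿cong (zeroʳ s) ⟩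
        - 0#         ≈⟨ +-identityˡ (- 0#) ⟨
        0# - 0#      ≈⟨ x-0≈x 0# ⟩
        0#           ∎)) exp-0))
      (‖‖-mono (1≤^ (1≤fromℕ-suc 7) D) ‖1‖)
    bound (suc m) = ‖‖-resp (begin
        exp (- (s * S)) * exp (exponent m)     ≈⟨ exp-+ _ _ ⟨
        exp (- (s * S) + exponent m)           ≈⟨ exp-cong (solve 3 (λ s S l → :- (s :* S) :+ :- (s :* l) := :- (s :* (S :+ l))) refl s S (logStep m)) ⟩
        exp (- (s * (S + logStep m)))          ∎)
      (≡.subst (λ n → ‖ exp (- (s * S)) * exp (exponent m) ‖≤ fromℕ n ^ℚ D) (≡.sym (ℕₚ.+-suc 8 m))
        (‖‖-mono (power-step m D) (‖‖-* (bound m) (factor-bound m))))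
      where S = partialSum logStep m

  -- The number 2 bounds ζ, and 8 + 8 (r + 1) ≤ 16 (r + 1) turns the power from the logarithmic
  -- steps into 16^D times a power of r + 1.
  coeff-bound : ∀ s → ∃[ C ] ∃[ D ] 0ℚ ℚ.≤ C × (∀ r → ‖ coeff s r ‖≤ C ℚ.* fromℕ (suc r) ^ℚ D)
  coeff-bound s = C , D , 0≤* (0≤+ 0≤1 0≤1) (0≤^ (0≤fromℕ 16) D) , λ r →
    ‖‖-resp (sym (trans (coeff-≈ s r) (*-congˡ (exp-cong (-‿cong (*-congˡ (reflexive (log1+-≡ (suc r)))))))))
      (‖‖-mono (bound r) (‖‖-* (zeta-bound r) (h (8 ℕ.* suc r))))
    where
    D = proj₁ (exp-∑logStep-bound s)
    h = proj₂ (exp-∑logStep-bound s)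
    C : ℚ
    C = (1ℚ ℚ.+ 1ℚ) ℚ.* fromℕ 16 ^ℚ D
    8+8r≤16r : ∀ r → 8 ℕ.+ 8 ℕ.* suc r ℕ.≤ 16 ℕ.* suc r
    8+8r≤16r r = ℕₚ.≤-trans (ℕₚ.+-monoˡ-≤ (8 ℕ.* suc r) (ℕₚ.m≤m*n 8 (suc r)))
      (ℕₚ.≤-reflexive (≡.sym (ℕₚ.*-distribʳ-+ (suc r) 8 8)))
    bound : ∀ r → (1ℚ ℚ.+ 1ℚ) ℚ.* fromℕ (8 ℕ.+ 8 ℕ.* suc r) ^ℚ D ℚ.≤ C ℚ.* fromℕ (suc r) ^ℚ D
    bound r = ℚₚ.≤-trans
      (*-monoˡ (1ℚ ℚ.+ 1ℚ) (0≤+ 0≤1 0≤1) (^-mono (0≤fromℕ _) (fromℕ-mono (8+8r≤16r r)) D))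
      (ℚₚ.≤-reflexive (≡.trans (≡.cong (λ q → (1ℚ ℚ.+ 1ℚ) ℚ.* q)
        (≡.trans (≡.cong (_^ℚ D) (fromℕ-* 16 (suc r))) (ℚ^.^-distrib-* (fromℕ 16) (fromℕ (suc r)) D)))
        (≡.sym (ℚₚ.*-assoc (1ℚ ℚ.+ 1ℚ) (fromℕ 16 ^ℚ D) (fromℕ (suc r) ^ℚ D)))))

-- Termwise differentiation with a quadratic remainder.

module PowerSeries (A : CompleteNormedAlgebra) where
  open Analysis A
  open Exponential A
  open Coefficients A
  open import Relation.Binary.Reasoning.Setoid setoid
  private module ℚS = +-*-Solver

  -- (wⁿ − zⁿ − n zⁿ⁻¹ (w − z)) / (w − z)²; note that n zⁿ⁻¹ is secant z z n.
  secondSecant : Carrier → Carrier → ℕ → Carrier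
  secondSecant w z zero    = 0#
  secondSecant w z (suc n) = w * secondSecant w z n + secant z z n

  secondSecant-eq : ∀ w z n → (w ^ n - z ^ n) - secant z z n * (w - z) ≈ (w - z) * ((w - z) * secondSecant w z n)
  secondSecant-eq w z zero = begin
    (1# - 1#) - 0# * (w - z)        ≈⟨ +-cong (-‿inverseʳ 1#) (-‿cong (zeroˡ (w - z))) ⟩
    0# - 0#                         ≈⟨ x-0≈x 0# ⟩
    0#                              ≈⟨ trans (*-congˡ (zeroʳ (w - z))) (zeroʳ (w - z)) ⟨
    (w - z) * ((w - z) * 0#)        ∎
  secondSecant-eq w z (suc n) = begin
    (w * p - z * q) - (z * d + q) * (w - z)
      ≈⟨ solve 5 (λ w z p q d → (w :* p :- z :* q) :- (z :* d :+ q) :* (w :- z) := w :* ((p :- q) :- d :* (w :- z)) :+ (w :- z) :* ((w :- z) :* d)) refl w z p q d ⟩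
    w * ((p - q) - d * (w - z)) + (w - z) * ((w - z) * d)
      ≈⟨ +-congʳ (*-congˡ (secondSecant-eq w z n)) ⟩
    w * ((w - z) * ((w - z) * s)) + (w - z) * ((w - z) * d)
      ≈⟨ solve 4 (λ w z s d → w :* ((w :- z) :* ((w :- z) :* s)) :+ (w :- z) :* ((w :- z) :* d) := (w :- z) :* ((w :- z) :* (w :* s :+ d))) refl w z s d ⟩
    (w - z) * ((w - z) * (w * s + d)) ∎
    where
    p = w ^ n
    q = z ^ n
    d = secant z z n
    s = secondSecant w z n

  z*secant : ∀ z n → z * secant z z n ≈ ν n * z ^ n
  z*secant z zero = trans (zeroʳ z) (sym (trans (*-congʳ ν-0) (zeroˡ 1#)))
  z*secant z (suc n) = begin
    z * (z * secant z z n + z ^ n)        ≈⟨ distribˡ z _ _ ⟩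
    z * (z * secant z z n) + z * z ^ n    ≈⟨ +-congʳ (*-congˡ (z*secant z n)) ⟩
    z * (ν n * z ^ n) + z * z ^ n         ≈⟨ solve 3 (λ z m p → z :* (m :* p) :+ z :* p := (con 1ℚ :+ m) :* (z :* p)) refl z (ν n) (z ^ n) ⟩
    (ι 1ℚ + ν n) * (z * z ^ n)            ≈⟨ *-congʳ (ν-suc n) ⟨
    ν (suc n) * z ^ suc n                 ∎

  -- The common bound for the terms zᵏ⁺², (k + 2) zᵏ⁺¹ and secondSecant w z (k + 2) in |z|, |w| ≤ θ.
  growth : ℚ → ℕ → ℚ
  growth θ k = (1ℚ ℚ.+ 1ℚ) ℚ.* (fromℕ (suc k) ℚ.* fromℕ (suc k)) ℚ.* θ ^ℚ k

  private
    1≤square : ∀ k → 1ℚ ℚ.≤ fromℕ (suc k) ℚ.* fromℕ (suc k)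
    1≤square k = *-mono {1ℚ} {fromℕ (suc k)} {1ℚ} {fromℕ (suc k)} (0≤fromℕ (suc k)) 0≤1 (1≤fromℕ-suc k) (1≤fromℕ-suc k)

    0≤square-fromℕ : ∀ k → 0ℚ ℚ.≤ fromℕ (suc k) ℚ.* fromℕ (suc k)
    0≤square-fromℕ k = ℚₚ.≤-trans 0≤1 (1≤square k)

    ≤double : ∀ {q} → 0ℚ ℚ.≤ q → q ℚ.≤ (1ℚ ℚ.+ 1ℚ) ℚ.* q
    ≤double {q} 0≤q = ≤-by q 0≤q (ℚS.solve 1 (λ q → q ℚS.:+ q ℚS.:= (ℚS.con 1ℚ ℚS.:+ ℚS.con 1ℚ) ℚS.:* q) ≡.refl q)

    square≤growth : ∀ {θ} → 0ℚ ℚ.≤ θ → ∀ k → fromℕ (suc k) ℚ.* fromℕ (suc k) ℚ.* θ ^ℚ k ℚ.≤ growth θ k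
    square≤growth {θ} 0≤θ k = *-monoʳ (θ ^ℚ k) (0≤^ 0≤θ k) (≤double (0≤square-fromℕ k))

  ^-growth : ∀ {z θ} → ‖ z ‖≤ θ → θ ℚ.≤ 1ℚ → ∀ k → ‖ z ^ (2 ℕ.+ k) ‖≤ growth θ k
  ^-growth {z} {θ} hz θ≤1 k = ‖‖-mono (ℚₚ.≤-trans drop (square≤growth 0≤θ k)) (‖‖-^ hz (2 ℕ.+ k))
    where
    0≤θ = ‖‖-nonNeg hz
    step : ∀ n → θ ^ℚ suc n ℚ.≤ θ ^ℚ n
    step n = ≡.subst (θ ^ℚ suc n ℚ.≤_) (ℚₚ.*-identityˡ (θ ^ℚ n)) (*-monoʳ (θ ^ℚ n) (0≤^ 0≤θ n) θ≤1)
    drop : θ ^ℚ (2 ℕ.+ k) ℚ.≤ fromℕ (suc k) ℚ.* fromℕ (suc k) ℚ.* θ ^ℚ k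
    drop = ℚₚ.≤-trans (ℚₚ.≤-trans (step (suc k)) (step k))
      (≡.subst (ℚ._≤ fromℕ (suc k) ℚ.* fromℕ (suc k) ℚ.* θ ^ℚ k) (ℚₚ.*-identityˡ (θ ^ℚ k))
        (*-monoʳ (θ ^ℚ k) (0≤^ 0≤θ k) (1≤square k)))

  -- At k = 0 the available bound is 2 θ, which is the reason for the factor 2 in `growth`.
  secant-growth : ∀ {z θ} → ‖ z ‖≤ θ → θ ℚ.≤ 1ℚ → ∀ k → ‖ secant z z (2 ℕ.+ k) ‖≤ growth θ k
  secant-growth {z} {θ} hz θ≤1 k = ‖‖-mono bound (secant-bound hz hz (suc k))
    where
    0≤θ = ‖‖-nonNeg hz
    m = fromℕ (suc k)
    t = θ ^ℚ k
    2≤ : fromℕ (2 ℕ.+ k) ℚ.≤ (1ℚ ℚ.+ 1ℚ) ℚ.* (m ℚ.* m)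
    2≤ = ℚₚ.≤-trans (ℚₚ.≤-reflexive (fromℕ-suc (suc k)))
      (ℚₚ.≤-trans (ℚₚ.+-monoˡ-≤ m (1≤fromℕ-suc k))
      (ℚₚ.≤-trans (ℚₚ.≤-reflexive (ℚS.solve 1 (λ m → m ℚS.:+ m ℚS.:= (ℚS.con 1ℚ ℚS.:+ ℚS.con 1ℚ) ℚS.:* (ℚS.con 1ℚ ℚS.:* m)) ≡.refl m))
        (*-monoˡ (1ℚ ℚ.+ 1ℚ) (0≤+ 0≤1 0≤1) (*-monoʳ m (0≤fromℕ (suc k)) (1≤fromℕ-suc k)))))
    bound : fromℕ (2 ℕ.+ k) ℚ.* (θ ℚ.* t) ℚ.≤ growth θ k
    bound = *-mono {fromℕ (2 ℕ.+ k)} {(1ℚ ℚ.+ 1ℚ) ℚ.* (m ℚ.* m)} {θ ℚ.* t} {t} (0≤* (0≤+ 0≤1 0≤1) (0≤square-fromℕ k)) (0≤* 0≤θ (0≤^ 0≤θ k)) 2≤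
      (≡.subst (θ ℚ.* t ℚ.≤_) (ℚₚ.*-identityˡ t) (*-monoʳ t (0≤^ 0≤θ k) θ≤1))

  secondSecant-growth : ∀ {w z θ} → ‖ w ‖≤ θ → ‖ z ‖≤ θ → ∀ k → ‖ secondSecant w z (2 ℕ.+ k) ‖≤ growth θ k
  secondSecant-growth {w} {z} {θ} hw hz k = ‖‖-mono (square≤growth (‖‖-nonNeg hz) k) (square-bound k)
    where
    -- With m = k + 1, the induction closes because m² + (m + 1) ≤ (m + 1)².
    square-bound : ∀ k → ‖ secondSecant w z (2 ℕ.+ k) ‖≤ fromℕ (suc k) ℚ.* fromℕ (suc k) ℚ.* θ ^ℚ k
    square-bound zero = ‖‖-resp (begin
        secant z z 1                             ≈⟨ +-identityˡ (secant z z 1) ⟨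
        0# + secant z z 1                        ≈⟨ +-congʳ (trans (*-congˡ (trans (+-identityʳ _) (zeroʳ w))) (zeroʳ w)) ⟨
        w * (w * 0# + 0#) + secant z z 1         ∎)
      (≡.subst (‖ secant z z 1 ‖≤_) (≡.cong (ℚ._* 1ℚ) (≡.trans (≡.sym (ℚₚ.*-identityʳ (fromℕ 1))) (≡.cong (fromℕ 1 ℚ.*_) (≡.sym fromℕ-1))))
        (secant-bound hz hz 0))
    square-bound (suc k) = ‖‖-mono bound (‖‖-+ (‖‖-* hw (square-bound k)) (secant-bound hz hz (suc k)))
      where
      m = fromℕ (suc k)
      t = θ ^ℚ k
      bound′ : θ ℚ.* (m ℚ.* m ℚ.* t) ℚ.+ (1ℚ ℚ.+ m) ℚ.* (θ ℚ.* t) ℚ.≤ (1ℚ ℚ.+ m) ℚ.* (1ℚ ℚ.+ m) ℚ.* (θ ℚ.* t)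
      bound′ = ≤-by (m ℚ.* (θ ℚ.* t)) (0≤* (0≤fromℕ (suc k)) (0≤* (‖‖-nonNeg hz) (0≤^ (‖‖-nonNeg hz) k)))
        (ℚS.solve 3 (λ θ m t → θ ℚS.:* (m ℚS.:* m ℚS.:* t) ℚS.:+ (ℚS.con 1ℚ ℚS.:+ m) ℚS.:* (θ ℚS.:* t) ℚS.:+ m ℚS.:* (θ ℚS.:* t)
          ℚS.:= (ℚS.con 1ℚ ℚS.:+ m) ℚS.:* (ℚS.con 1ℚ ℚS.:+ m) ℚS.:* (θ ℚS.:* t)) ≡.refl θ m t)
      bound : θ ℚ.* (m ℚ.* m ℚ.* t) ℚ.+ fromℕ (2 ℕ.+ k) ℚ.* (θ ℚ.* t) ℚ.≤ fromℕ (2 ℕ.+ k) ℚ.* fromℕ (2 ℕ.+ k) ℚ.* (θ ℚ.* t)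
      bound = ≡.subst (λ n → θ ℚ.* (m ℚ.* m ℚ.* t) ℚ.+ n ℚ.* (θ ℚ.* t) ℚ.≤ n ℚ.* n ℚ.* (θ ℚ.* t))
        (≡.sym (fromℕ-suc (suc k))) bound′

  module _ {b : ℕ → Carrier} {C D} (0≤C : 0ℚ ℚ.≤ C) (b-bound : ∀ k → ‖ b k ‖≤ C ℚ.* fromℕ (suc k) ^ℚ D) where

    -- The quantifiers matter: B is fixed before x. For the remainder series, whose terms depend on
    -- w, this gives a bound uniform in w.
    summable : ∀ {θ} → 0ℚ ℚ.≤ θ → θ ℚ.< 1ℚ →
      ∃[ B ] 0ℚ ℚ.≤ B × (∀ (x : ℕ → Carrier) → (∀ k → ‖ x k ‖≤ growth θ k) → ∃[ w ] HasSum (λ k → b k * x k) w × ‖ w ‖≤ B)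
    summable {θ} 0≤θ θ<1 = B , 0≤B , λ x hx →
      let w , h , hw = geometric-test {C = B} 0≤B 0≤τ τ<1 (term x hx)
      in w , h , ≡.subst (‖ w ‖≤_) (ℚₚ.*-identityʳ B) (‖sum‖≤ (hw 0))
      where
      C′ : ℚ
      C′ = (1ℚ ℚ.+ 1ℚ) ℚ.* C
      0≤C′ : 0ℚ ℚ.≤ C′
      0≤C′ = 0≤* (0≤+ 0≤1 0≤1) 0≤C
      -- Degree D comes from the coefficients, the additional 2 from the square in `growth`.
      slow = Slow-polynomial 0≤C′ (2 ℕ.+ D) θ 0≤θ θ<1
      M = proj₁ slow
      τ = proj₁ (proj₂ slow)
      0≤M = proj₁ (proj₂ (proj₂ slow))
      0≤τ = proj₁ (proj₂ (proj₂ (proj₂ slow)))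
      τ<1 = proj₁ (proj₂ (proj₂ (proj₂ (proj₂ slow))))
      slow-bound = proj₂ (proj₂ (proj₂ (proj₂ (proj₂ slow))))
      -- u = 1 / (1 - τ) brings the term bound M τᵏ into the form B (1 - τ) τᵏ of the geometric
      -- test.
      inverse = quotient-pos (<⇒0< τ<1) 0<1
      u = proj₁ inverse
      B : ℚ
      B = M ℚ.* u
      0≤B : 0ℚ ℚ.≤ B
      0≤B = 0≤* 0≤M (ℚₚ.<⇒≤ (proj₁ (proj₂ inverse)))
      B[1-τ]≡M : B ℚ.* (1ℚ ℚ.- τ) ≡ M
      B[1-τ]≡M = ≡.trans (ℚS.solve 3 (λ M u d → M ℚS.:* u ℚS.:* d ℚS.:= M ℚS.:* (d ℚS.:* u)) ≡.refl M u (1ℚ ℚ.- τ))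
        (≡.trans (≡.cong (M ℚ.*_) (proj₂ (proj₂ inverse))) (ℚₚ.*-identityʳ M))
      rearrange : ∀ k → C ℚ.* fromℕ (suc k) ^ℚ D ℚ.* growth θ k ≡ C′ ℚ.* fromℕ (suc k) ^ℚ (2 ℕ.+ D) ℚ.* θ ^ℚ k
      rearrange k = ℚS.solve 4 (λ C p m t → C ℚS.:* p ℚS.:* ((ℚS.con 1ℚ ℚS.:+ ℚS.con 1ℚ) ℚS.:* (m ℚS.:* m) ℚS.:* t)
        ℚS.:= (ℚS.con 1ℚ ℚS.:+ ℚS.con 1ℚ) ℚS.:* C ℚS.:* (m ℚS.:* (m ℚS.:* p)) ℚS.:* t) ≡.refl C (fromℕ (suc k) ^ℚ D) (fromℕ (suc k)) (θ ^ℚ k)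
      term : ∀ (x : ℕ → Carrier) → (∀ k → ‖ x k ‖≤ growth θ k) → ∀ k → ‖ b k * x k ‖≤ B ℚ.* (1ℚ ℚ.- τ) ℚ.* τ ^ℚ k
      term x hx k = ≡.subst (λ c → ‖ b k * x k ‖≤ c ℚ.* τ ^ℚ k) (≡.sym B[1-τ]≡M)
        (‖‖-mono (slow-bound k) (≡.subst (‖ b k * x k ‖≤_) (rearrange k) (‖‖-* (b-bound k) (hx k))))

    power-series-converges : ∀ {z θ} → ‖ z ‖≤ θ → θ ℚ.< 1ℚ → ∃[ w ] HasSum (λ k → b k * z ^ (2 ℕ.+ k)) w
    power-series-converges {z} hz θ<1 =
      let _ , _ , sum = summable (‖‖-nonNeg hz) θ<1
          w , h , _ = sum (λ k → z ^ (2 ℕ.+ k)) (^-growth hz (ℚₚ.<⇒≤ θ<1))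
      in w , h

    -- The second-order remainder is an exact identity in each term, so it can be summed as a series
    -- and no limit has to be exchanged with the sum.
    power-series-derivative : ∀ {z θ} → ‖ z ‖≤ θ → θ ℚ.< 1ℚ →
      ∃[ d ] HasSum (λ k → b k * secant z z (2 ℕ.+ k)) d ×
      ∃[ B ] 0ℚ ℚ.≤ B × (∀ {w fw fz} → ‖ w ‖≤ θ →
        HasSum (λ k → b k * w ^ (2 ℕ.+ k)) fw → HasSum (λ k → b k * z ^ (2 ℕ.+ k)) fz →
        ∃[ τ ] ‖ τ ‖≤ B × (fw - fz) - d * (w - z) ≈ (w - z) * ((w - z) * τ))
    power-series-derivative {z} hz θ<1 =
      let B , 0≤B , sum = summable (‖‖-nonNeg hz) θ<1
          d , hd , _ = sum (λ k → secant z z (2 ℕ.+ k)) (secant-growth hz (ℚₚ.<⇒≤ θ<1))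
      in d , hd , B , 0≤B , λ {w} {fw} {fz} hw hfw hfz →
        let τ , hτ , τ≤B = sum (λ k → secondSecant w z (2 ℕ.+ k)) (secondSecant-growth hw hz)
        in τ , τ≤B , HasSum-unique
             (HasSum-- (HasSum-- hfw hfz) (HasSum-cong (λ _ → refl) (*-comm (w - z) d) (HasSum-*ˡ (w - z) hd)))
             (HasSum-cong (λ k → sym (term w k)) (*-assoc (w - z) (w - z) τ) (HasSum-*ˡ {λ k → b k * secondSecant w z (2 ℕ.+ k)} ((w - z) * (w - z)) hτ))
      where
      term : ∀ w k → (b k * w ^ (2 ℕ.+ k) - b k * z ^ (2 ℕ.+ k)) - (w - z) * (b k * secant z z (2 ℕ.+ k))
        ≈ ((w - z) * (w - z)) * (b k * secondSecant w z (2 ℕ.+ k))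
      term w k = begin
        (b k * w ^ (2 ℕ.+ k) - b k * z ^ (2 ℕ.+ k)) - (w - z) * (b k * secant z z (2 ℕ.+ k))
          ≈⟨ solve 5 (λ b p q e d → (b :* p :- b :* q) :- e :* (b :* d) := b :* ((p :- q) :- d :* e)) refl
               (b k) (w ^ (2 ℕ.+ k)) (z ^ (2 ℕ.+ k)) (w - z) (secant z z (2 ℕ.+ k)) ⟩
        b k * ((w ^ (2 ℕ.+ k) - z ^ (2 ℕ.+ k)) - secant z z (2 ℕ.+ k) * (w - z))
          ≈⟨ *-congˡ (secondSecant-eq w z (2 ℕ.+ k)) ⟩
        b k * ((w - z) * ((w - z) * secondSecant w z (2 ℕ.+ k)))
          ≈⟨ solve 3 (λ b e s → b :* (e :* (e :* s)) := (e :* e) :* (b :* s)) refl (b k) (w - z) (secondSecant w z (2 ℕ.+ k)) ⟩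
        ((w - z) * (w - z)) * (b k * secondSecant w z (2 ℕ.+ k)) ∎

  z*secant-series : ∀ {s z d g} → HasSum (λ k → coeff (s + 1#) k * secant z z (2 ℕ.+ k)) d →
    HasSum (λ k → coeff s k * z ^ (2 ℕ.+ k)) g → z * d ≈ g
  z*secant-series {s} {z} hd hg = HasSum-unique (HasSum-cong term refl (HasSum-*ˡ z hd)) hg
    where
    term : ∀ k → z * (coeff (s + 1#) k * secant z z (2 ℕ.+ k)) ≈ coeff s k * z ^ (2 ℕ.+ k)
    term k = begin
      z * (c * secant z z (2 ℕ.+ k))             ≈⟨ solve 3 (λ z c d → z :* (c :* d) := c :* (z :* d)) refl z c (secant z z (2 ℕ.+ k)) ⟩
      c * (z * secant z z (2 ℕ.+ k))             ≈⟨ *-congˡ (z*secant z (2 ℕ.+ k)) ⟩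
      c * (ν (2 ℕ.+ k) * z ^ (2 ℕ.+ k))          ≈⟨ solve 3 (λ c n p → c :* (n :* p) := (n :* c) :* p) refl c (ν (2 ℕ.+ k)) (z ^ (2 ℕ.+ k)) ⟩
      (ν (2 ℕ.+ k) * c) * z ^ (2 ℕ.+ k)          ≈⟨ *-congʳ (coeff-shift s k) ⟩
      coeff s k * z ^ (2 ℕ.+ k)                  ∎
      where c = coeff (s + 1#) k

  opaque
    logTerm : Carrier → Carrier → ℕ → Carrier
    logTerm s z k = coeff s k * z ^ (2 ℕ.+ k)

    logTerm-≡ : ∀ s z k → logTerm s z k ≡ coeff s k * z ^ (2 ℕ.+ k)
    logTerm-≡ s z k = ≡.refl

  logTerm-≈ : ∀ s z k → logTerm s z k ≈ coeff s k * z ^ (2 ℕ.+ k)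
  logTerm-≈ s z k = reflexive (logTerm-≡ s z k)

  opaque
    logG-converges : ∀ s {z θ} → ‖ z ‖≤ θ → θ ℚ.< 1ℚ → ∃[ w ] HasSum (logTerm s z) w
    logG-converges s {z} hz θ<1 =
      let C , D , 0≤C , bound = coeff-bound s
          w , h = power-series-converges {coeff s} {C} {D} 0≤C bound hz θ<1
      in w , HasSum-cong (λ k → sym (logTerm-≈ s z k)) refl h

  opaque
    logG-derivative : ∀ {s t z θ} → t ≈ s + 1# → ‖ z ‖≤ θ → θ ℚ.< 1ℚ →
      ∃[ d ] (∃[ B ] 0ℚ ℚ.≤ B × (∀ {w fw fz} → ‖ w ‖≤ θ → HasSum (logTerm t w) fw → HasSum (logTerm t z) fz →
          ∃[ τ ] ‖ τ ‖≤ B × (fw - fz) - d * (w - z) ≈ (w - z) * ((w - z) * τ))) ×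
        (∀ {g} → HasSum (logTerm s z) g → z * d ≈ g)
    logG-derivative {s} {t} {z} t≈s+1 hz θ<1 =
      let C , D , 0≤C , bound = coeff-bound (s + 1#)
          d , hd , B , 0≤B , expansion = power-series-derivative {coeff (s + 1#)} {C} {D} 0≤C bound hz θ<1
      in d , (B , 0≤B , λ hw hfw hfz → expansion hw (HasSum-cong (shifted _) refl hfw) (HasSum-cong (shifted _) refl hfz)) ,
         λ hg → z*secant-series hd (HasSum-cong (logTerm-≈ s z) refl hg)
      where
      shifted : ∀ w k → logTerm t w k ≈ coeff (s + 1#) k * w ^ (2 ℕ.+ k)
      shifted w k = trans (logTerm-≈ t w k) (*-congʳ (coeff-cong t≈s+1 k))

open import Defs

-- Rational bounds for the modulus of a complex number.

module ComplexNorm where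
  private
    module ℚS = +-*-Solver
    open ℚS using (_:+_; _:*_; _:-_; :-_; _:=_; con)

  norm² : ℚ → ℚ → ℚ
  norm² a b = a ℚ.* a ℚ.+ b ℚ.* b

  -- The Brahmagupta-Fibonacci two-square identity.
  norm²-* : ∀ a b c d → norm² (a ℚ.* c ℚ.+ ℚ.- (b ℚ.* d)) (a ℚ.* d ℚ.+ b ℚ.* c) ≡ norm² a b ℚ.* norm² c d
  norm²-* = ℚS.solve 4 (λ a b c d →
    (a :* c :+ :- (b :* d)) :* (a :* c :+ :- (b :* d)) :+ (a :* d :+ b :* c) :* (a :* d :+ b :* c)
      := (a :* a :+ b :* b) :* (c :* c :+ d :* d)) ≡.refl

  -- Expanding leaves twice the inner product, which is at most p q by Cauchy-Schwarz. The rationals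
  -- p and q stand in for the moduli.
  norm²-+ : ∀ {a b c d p q} → 0ℚ ℚ.≤ p → 0ℚ ℚ.≤ q → norm² a b ℚ.≤ p ℚ.* p → norm² c d ℚ.≤ q ℚ.* q →
    norm² (a ℚ.+ c) (b ℚ.+ d) ℚ.≤ (p ℚ.+ q) ℚ.* (p ℚ.+ q)
  norm²-+ {a} {b} {c} {d} {p} {q} 0≤p 0≤q hp hq = begin
    norm² (a ℚ.+ c) (b ℚ.+ d)
      ≡⟨ ℚS.solve 4 (λ a b c d → (a :+ c) :* (a :+ c) :+ (b :+ d) :* (b :+ d)
           := (a :* a :+ b :* b) :+ (c :* c :+ d :* d) :+ ((a :* c :+ b :* d) :+ (a :* c :+ b :* d))) ≡.refl a b c d ⟩
    norm² a b ℚ.+ norm² c d ℚ.+ (inner ℚ.+ inner)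
      ≤⟨ ℚₚ.+-mono-≤ (ℚₚ.+-mono-≤ hp hq) (ℚₚ.+-mono-≤ inner≤pq inner≤pq) ⟩
    p ℚ.* p ℚ.+ q ℚ.* q ℚ.+ (p ℚ.* q ℚ.+ p ℚ.* q)
      ≡⟨ ℚS.solve 2 (λ p q → p :* p :+ q :* q :+ (p :* q :+ p :* q) := (p :+ q) :* (p :+ q)) ≡.refl p q ⟩
    (p ℚ.+ q) ℚ.* (p ℚ.+ q) ∎
    where
    open ℚₚ.≤-Reasoning
    inner cross : ℚ
    inner = a ℚ.* c ℚ.+ b ℚ.* d
    cross = a ℚ.* d ℚ.- b ℚ.* c
    0≤norm² : 0ℚ ℚ.≤ norm² c d
    0≤norm² = 0≤+ {c ℚ.* c} {d ℚ.* d} (0≤square c) (0≤square d)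
    -- Cauchy–Schwarz
    inner≤pq : inner ℚ.≤ p ℚ.* q
    inner≤pq = square-cancel-≤ (0≤* 0≤p 0≤q) (begin
      inner ℚ.* inner                  ≤⟨ ≤-by (cross ℚ.* cross) (0≤square cross) (ℚS.solve 4 (λ a b c d →
                                            (a :* c :+ b :* d) :* (a :* c :+ b :* d) :+ (a :* d :- b :* c) :* (a :* d :- b :* c)
                                              := (a :* a :+ b :* b) :* (c :* c :+ d :* d)) ≡.refl a b c d) ⟩
      norm² a b ℚ.* norm² c d          ≤⟨ *-mono {norm² a b} {p ℚ.* p} {norm² c d} {q ℚ.* q} (0≤square p) 0≤norm² hp hq ⟩
      p ℚ.* p ℚ.* (q ℚ.* q)            ≡⟨ ℚS.solve 2 (λ p q → p :* p :* (q :* q) := (p :* q) :* (p :* q)) ≡.refl p q ⟩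
      (p ℚ.* q) ℚ.* (p ℚ.* q)          ∎)

  ∣∣-square : ∀ a → ∣ a ∣ ℚ.* ∣ a ∣ ≡ a ℚ.* a
  ∣∣-square a = ≡.trans (≡.sym (ℚₚ.∣p*q∣≡∣p∣*∣q∣ a a)) (ℚₚ.0≤p⇒∣p∣≡p (0≤square a))

  ≤∣∣ : ∀ a → a ℚ.≤ ∣ a ∣
  ≤∣∣ a = square-cancel-≤ (ℚₚ.0≤∣p∣ a) (ℚₚ.≤-reflexive (≡.sym (∣∣-square a)))

  ∣∣≤⇒square≤ : ∀ {a h} → ∣ a ∣ ℚ.≤ h → a ℚ.* a ℚ.≤ h ℚ.* h
  ∣∣≤⇒square≤ {a} {h} a≤h = ≡.subst (ℚ._≤ h ℚ.* h) (∣∣-square a) (square-mono (ℚₚ.0≤∣p∣ a) a≤h)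

  square≤⇒∣∣≤ : ∀ {a h} → 0ℚ ℚ.≤ h → a ℚ.* a ℚ.≤ h ℚ.* h → ∣ a ∣ ℚ.≤ h
  square≤⇒∣∣≤ {a} {h} 0≤h aa≤hh = square-cancel-≤ 0≤h (≡.subst (ℚ._≤ h ℚ.* h) (≡.sym (∣∣-square a)) aa≤hh)

  norm²≤⇒∣re∣≤ : ∀ {a b h} → 0ℚ ℚ.≤ h → norm² a b ℚ.≤ h ℚ.* h → ∣ a ∣ ℚ.≤ h
  norm²≤⇒∣re∣≤ {a} {b} 0≤h le = square≤⇒∣∣≤ 0≤h (ℚₚ.≤-trans (≤-by (b ℚ.* b) (0≤square b) ≡.refl) le)

  norm²≤⇒∣im∣≤ : ∀ {a b h} → 0ℚ ℚ.≤ h → norm² a b ℚ.≤ h ℚ.* h → ∣ b ∣ ℚ.≤ h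
  norm²≤⇒∣im∣≤ {a} {b} 0≤h le = square≤⇒∣∣≤ 0≤h (ℚₚ.≤-trans (≤-by (a ℚ.* a) (0≤square a) (ℚₚ.+-comm (b ℚ.* b) (a ℚ.* a))) le)

  -- The rational 2 h replaces the optimal √2 h.
  ∣∣≤⇒norm²≤ : ∀ {a b h} → ∣ a ∣ ℚ.≤ h → ∣ b ∣ ℚ.≤ h → norm² a b ℚ.≤ (h ℚ.+ h) ℚ.* (h ℚ.+ h)
  ∣∣≤⇒norm²≤ {a} {b} {h} ha hb = ℚₚ.≤-trans (ℚₚ.+-mono-≤ (∣∣≤⇒square≤ {a} ha) (∣∣≤⇒square≤ {b} hb))
    (≤-by (h ℚ.* h ℚ.+ h ℚ.* h) (0≤+ {h ℚ.* h} {h ℚ.* h} (0≤square h) (0≤square h))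
      (ℚS.solve 1 (λ h → h :* h :+ h :* h :+ (h :* h :+ h :* h) := (h :+ h) :* (h :+ h)) ≡.refl h))

  infix 4 _≐_ ‖_‖≤_

  -- Equality of representing sequences, finer than `_≈_`; norm bounds transfer along it without any
  -- ε.
  _≐_ : ℂ → ℂ → Set
  z ≐ w = ∀ n → seq (re z) n ≡ seq (re w) n × seq (im z) n ≡ seq (im w) n

  -- norm² (seq (re z) n) (seq (im z) n) is the n-th term of the sequence ∣ z ∣².
  record ‖_‖≤_ (z : ℂ) (q : ℚ) : Set where
    constructor mk‖‖≤
    field
      nonNeg     : 0ℚ ℚ.≤ q
      -- The slack ε makes the bound invariant under `_≈_`. Without it, q = 0 would force the terms
      -- of z to vanish eventually.
      eventually : ∀ ε → 0ℚ ℚ.< ε → ∃[ M ] ∀ n → M ℕ.≤ n → seq ∣ z ∣² n ℚ.≤ (q ℚ.+ ε) ℚ.* (q ℚ.+ ε)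
  open ‖_‖≤_ public

  ‖‖-pointwise : ∀ {z w q} → (∀ n → seq ∣ w ∣² n ℚ.≤ seq ∣ z ∣² n) → ‖ z ‖≤ q → ‖ w ‖≤ q
  ‖‖-pointwise w≤z h = mk‖‖≤ (nonNeg h) λ ε 0<ε → let M , k = eventually h ε 0<ε in
    M , λ n M≤n → ℚₚ.≤-trans (w≤z n) (k n M≤n)

  ‖‖-≐ : ∀ {z w q} → z ≐ w → ‖ z ‖≤ q → ‖ w ‖≤ q
  ‖‖-≐ z≐w = ‖‖-pointwise λ n → ℚₚ.≤-reflexive (≡.sym (≡.cong₂ norm² (proj₁ (z≐w n)) (proj₂ (z≐w n))))

  ‖‖-mono : ∀ {z p q} → p ℚ.≤ q → ‖ z ‖≤ p → ‖ z ‖≤ q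
  ‖‖-mono p≤q h = mk‖‖≤ (ℚₚ.≤-trans (nonNeg h) p≤q) λ ε 0<ε → let M , k = eventually h ε 0<ε in
    M , λ n M≤n → ℚₚ.≤-trans (k n M≤n) (square-mono (0≤+ (nonNeg h) (ℚₚ.<⇒≤ 0<ε)) (ℚₚ.+-monoˡ-≤ ε p≤q))

  ‖‖-eventually : ∀ {z q} → 0ℚ ℚ.≤ q → (∃[ M ] ∀ n → M ℕ.≤ n → seq ∣ z ∣² n ℚ.≤ q ℚ.* q) → ‖ z ‖≤ q
  ‖‖-eventually 0≤q (M , h) = mk‖‖≤ 0≤q λ ε 0<ε → M , λ n M≤n →
    ℚₚ.≤-trans (h n M≤n) (square-mono 0≤q (≤-by ε (ℚₚ.<⇒≤ 0<ε) ≡.refl))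

  ‖‖-components : ∀ {z h} → 0ℚ ℚ.≤ h →
    (∃[ M ] ∀ n → M ℕ.≤ n → ∣ seq (re z) n ∣ ℚ.≤ h × ∣ seq (im z) n ∣ ℚ.≤ h) → ‖ z ‖≤ h ℚ.+ h
  ‖‖-components {z} 0≤h (M , k) = ‖‖-eventually (0≤+ 0≤h 0≤h)
    (M , λ n M≤n → ∣∣≤⇒norm²≤ {seq (re z) n} {seq (im z) n} (proj₁ (k n M≤n)) (proj₂ (k n M≤n)))

  ‖‖-closed : ∀ {z q} → (∀ ε → 0ℚ ℚ.< ε → ‖ z ‖≤ q ℚ.+ ε) → ‖ z ‖≤ q
  ‖‖-closed {z} {q} h = mk‖‖≤ (≤-from-ε λ ε 0<ε → nonNeg (h ε 0<ε)) λ ε 0<ε →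
    let δ = ½ ℚ.* ε
        M , k = eventually (h δ (0<½* 0<ε)) δ (0<½* 0<ε)
        eq : q ℚ.+ δ ℚ.+ δ ≡ q ℚ.+ ε
        eq = ≡.trans (ℚₚ.+-assoc q δ δ) (≡.cong (q ℚ.+_) (½+½ ε))
    in M , λ n M≤n → ≡.subst (λ c → seq ∣ z ∣² n ℚ.≤ c ℚ.* c) eq (k n M≤n)

  ‖‖-+ : ∀ {z w p q} → ‖ z ‖≤ p → ‖ w ‖≤ q → ‖ z + w ‖≤ p ℚ.+ q
  ‖‖-+ {z} {w} {p} {q} hz hw = mk‖‖≤ (0≤+ (nonNeg hz) (nonNeg hw)) λ ε 0<ε →
    let δ = ½ ℚ.* ε
        0<δ = 0<½* 0<ε
        M , kz = eventually hz δ 0<δ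
        N , kw = eventually hw δ 0<δ
        eq : (p ℚ.+ δ) ℚ.+ (q ℚ.+ δ) ≡ (p ℚ.+ q) ℚ.+ ε
        eq = ℚS.solve 3 (λ p q e → (p :+ con ½ :* e) :+ (q :+ con ½ :* e) := (p :+ q) :+ e) ≡.refl p q ε
    in M ⊔ N , λ n ≤n → ≡.subst (λ c → seq ∣ z + w ∣² n ℚ.≤ c ℚ.* c) eq
         (norm²-+ {seq (re z) n} {seq (im z) n} {seq (re w) n} {seq (im w) n} {p ℚ.+ δ} {q ℚ.+ δ}
           (0≤+ (nonNeg hz) (ℚₚ.<⇒≤ 0<δ)) (0≤+ (nonNeg hw) (ℚₚ.<⇒≤ 0<δ))
           (kz n (ℕₚ.m⊔n≤o⇒m≤o M N ≤n)) (kw n (ℕₚ.m⊔n≤o⇒n≤o M N ≤n)))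

  private
    -- For δ = ε / D the excess (p + q + δ) δ is at most D δ = ε as soon as δ ≤ 1 + ε, and this
    -- holds because D ≥ 1.
    split-product : ∀ {p q ε} → 0ℚ ℚ.≤ p → 0ℚ ℚ.≤ q → 0ℚ ℚ.< ε →
      ∃[ δ ] 0ℚ ℚ.< δ × (p ℚ.+ δ) ℚ.* (q ℚ.+ δ) ℚ.≤ p ℚ.* q ℚ.+ ε
    split-product {p} {q} {ε} 0≤p 0≤q 0<ε = δ , 0<δ , ≤-by slack 0≤slack eq
      where
      D : ℚ
      D = p ℚ.+ q ℚ.+ 1ℚ ℚ.+ ε
      0≤p+q+1 : 0ℚ ℚ.≤ p ℚ.+ q ℚ.+ 1ℚ
      0≤p+q+1 = 0≤+ {p ℚ.+ q} {1ℚ} (0≤+ {p} {q} 0≤p 0≤q) 0≤1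
      0<D : 0ℚ ℚ.< D
      0<D = ≡.subst (0ℚ ℚ.<_) (ℚₚ.+-comm ε (p ℚ.+ q ℚ.+ 1ℚ)) (0<+ {ε} {p ℚ.+ q ℚ.+ 1ℚ} 0<ε 0≤p+q+1)
      root = quotient-pos 0<D 0<ε
      δ = proj₁ root
      0<δ = proj₁ (proj₂ root)
      Dδ≡ε : D ℚ.* δ ≡ ε
      Dδ≡ε = proj₂ (proj₂ root)
      slack : ℚ
      slack = δ ℚ.* (1ℚ ℚ.+ ε ℚ.- δ)
      δ≤1+ε : δ ℚ.≤ 1ℚ ℚ.+ ε
      δ≤1+ε = ≤-by (1ℚ ℚ.+ (p ℚ.+ q ℚ.+ ε) ℚ.* δ) (0≤+ {1ℚ} {(p ℚ.+ q ℚ.+ ε) ℚ.* δ} 0≤1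
          (0≤* {p ℚ.+ q ℚ.+ ε} (0≤+ {p ℚ.+ q} {ε} (0≤+ {p} {q} 0≤p 0≤q) (ℚₚ.<⇒≤ 0<ε)) (ℚₚ.<⇒≤ 0<δ)))
        (≡.trans (ℚS.solve 4 (λ p q e d → d :+ (con 1ℚ :+ (p :+ q :+ e) :* d) := con 1ℚ :+ (p :+ q :+ con 1ℚ :+ e) :* d) ≡.refl p q ε δ)
          (≡.cong (1ℚ ℚ.+_) Dδ≡ε))
      0≤slack : 0ℚ ℚ.≤ slack
      0≤slack = 0≤* {δ} {1ℚ ℚ.+ ε ℚ.- δ} (ℚₚ.<⇒≤ 0<δ) (≤⇒0≤ δ≤1+ε)
      eq : (p ℚ.+ δ) ℚ.* (q ℚ.+ δ) ℚ.+ slack ≡ p ℚ.* q ℚ.+ ε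
      eq = ≡.trans (ℚS.solve 4 (λ p q e d → (p :+ d) :* (q :+ d) :+ d :* (con 1ℚ :+ e :- d) := p :* q :+ (p :+ q :+ con 1ℚ :+ e) :* d) ≡.refl p q ε δ)
        (≡.cong (p ℚ.* q ℚ.+_) Dδ≡ε)

  ‖‖-* : ∀ {z w p q} → ‖ z ‖≤ p → ‖ w ‖≤ q → ‖ z * w ‖≤ p ℚ.* q
  ‖‖-* {z} {w} {p} {q} hz hw = mk‖‖≤ (0≤* (nonNeg hz) (nonNeg hw)) λ ε 0<ε →
    let δ , 0<δ , le = split-product (nonNeg hz) (nonNeg hw) 0<ε
        M , kz = eventually hz δ 0<δ
        N , kw = eventually hw δ 0<δ
        0≤p+δ = 0≤+ (nonNeg hz) (ℚₚ.<⇒≤ 0<δ)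
        0≤q+δ = 0≤+ (nonNeg hw) (ℚₚ.<⇒≤ 0<δ)
    in M ⊔ N , λ n ≤n → begin
      seq ∣ z * w ∣² n
        ≡⟨ norm²-* (seq (re z) n) (seq (im z) n) (seq (re w) n) (seq (im w) n) ⟩
      seq ∣ z ∣² n ℚ.* seq ∣ w ∣² n
        ≤⟨ *-mono {seq ∣ z ∣² n} {(p ℚ.+ δ) ℚ.* (p ℚ.+ δ)} {seq ∣ w ∣² n} {(q ℚ.+ δ) ℚ.* (q ℚ.+ δ)} (0≤square (p ℚ.+ δ))
             (0≤+ {seq (re w) n ℚ.* seq (re w) n} {seq (im w) n ℚ.* seq (im w) n} (0≤square (seq (re w) n)) (0≤square (seq (im w) n)))
             (kz n (ℕₚ.m⊔n≤o⇒m≤o M N ≤n)) (kw n (ℕₚ.m⊔n≤o⇒n≤o M N ≤n)) ⟩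
      (p ℚ.+ δ) ℚ.* (p ℚ.+ δ) ℚ.* ((q ℚ.+ δ) ℚ.* (q ℚ.+ δ))
        ≡⟨ ℚS.solve 2 (λ p q → p :* p :* (q :* q) := (p :* q) :* (p :* q)) ≡.refl (p ℚ.+ δ) (q ℚ.+ δ) ⟩
      (p ℚ.+ δ) ℚ.* (q ℚ.+ δ) ℚ.* ((p ℚ.+ δ) ℚ.* (q ℚ.+ δ))
        ≤⟨ square-mono (0≤* 0≤p+δ 0≤q+δ) le ⟩
      (p ℚ.* q ℚ.+ ε) ℚ.* (p ℚ.* q ℚ.+ ε) ∎
    where open ℚₚ.≤-Reasoning

  eventually-bounded : ∀ (x : ℝ) → ∃[ B ] 0ℚ ℚ.≤ B × ∃[ N ] ∀ n → N ℕ.≤ n → ∣ seq x n ∣ ℚ.≤ B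
  eventually-bounded x = let N , h = cauchy x 1ℚ 0<1 in
    1ℚ ℚ.+ ∣ seq x N ∣ , 0≤+ {1ℚ} {∣ seq x N ∣} 0≤1 (ℚₚ.0≤∣p∣ (seq x N)) , N , λ n N≤n → begin
      ∣ seq x n ∣                                  ≡⟨ ≡.cong ∣_∣ (ℚS.solve 2 (λ a b → a := (a :- b) :+ b) ≡.refl (seq x n) (seq x N)) ⟩
      ∣ (seq x n ℚ.- seq x N) ℚ.+ seq x N ∣        ≤⟨ ℚₚ.∣p+q∣≤∣p∣+∣q∣ (seq x n ℚ.- seq x N) (seq x N) ⟩
      ∣ seq x n ℚ.- seq x N ∣ ℚ.+ ∣ seq x N ∣      ≤⟨ ℚₚ.+-monoˡ-≤ ∣ seq x N ∣ (ℚₚ.<⇒≤ (h n N N≤n ℕₚ.≤-refl)) ⟩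
      1ℚ ℚ.+ ∣ seq x N ∣                           ∎
    where open ℚₚ.≤-Reasoning

  ‖‖-finite : ∀ z → ∃[ q ] ‖ z ‖≤ q
  ‖‖-finite z =
    let A , 0≤A , M , ha = eventually-bounded (re z)
        B , 0≤B , N , hb = eventually-bounded (im z)
    in (A ℚ.+ B) ℚ.+ (A ℚ.+ B) , ‖‖-components (0≤+ {A} {B} 0≤A 0≤B) (M ⊔ N , λ n ≤n →
         ℚₚ.≤-trans (ha n (ℕₚ.m⊔n≤o⇒m≤o M N ≤n)) (≤-by B 0≤B ≡.refl) ,
         ℚₚ.≤-trans (hb n (ℕₚ.m⊔n≤o⇒n≤o M N ≤n)) (≤-by A 0≤A (ℚₚ.+-comm B A)))

  ‖‖⇒∣re∣ : ∀ {z q} → ‖ z ‖≤ q → ∀ ε → 0ℚ ℚ.< ε → ∃[ M ] ∀ n → M ℕ.≤ n → ∣ seq (re z) n ∣ ℚ.≤ q ℚ.+ ε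
  ‖‖⇒∣re∣ {z} h ε 0<ε = let M , k = eventually h ε 0<ε in
    M , λ n M≤n → norm²≤⇒∣re∣≤ {seq (re z) n} {seq (im z) n} (0≤+ (nonNeg h) (ℚₚ.<⇒≤ 0<ε)) (k n M≤n)

  ‖‖⇒∣im∣ : ∀ {z q} → ‖ z ‖≤ q → ∀ ε → 0ℚ ℚ.< ε → ∃[ M ] ∀ n → M ℕ.≤ n → ∣ seq (im z) n ∣ ℚ.≤ q ℚ.+ ε
  ‖‖⇒∣im∣ {z} h ε 0<ε = let M , k = eventually h ε 0<ε in
    M , λ n M≤n → norm²≤⇒∣im∣≤ {seq (re z) n} {seq (im z) n} (0≤+ (nonNeg h) (ℚₚ.<⇒≤ 0<ε)) (k n M≤n)

  -- Together with the converse below, this reduces the equivalence and congruence laws of `_≈_` to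
  -- norm estimates with bound 0.
  ≈⇒‖-‖≤0 : ∀ {z w} → z ≈ w → ‖ z - w ‖≤ 0ℚ
  ≈⇒‖-‖≤0 {z} {w} (hr , hi) = mk‖‖≤ ℚₚ.≤-refl λ ε 0<ε →
    let δ = ½ ℚ.* ε
        M , kr = hr δ (0<½* 0<ε)
        N , ki = hi δ (0<½* 0<ε)
        eq : δ ℚ.+ δ ≡ 0ℚ ℚ.+ ε
        eq = ≡.trans (½+½ ε) (≡.sym (ℚₚ.+-identityˡ ε))
    in M ⊔ N , λ n ≤n → ≡.subst (λ c → seq ∣ z - w ∣² n ℚ.≤ c ℚ.* c) eq
         (∣∣≤⇒norm²≤ {seq (re (z - w)) n} {seq (im (z - w)) n}
           (ℚₚ.<⇒≤ (kr n (ℕₚ.m⊔n≤o⇒m≤o M N ≤n))) (ℚₚ.<⇒≤ (ki n (ℕₚ.m⊔n≤o⇒n≤o M N ≤n))))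

  ‖-‖≤0⇒≈ : ∀ {z w} → ‖ z - w ‖≤ 0ℚ → z ≈ w
  ‖-‖≤0⇒≈ {z} {w} h =
    (λ ε 0<ε → let M , k = ‖‖⇒∣re∣ h (½ ℚ.* ε) (0<½* 0<ε) in M , λ n M≤n → small ε 0<ε (k n M≤n)) ,
    (λ ε 0<ε → let M , k = ‖‖⇒∣im∣ h (½ ℚ.* ε) (0<½* 0<ε) in M , λ n M≤n → small ε 0<ε (k n M≤n))
    where
    small : ∀ ε → 0ℚ ℚ.< ε → ∀ {a} → a ℚ.≤ 0ℚ ℚ.+ ½ ℚ.* ε → a ℚ.< ε
    small ε 0<ε {a} a≤ = ℚₚ.≤-<-trans (≡.subst (a ℚ.≤_) (ℚₚ.+-identityˡ (½ ℚ.* ε)) a≤) (½*< 0<ε)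

-- ℂ as a complete normed algebra.

module ComplexAlgebra where
  open ComplexNorm
  private
    module ℚS = +-*-Solver
    open ℚS using (_:+_; _:*_; _:-_; :-_; _:=_; con)

  ≐⇒≈ : ∀ {z w} → z ≐ w → z ≈ w
  ≐⇒≈ {z} {w} z≐w =
    (λ ε 0<ε → 0 , λ n _ → close (proj₁ (z≐w n)) 0<ε) , (λ ε 0<ε → 0 , λ n _ → close (proj₂ (z≐w n)) 0<ε)
    where
    close : ∀ {a b ε} → a ≡ b → 0ℚ ℚ.< ε → ∣ a ℚ.- b ∣ ℚ.< ε
    close {a} {.a} {ε} ≡.refl 0<ε = ≡.subst (ℚ._< ε) (≡.cong ∣_∣ (≡.sym (ℚₚ.+-inverseʳ a))) 0<ε

  ≈-refl : ∀ {z} → z ≈ z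
  ≈-refl {z} = ≐⇒≈ {z} {z} λ n → ≡.refl , ≡.refl

  ‖‖-swap : ∀ {z w q} → ‖ z - w ‖≤ q → ‖ w - z ‖≤ q
  ‖‖-swap {z} {w} = ‖‖-pointwise {z - w} {w - z} λ n → ℚₚ.≤-reflexive
    (ℚS.solve 4 (λ a b c d → (c :- a) :* (c :- a) :+ (d :- b) :* (d :- b) := (a :- c) :* (a :- c) :+ (b :- d) :* (b :- d))
      ≡.refl (seq (re z) n) (seq (im z) n) (seq (re w) n) (seq (im w) n))

  ≈-sym : ∀ {z w} → z ≈ w → w ≈ z
  ≈-sym {z} {w} h = ‖-‖≤0⇒≈ {w} {z} (‖‖-swap {z} {w} (≈⇒‖-‖≤0 {z} {w} h))

  ‖‖-triangle : ∀ {x z p q} y → ‖ x - y ‖≤ p → ‖ y - z ‖≤ q → ‖ x - z ‖≤ p ℚ.+ q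
  ‖‖-triangle {x} {z} y h k = ‖‖-≐ {(x - y) + (y - z)} {x - z}
    (λ n → telescope (seq (re x) n) (seq (re y) n) (seq (re z) n) , telescope (seq (im x) n) (seq (im y) n) (seq (im z) n))
    (‖‖-+ {x - y} {y - z} h k)
    where
    telescope : ∀ a b c → (a ℚ.- b) ℚ.+ (b ℚ.- c) ≡ a ℚ.- c
    telescope = ℚS.solve 3 (λ a b c → (a :- b) :+ (b :- c) := a :- c) ≡.refl

  ≈-trans : ∀ {x y z} → x ≈ y → y ≈ z → x ≈ z
  ≈-trans {x} {y} {z} h k = ‖-‖≤0⇒≈ {x} {z} (‖‖-triangle {x} {z} y (≈⇒‖-‖≤0 {x} {y} h) (≈⇒‖-‖≤0 {y} {z} k))

  ‖‖-resp : ∀ {x y q} → x ≈ y → ‖ x ‖≤ q → ‖ y ‖≤ q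
  ‖‖-resp {x} {y} {q} h k = ≡.subst (‖ y ‖≤_) (ℚₚ.+-identityˡ q) (‖‖-≐ {(y - x) + x} {y}
    (λ n → cancel (seq (re x) n) (seq (re y) n) , cancel (seq (im x) n) (seq (im y) n))
    (‖‖-+ {y - x} {x} (≈⇒‖-‖≤0 {y} {x} (≈-sym {x} {y} h)) k))
    where
    cancel : ∀ a b → (b ℚ.- a) ℚ.+ a ≡ b
    cancel = ℚS.solve 2 (λ a b → (b :- a) :+ a := b) ≡.refl

  +-cong : ∀ {x y u v} → x ≈ y → u ≈ v → x + u ≈ y + v
  +-cong {x} {y} {u} {v} h k = ‖-‖≤0⇒≈ {x + u} {y + v} (‖‖-≐ {(x - y) + (u - v)} {(x + u) - (y + v)}
    (λ n → exchange (seq (re x) n) (seq (re y) n) (seq (re u) n) (seq (re v) n) , exchange (seq (im x) n) (seq (im y) n) (seq (im u) n) (seq (im v) n))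
    (‖‖-+ {x - y} {u - v} (≈⇒‖-‖≤0 {x} {y} h) (≈⇒‖-‖≤0 {u} {v} k)))
    where
    exchange : ∀ a b c d → (a ℚ.- b) ℚ.+ (c ℚ.- d) ≡ (a ℚ.+ c) ℚ.- (b ℚ.+ d)
    exchange = ℚS.solve 4 (λ a b c d → (a :- b) :+ (c :- d) := (a :+ c) :- (b :+ d)) ≡.refl

  *-cong : ∀ {x y u v} → x ≈ y → u ≈ v → x * u ≈ y * v
  *-cong {x} {y} {u} {v} h k =
    let p , hu = ‖‖-finite u
        q , hy = ‖‖-finite y
        eq : 0ℚ ℚ.* p ℚ.+ q ℚ.* 0ℚ ≡ 0ℚ
        eq = ≡.cong₂ ℚ._+_ (ℚₚ.*-zeroˡ p) (ℚₚ.*-zeroʳ q)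
    in ‖-‖≤0⇒≈ {x * u} {y * v} (‖‖-≐ {(x - y) * u + y * (u - v)} {x * u - y * v}
      (λ n → real (seq (re x) n) (seq (im x) n) (seq (re y) n) (seq (im y) n) (seq (re u) n) (seq (im u) n) (seq (re v) n) (seq (im v) n) ,
             imag (seq (re x) n) (seq (im x) n) (seq (re y) n) (seq (im y) n) (seq (re u) n) (seq (im u) n) (seq (re v) n) (seq (im v) n))
      (≡.subst (‖ (x - y) * u + y * (u - v) ‖≤_) eq (‖‖-+ {(x - y) * u} {y * (u - v)}
        (‖‖-* {x - y} {u} (≈⇒‖-‖≤0 {x} {y} h) hu) (‖‖-* {y} {u - v} hy (≈⇒‖-‖≤0 {u} {v} k)))))
    where
    real : ∀ a a′ b b′ c c′ d d′ →
      ((a ℚ.- b) ℚ.* c ℚ.+ ℚ.- ((a′ ℚ.- b′) ℚ.* c′)) ℚ.+ (b ℚ.* (c ℚ.- d) ℚ.+ ℚ.- (b′ ℚ.* (c′ ℚ.- d′)))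
        ≡ (a ℚ.* c ℚ.+ ℚ.- (a′ ℚ.* c′)) ℚ.- (b ℚ.* d ℚ.+ ℚ.- (b′ ℚ.* d′))
    real = ℚS.solve 8 (λ a a′ b b′ c c′ d d′ →
      ((a :- b) :* c :+ :- ((a′ :- b′) :* c′)) :+ (b :* (c :- d) :+ :- (b′ :* (c′ :- d′)))
        := (a :* c :+ :- (a′ :* c′)) :- (b :* d :+ :- (b′ :* d′))) ≡.refl
    imag : ∀ a a′ b b′ c c′ d d′ →
      ((a ℚ.- b) ℚ.* c′ ℚ.+ (a′ ℚ.- b′) ℚ.* c) ℚ.+ (b ℚ.* (c′ ℚ.- d′) ℚ.+ b′ ℚ.* (c ℚ.- d))
        ≡ (a ℚ.* c′ ℚ.+ a′ ℚ.* c) ℚ.- (b ℚ.* d′ ℚ.+ b′ ℚ.* d)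
    imag = ℚS.solve 8 (λ a a′ b b′ c c′ d d′ →
      ((a :- b) :* c′ :+ (a′ :- b′) :* c) :+ (b :* (c′ :- d′) :+ b′ :* (c :- d))
        := (a :* c′ :+ a′ :* c) :- (b :* d′ :+ b′ :* d)) ≡.refl

  -‿cong : ∀ {x y} → x ≈ y → - x ≈ - y
  -‿cong {x} {y} h = ‖-‖≤0⇒≈ { - x} { - y} (‖‖-pointwise {x - y} {(- x) - (- y)}
    (λ n → ℚₚ.≤-reflexive (ℚS.solve 4 (λ a b c d → (:- a :- :- c) :* (:- a :- :- c) :+ (:- b :- :- d) :* (:- b :- :- d)
      := (a :- c) :* (a :- c) :+ (b :- d) :* (b :- d)) ≡.refl (seq (re x) n) (seq (im x) n) (seq (re y) n) (seq (im y) n)))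
    (≈⇒‖-‖≤0 {x} {y} h))

  private
    *-assoc : ∀ x y z → (x * y) * z ≈ x * (y * z)
    *-assoc x y z = ≐⇒≈ {(x * y) * z} {x * (y * z)} λ n →
      ℚS.solve 6 (λ a b c d e f → (a :* c :+ :- (b :* d)) :* e :+ :- ((a :* d :+ b :* c) :* f)
        := a :* (c :* e :+ :- (d :* f)) :+ :- (b :* (c :* f :+ d :* e))) ≡.refl
        (seq (re x) n) (seq (im x) n) (seq (re y) n) (seq (im y) n) (seq (re z) n) (seq (im z) n) ,
      ℚS.solve 6 (λ a b c d e f → (a :* c :+ :- (b :* d)) :* f :+ (a :* d :+ b :* c) :* e
        := a :* (c :* f :+ d :* e) :+ b :* (c :* e :+ :- (d :* f))) ≡.refl
        (seq (re x) n) (seq (im x) n) (seq (re y) n) (seq (im y) n) (seq (re z) n) (seq (im z) n)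

    *-comm : ∀ x y → x * y ≈ y * x
    *-comm x y = ≐⇒≈ {x * y} {y * x} λ n →
      ℚS.solve 4 (λ a b c d → a :* c :+ :- (b :* d) := c :* a :+ :- (d :* b)) ≡.refl
        (seq (re x) n) (seq (im x) n) (seq (re y) n) (seq (im y) n) ,
      ℚS.solve 4 (λ a b c d → a :* d :+ b :* c := c :* b :+ d :* a) ≡.refl
        (seq (re x) n) (seq (im x) n) (seq (re y) n) (seq (im y) n)

    *-identityˡ : ∀ x → 1ℂ * x ≈ x
    *-identityˡ x = ≐⇒≈ {1ℂ * x} {x} λ n →
      ℚS.solve 2 (λ a b → con 1ℚ :* a :+ :- (con 0ℚ :* b) := a) ≡.refl (seq (re x) n) (seq (im x) n) ,
      ℚS.solve 2 (λ a b → con 1ℚ :* b :+ con 0ℚ :* a := b) ≡.refl (seq (re x) n) (seq (im x) n)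

    distribˡ : ∀ x y z → x * (y + z) ≈ x * y + x * z
    distribˡ x y z = ≐⇒≈ {x * (y + z)} {x * y + x * z} λ n →
      ℚS.solve 6 (λ a b c d e f → a :* (c :+ e) :+ :- (b :* (d :+ f)) := (a :* c :+ :- (b :* d)) :+ (a :* e :+ :- (b :* f))) ≡.refl
        (seq (re x) n) (seq (im x) n) (seq (re y) n) (seq (im y) n) (seq (re z) n) (seq (im z) n) ,
      ℚS.solve 6 (λ a b c d e f → a :* (d :+ f) :+ b :* (c :+ e) := (a :* d :+ b :* c) :+ (a :* f :+ b :* e)) ≡.refl
        (seq (re x) n) (seq (im x) n) (seq (re y) n) (seq (im y) n) (seq (re z) n) (seq (im z) n)

    +-assoc : ∀ x y z → (x + y) + z ≈ x + (y + z)
    +-assoc x y z = ≐⇒≈ {(x + y) + z} {x + (y + z)} λ n →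
      ℚₚ.+-assoc (seq (re x) n) (seq (re y) n) (seq (re z) n) , ℚₚ.+-assoc (seq (im x) n) (seq (im y) n) (seq (im z) n)

    +-comm : ∀ x y → x + y ≈ y + x
    +-comm x y = ≐⇒≈ {x + y} {y + x} λ n →
      ℚₚ.+-comm (seq (re x) n) (seq (re y) n) , ℚₚ.+-comm (seq (im x) n) (seq (im y) n)

    +-identityˡ : ∀ x → 0ℂ + x ≈ x
    +-identityˡ x = ≐⇒≈ {0ℂ + x} {x} λ n →
      ℚₚ.+-identityˡ (seq (re x) n) , ℚₚ.+-identityˡ (seq (im x) n)

    -‿inverseˡ : ∀ x → (- x) + x ≈ 0ℂ
    -‿inverseˡ x = ≐⇒≈ {(- x) + x} {0ℂ} λ n → ℚₚ.+-inverseˡ (seq (re x) n) , ℚₚ.+-inverseˡ (seq (im x) n)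

  ℂ-commutativeRing : CommutativeRing 0ℓ 0ℓ
  ℂ-commutativeRing = record
    { Carrier = ℂ ; _≈_ = _≈_ ; _+_ = _+_ ; _*_ = _*_ ; -_ = -_ ; 0# = 0ℂ ; 1# = 1ℂ
    ; isCommutativeRing = record
      { isRing = record
        { +-isAbelianGroup = record
          { isGroup = record
            { isMonoid = record
              { isSemigroup = record
                { isMagma = record
                  { isEquivalence = record
                    { refl = λ {x} → ≈-refl {x} ; sym = λ {x} {y} → ≈-sym {x} {y} ; trans = λ {x} {y} {z} → ≈-trans {x} {y} {z} }
                  ; ∙-cong = λ {x} {y} {u} {v} → +-cong {x} {y} {u} {v} }
                ; assoc = +-assoc }
              ; identity = +-identityˡ , λ x → ≈-trans {x + 0ℂ} {0ℂ + x} {x} (+-comm x 0ℂ) (+-identityˡ x) }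
            ; inverse = -‿inverseˡ , λ x → ≈-trans {x + - x} {(- x) + x} {0ℂ} (+-comm x (- x)) (-‿inverseˡ x)
            ; ⁻¹-cong = λ {x} {y} → -‿cong {x} {y} }
          ; comm = +-comm }
        ; *-cong = λ {x} {y} {u} {v} → *-cong {x} {y} {u} {v}
        ; *-assoc = *-assoc
        ; *-identity = *-identityˡ , λ x → ≈-trans {x * 1ℂ} {1ℂ * x} {x} (*-comm x 1ℂ) (*-identityˡ x)
        ; distrib = distribˡ , λ x y z → ≈-trans {(y + z) * x} {x * (y + z)} {y * x + z * x} (*-comm (y + z) x)
            (≈-trans {x * (y + z)} {x * y + x * z} {y * x + z * x} (distribˡ x y z)
              (+-cong {x * y} {y * x} {x * z} {z * x} (*-comm x y) (*-comm x z))) }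
      ; *-comm = *-comm } }

  -- Completeness

  infix 4 _⟶_
  _⟶_ : (ℕ → ℂ) → ℂ → Set
  x ⟶ y = ∀ ε → 0ℚ ℚ.< ε → ∃[ N ] ∀ n → N ℕ.≤ n → ‖ x n - y ‖≤ ε

  private
    module Completeness (x : ℕ → ℂ)
      (x-cauchy : ∀ ε → 0ℚ ℚ.< ε → ∃[ N ] ∀ m n → N ℕ.≤ m → N ℕ.≤ n → ‖ x m - x n ‖≤ ε) where

      κ : ℕ → ℚ
      κ k = recip (suc k)

      0<κ : ∀ k → 0ℚ ℚ.< κ k
      0<κ k = 0<recip (suc k)

      0≤κ : ∀ k → 0ℚ ℚ.≤ κ k
      0≤κ k = 0≤recip (suc k)

      -- The term x (K k) approximates the limit, and its M k-th rational term approximates x (K k), each to within κ k.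
      K : ℕ → ℕ
      K k = proj₁ (x-cauchy (κ k) (0<κ k))

      M : ℕ → ℕ
      M k = proj₁ (cauchy (re (x (K k))) (κ k) (0<κ k)) ⊔ proj₁ (cauchy (im (x (K k))) (κ k) (0<κ k))

      a b : ℕ → ℚ
      a k = seq (re (x (K k))) (M k)
      b k = seq (im (x (K k))) (M k)

      -- The k-th rational approximation as a constant sequence, so that its distance to other
      -- points is a norm in ℂ; the limit has these points as its terms.
      sample : ℕ → ℂ
      sample k = fromℚ (a k) +i fromℚ (b k)

      z-sample : ∀ k → ‖ x (K k) - sample k ‖≤ κ k ℚ.+ κ k
      z-sample k = ‖‖-components {x (K k) - sample k} (0≤κ k) (M k , λ n M≤n →
        let Nr = proj₁ (cauchy (re (x (K k))) (κ k) (0<κ k))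
            Ni = proj₁ (cauchy (im (x (K k))) (κ k) (0<κ k))
        in ℚₚ.<⇒≤ (proj₂ (cauchy (re (x (K k))) (κ k) (0<κ k)) n (M k) (ℕₚ.m⊔n≤o⇒m≤o Nr Ni M≤n) (ℕₚ.m≤m⊔n Nr Ni)) ,
           ℚₚ.<⇒≤ (proj₂ (cauchy (im (x (K k))) (κ k) (0<κ k)) n (M k) (ℕₚ.m⊔n≤o⇒n≤o Nr Ni M≤n) (ℕₚ.m≤n⊔m Nr Ni)))

      x-z : ∀ k n → K k ℕ.≤ n → ‖ x n - x (K k) ‖≤ κ k
      x-z k n N≤n = proj₂ (x-cauchy (κ k) (0<κ k)) n (K k) N≤n (ℕₚ.≤-refl {K k})

      x-sample : ∀ k n → K k ℕ.≤ n → ‖ x n - sample k ‖≤ κ k ℚ.+ (κ k ℚ.+ κ k)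
      x-sample k n N≤n = ‖‖-triangle {x n} {sample k} (x (K k)) (x-z k n N≤n) (z-sample k)

      -- A sample lies within 3 κ of all late terms of x; two samples are compared through a common
      -- late term.
      gap : ℕ → ℕ → ℚ
      gap j k = (κ j ℚ.+ (κ j ℚ.+ κ j)) ℚ.+ (κ k ℚ.+ (κ k ℚ.+ κ k))

      sample-sample : ∀ j k → ‖ sample j - sample k ‖≤ gap j k
      sample-sample j k =
        let n = K j ⊔ K k in
        ‖‖-triangle {sample j} {sample k} (x n)
             (‖‖-swap {x n} {sample j} (x-sample j n (ℕₚ.m≤m⊔n (K j) (K k)))) (x-sample k n (ℕₚ.m≤n⊔m (K j) (K k)))

      a-a : ∀ j k → ∣ a j ℚ.- a k ∣ ℚ.≤ gap j k
      a-a j k = ≤-from-ε λ ε 0<ε → let N , h = ‖‖⇒∣re∣ (sample-sample j k) ε 0<ε in h N ℕₚ.≤-refl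

      b-b : ∀ j k → ∣ b j ℚ.- b k ∣ ℚ.≤ gap j k
      b-b j k = ≤-from-ε λ ε 0<ε → let N , h = ‖‖⇒∣im∣ (sample-sample j k) ε 0<ε in h N ℕₚ.≤-refl

      triple-mono : ∀ {s t} → s ℚ.≤ t → s ℚ.+ (s ℚ.+ s) ℚ.≤ t ℚ.+ (t ℚ.+ t)
      triple-mono s≤t = ℚₚ.+-mono-≤ s≤t (ℚₚ.+-mono-≤ s≤t s≤t)

      sixth : ∀ ε → 0ℚ ℚ.< ε → ∃[ δ ] 0ℚ ℚ.< δ × (δ ℚ.+ (δ ℚ.+ δ)) ℚ.+ (δ ℚ.+ (δ ℚ.+ δ)) ℚ.< ε
      -- Here δ = ε / 8, so that 6 δ = ε - 2 δ is strictly smaller than ε.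
      sixth ε 0<ε = ½ ℚ.* (½ ℚ.* (½ ℚ.* ε)) , 0<δ ,
        <-by (½ ℚ.* (½ ℚ.* (½ ℚ.* ε)) ℚ.+ ½ ℚ.* (½ ℚ.* (½ ℚ.* ε))) (0<+ 0<δ (ℚₚ.<⇒≤ 0<δ)) (ℚS.solve 1 (λ e →
          let δ = con ½ :* (con ½ :* (con ½ :* e)) in (δ :+ (δ :+ δ)) :+ (δ :+ (δ :+ δ)) :+ (δ :+ δ) := e) ≡.refl ε)
        where
        0<δ : 0ℚ ℚ.< ½ ℚ.* (½ ℚ.* (½ ℚ.* ε))
        0<δ = 0<½* (0<½* (0<½* 0<ε))

      κ-cauchy : ∀ {c : ℕ → ℚ} → (∀ j k → ∣ c j ℚ.- c k ∣ ℚ.≤ gap j k) → IsCauchy c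
      κ-cauchy h ε 0<ε =
        let δ , 0<δ , 6δ<ε = sixth ε 0<ε
            N , κ≤δ = Null-recip δ 0<δ
        in N , λ m n N≤m N≤n → ℚₚ.≤-<-trans (ℚₚ.≤-trans (h m n)
             (ℚₚ.+-mono-≤ (triple-mono (κ≤δ m N≤m)) (triple-mono (κ≤δ n N≤n)))) 6δ<ε

      limit : ℂ
      limit = mkℝ a (κ-cauchy {a} a-a) +i mkℝ b (κ-cauchy {b} b-b)

      sample-limit : ∀ k → ‖ sample k - limit ‖≤ gap k k ℚ.+ gap k k
      sample-limit k = ‖‖-components {sample k - limit} 0≤gap (k , λ j k≤j →
          ℚₚ.≤-trans (a-a k j) (later j k≤j) , ℚₚ.≤-trans (b-b k j) (later j k≤j))
        where
        0≤3κ : 0ℚ ℚ.≤ κ k ℚ.+ (κ k ℚ.+ κ k)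
        0≤3κ = 0≤+ (0≤κ k) (0≤+ (0≤κ k) (0≤κ k))
        0≤gap : 0ℚ ℚ.≤ gap k k
        0≤gap = 0≤+ 0≤3κ 0≤3κ
        later : ∀ j → k ℕ.≤ j → gap k j ℚ.≤ gap k k
        later j k≤j = ℚₚ.+-monoʳ-≤ (κ k ℚ.+ (κ k ℚ.+ κ k)) (triple-mono (recip-antimono {suc k} {suc j} (ℕ.s≤s k≤j)))

      x⟶limit : x ⟶ limit
      x⟶limit ε 0<ε =
        let δ , 0<δ , small = fraction ε 0<ε
            k , κ≤δ = Null-recip δ 0<δ
        in K k , λ n N≤n →
             ‖‖-mono {x n - limit} (ℚₚ.≤-trans (ℚₚ.+-mono-≤ (triple-mono (κ≤δ k ℕₚ.≤-refl)) (double-mono (double-mono (triple-mono (κ≤δ k ℕₚ.≤-refl))))) small)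
               (‖‖-triangle {x n} {limit} (sample k) (x-sample k n N≤n) (sample-limit k))
        where
        double-mono : ∀ {s t} → s ℚ.≤ t → s ℚ.+ s ℚ.≤ t ℚ.+ t
        double-mono s≤t = ℚₚ.+-mono-≤ s≤t s≤t
        fraction : ∀ ε → 0ℚ ℚ.< ε → ∃[ δ ] 0ℚ ℚ.< δ ×
          let t = δ ℚ.+ (δ ℚ.+ δ) in t ℚ.+ ((t ℚ.+ t) ℚ.+ (t ℚ.+ t)) ℚ.≤ ε
        -- Here δ = ε / 16: the estimates 3 κ and 4 · 3 κ add up to at most 15 δ.
        fraction ε 0<ε = ½ ℚ.* (½ ℚ.* (½ ℚ.* (½ ℚ.* ε))) , 0<δ , ≤-by (½ ℚ.* (½ ℚ.* (½ ℚ.* (½ ℚ.* ε)))) (ℚₚ.<⇒≤ 0<δ)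
          (ℚS.solve 1 (λ e → let δ = con ½ :* (con ½ :* (con ½ :* (con ½ :* e)))
                                 t = δ :+ (δ :+ δ) in t :+ ((t :+ t) :+ (t :+ t)) :+ δ := e) ≡.refl ε)
          where
          0<δ : 0ℚ ℚ.< ½ ℚ.* (½ ℚ.* (½ ℚ.* (½ ℚ.* ε)))
          0<δ = 0<½* (0<½* (0<½* (0<½* 0<ε)))

  complete : ∀ x → (∀ ε → 0ℚ ℚ.< ε → ∃[ N ] ∀ m n → N ℕ.≤ m → N ℕ.≤ n → ‖ x m - x n ‖≤ ε) → ∃[ y ] x ⟶ y
  complete x h = Completeness.limit x h , Completeness.x⟶limit x h

  -- Real numbers inside ℂ

  Real : ℂ → Set
  Real z = ∃[ l ] z ≈ fromℝ l

  -- Asks for a representative with all terms nonnegative, so that sums and products are treated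
  -- termwise. If the terms are nonnegative only eventually, `shift` provides such a representative.
  NonNeg : ℂ → Set
  NonNeg z = ∃[ l ] z ≈ fromℝ l × (∀ n → 0ℚ ℚ.≤ seq l n)

  fromℝ-+ : ∀ l m → fromℝ l + fromℝ m ≈ fromℝ (l +ʳ m)
  fromℝ-+ l m = ≐⇒≈ {fromℝ l + fromℝ m} {fromℝ (l +ʳ m)} λ n → ≡.refl , ≡.refl

  fromℝ-* : ∀ l m → fromℝ l * fromℝ m ≈ fromℝ (l *ʳ m)
  fromℝ-* l m = ≐⇒≈ {fromℝ l * fromℝ m} {fromℝ (l *ʳ m)} λ n →
    ℚS.solve 2 (λ a b → a :* b :+ :- (con 0ℚ :* con 0ℚ) := a :* b) ≡.refl (seq l n) (seq m n) ,
    ℚS.solve 2 (λ a b → a :* con 0ℚ :+ con 0ℚ :* b := con 0ℚ) ≡.refl (seq l n) (seq m n)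

  fromℝ-neg : ∀ l → - fromℝ l ≈ fromℝ (-ʳ l)
  fromℝ-neg l = ≐⇒≈ { - fromℝ l} {fromℝ (-ʳ l)} λ n → ≡.refl , ≡.refl

  private
    +-fromℝ : ∀ {x y l m} → x ≈ fromℝ l → y ≈ fromℝ m → x + y ≈ fromℝ (l +ʳ m)
    +-fromℝ {x} {y} {l} {m} h k = ≈-trans {x + y} {fromℝ l + fromℝ m} {fromℝ (l +ʳ m)}
      (+-cong {x} {fromℝ l} {y} {fromℝ m} h k) (fromℝ-+ l m)

    *-fromℝ : ∀ {x y l m} → x ≈ fromℝ l → y ≈ fromℝ m → x * y ≈ fromℝ (l *ʳ m)
    *-fromℝ {x} {y} {l} {m} h k = ≈-trans {x * y} {fromℝ l * fromℝ m} {fromℝ (l *ʳ m)}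
      (*-cong {x} {fromℝ l} {y} {fromℝ m} h k) (fromℝ-* l m)

  Real-resp : ∀ {x y} → x ≈ y → Real x → Real y
  Real-resp {x} {y} h (l , k) = l , ≈-trans {y} {x} {fromℝ l} (≈-sym {x} {y} h) k

  -- The imaginary part of y is at most the distance from y to a real x N, hence at most every ε.
  Real-lim : ∀ {x y} → (∀ n → Real (x n)) → x ⟶ y → Real y
  Real-lim {x} {y} h x⟶y = re y , ‖-‖≤0⇒≈ {y} {fromℝ (re y)} (‖‖-closed {y - fromℝ (re y)} λ ε 0<ε →
    ≡.subst (‖ y - fromℝ (re y) ‖≤_) (≡.sym (ℚₚ.+-identityˡ ε)) (close ε 0<ε))
    where
    close : ∀ ε → 0ℚ ℚ.< ε → ‖ y - fromℝ (re y) ‖≤ ε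
    close ε 0<ε =
      let N , k = x⟶y ε 0<ε
          l , xN≈l = h N
      in ‖‖-pointwise {fromℝ l - y} {y - fromℝ (re y)}
           (λ n → ≤-by ((seq l n ℚ.- seq (re y) n) ℚ.* (seq l n ℚ.- seq (re y) n)) (0≤square (seq l n ℚ.- seq (re y) n))
             (ℚS.solve 3 (λ l a b → (a :- a) :* (a :- a) :+ (b :- con 0ℚ) :* (b :- con 0ℚ) :+ (l :- a) :* (l :- a)
                := (l :- a) :* (l :- a) :+ (con 0ℚ :- b) :* (con 0ℚ :- b)) ≡.refl (seq l n) (seq (re y) n) (seq (im y) n)))
           (‖‖-resp {x N - y} {fromℝ l - y} (+-cong {x N} {fromℝ l} { - y} { - y} xN≈l (≈-refl { - y})) (k N ℕₚ.≤-refl))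

  ‖‖-NonNeg : ∀ {x y q} → NonNeg x → NonNeg y → ‖ x + y ‖≤ q → ‖ x ‖≤ q
  ‖‖-NonNeg {x} {y} (l , x≈l , 0≤l) (m , y≈m , 0≤m) h = ‖‖-resp {fromℝ l} {x} (≈-sym {x} {fromℝ l} x≈l)
    (‖‖-pointwise {fromℝ (l +ʳ m)} {fromℝ l}
      (λ n → ℚₚ.+-monoˡ-≤ (0ℚ ℚ.* 0ℚ) {seq l n ℚ.* seq l n} {(seq l n ℚ.+ seq m n) ℚ.* (seq l n ℚ.+ seq m n)}
        (square-mono {seq l n} {seq l n ℚ.+ seq m n} (0≤l n) (≤-by (seq m n) (0≤m n) ≡.refl)))
      (‖‖-resp {x + y} {fromℝ (l +ʳ m)} (+-fromℝ {x} {y} {l} {m} x≈l y≈m) h))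

  shift : ℕ → ℝ → ℝ
  shift M l = mkℝ (λ n → seq l (M ℕ.+ n)) λ ε 0<ε → let N , h = cauchy l ε 0<ε in
    N , λ m n N≤m N≤n → h (M ℕ.+ m) (M ℕ.+ n) (ℕₚ.≤-trans N≤m (ℕₚ.m≤n+m m M)) (ℕₚ.≤-trans N≤n (ℕₚ.m≤n+m n M))

  shift-≈ : ∀ M l → fromℝ l ≈ fromℝ (shift M l)
  shift-≈ M l = (λ ε 0<ε → let N , h = cauchy l ε 0<ε in
      N , λ n N≤n → h n (M ℕ.+ n) N≤n (ℕₚ.≤-trans N≤n (ℕₚ.m≤n+m n M))) ,
    (λ ε 0<ε → 0 , λ n _ → 0<ε)

  NonNeg-eventually : ∀ {z l} → z ≈ fromℝ l → (∃[ M ] ∀ n → M ℕ.≤ n → 0ℚ ℚ.≤ seq l n) → NonNeg z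
  NonNeg-eventually {z} {l} h (M , k) = shift M l , ≈-trans {z} {fromℝ l} {fromℝ (shift M l)} h (shift-≈ M l) ,
    λ n → k (M ℕ.+ n) (ℕₚ.m≤m+n M n)

  -- A single rational term q, within ½ ε of all later ones, is compared with ± ½ ε. Beyond either
  -- threshold all later terms share its sign; between them they are at most ε in absolute value.
  Real-sign : ∀ {x} → Real x → ∀ ε → 0ℚ ℚ.< ε → ‖ x ‖≤ ε ⊎ NonNeg x ⊎ NonNeg (- x)
  Real-sign {x} (l , x≈l) ε 0<ε = decide (ℚₚ.≤-total δ q) (ℚₚ.≤-total q (ℚ.- δ))
    where
    open ℚₚ.≤-Reasoning
    δ q : ℚ
    δ = ½ ℚ.* ε
    0<δ = 0<½* 0<ε
    M = proj₁ (cauchy l δ 0<δ)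
    q = seq l M
    close : ∀ n → M ℕ.≤ n → ∣ seq l n ℚ.- q ∣ ℚ.≤ δ
    close n M≤n = ℚₚ.<⇒≤ (proj₂ (cauchy l δ 0<δ) n M M≤n ℕₚ.≤-refl)
    below : ∀ n → M ℕ.≤ n → q ℚ.- seq l n ℚ.≤ δ
    below n M≤n = ℚₚ.≤-trans (≤∣∣ (q ℚ.- seq l n)) (≡.subst (ℚ._≤ δ)
      (≡.trans (≡.sym (ℚₚ.∣-p∣≡∣p∣ (seq l n ℚ.- q))) (≡.cong ∣_∣ (ℚS.solve 2 (λ a b → :- (a :- b) := b :- a) ≡.refl (seq l n) q)))
      (close n M≤n))
    above : ∀ n → M ℕ.≤ n → seq l n ℚ.- q ℚ.≤ δ
    above n M≤n = ℚₚ.≤-trans (≤∣∣ (seq l n ℚ.- q)) (close n M≤n)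
    decide : (δ ℚ.≤ q ⊎ q ℚ.≤ δ) → (q ℚ.≤ ℚ.- δ ⊎ ℚ.- δ ℚ.≤ q) → ‖ x ‖≤ ε ⊎ NonNeg x ⊎ NonNeg (- x)
    decide (inj₁ δ≤q) _ = inj₂ (inj₁ (NonNeg-eventually {x} {l} x≈l (M , λ n M≤n →
      ≡.subst (0ℚ ℚ.≤_) (ℚS.solve 3 (λ d q a → (q :- d) :+ (d :- (q :- a)) := a) ≡.refl δ q (seq l n))
        (0≤+ {q ℚ.- δ} {δ ℚ.- (q ℚ.- seq l n)} (≤⇒0≤ δ≤q) (≤⇒0≤ (below n M≤n))))))
    decide (inj₂ _) (inj₁ q≤-δ) = inj₂ (inj₂ (NonNeg-eventually { - x} { -ʳ l}
      (≈-trans { - x} { - fromℝ l} {fromℝ (-ʳ l)} (-‿cong {x} {fromℝ l} x≈l) (fromℝ-neg l)) (M , λ n M≤n →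
      ≡.subst (0ℚ ℚ.≤_) (ℚS.solve 3 (λ d q a → (:- d :- q) :+ (d :- (a :- q)) := :- a) ≡.refl δ q (seq l n))
        (0≤+ {ℚ.- δ ℚ.- q} {δ ℚ.- (seq l n ℚ.- q)} (≤⇒0≤ q≤-δ) (≤⇒0≤ (above n M≤n))))))
    decide (inj₂ q≤δ) (inj₂ -δ≤q) = inj₁ (‖‖-resp {fromℝ l} {x} (≈-sym {x} {fromℝ l} x≈l)
      (‖‖-eventually {fromℝ l} (ℚₚ.<⇒≤ 0<ε) (M , λ n M≤n →
        ≤-by ((ε ℚ.- seq l n) ℚ.* (ε ℚ.+ seq l n))
          (0≤* {ε ℚ.- seq l n} {ε ℚ.+ seq l n}
            (≡.subst (0ℚ ℚ.≤_) (ℚS.solve 3 (λ e q a → (con ½ :* e :- q) :+ (con ½ :* e :- (a :- q)) := e :- a) ≡.refl ε q (seq l n))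
              (0≤+ {δ ℚ.- q} {δ ℚ.- (seq l n ℚ.- q)} (≤⇒0≤ q≤δ) (≤⇒0≤ (above n M≤n))))
            (≡.subst (0ℚ ℚ.≤_) (ℚS.solve 3 (λ e q a → (q :- :- (con ½ :* e)) :+ (con ½ :* e :- (q :- a)) := e :+ a) ≡.refl ε q (seq l n))
              (0≤+ {q ℚ.- ℚ.- δ} {δ ℚ.- (q ℚ.- seq l n)} (≤⇒0≤ -δ≤q) (≤⇒0≤ (below n M≤n)))))
          (ℚS.solve 2 (λ e a → a :* a :+ con 0ℚ :* con 0ℚ :+ (e :- a) :* (e :+ a) := e :* e) ≡.refl ε (seq l n)))))

  open CommutativeRing ℂ-commutativeRing using () renaming (_-_ to _-ᴿ_)

  -- The two differences agree definitionally, but at the level of ℂ the conversion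
  -- checker would compare their Cauchy proofs; term by term it only compares rationals.
  from-ring-difference : ∀ {x y q} → ‖ x -ᴿ y ‖≤ q → ‖ x - y ‖≤ q
  from-ring-difference {x} {y} = ‖‖-pointwise {x -ᴿ y} {x - y} λ n → ℚₚ.≤-refl

  to-ring-difference : ∀ {x y q} → ‖ x - y ‖≤ q → ‖ x -ᴿ y ‖≤ q
  to-ring-difference {x} {y} = ‖‖-pointwise {x - y} {x -ᴿ y} λ n → ℚₚ.≤-refl

  ℂ-algebra : CompleteNormedAlgebra
  ℂ-algebra = record
    { commutativeRing = ℂ-commutativeRing
    ; ι = ofℚ
    ; ι-+ = λ p q → ≐⇒≈ {ofℚ (p ℚ.+ q)} {ofℚ p + ofℚ q} λ n → ≡.refl , ≡.refl
    ; ι-* = λ p q → ≈-sym {ofℚ p * ofℚ q} {ofℚ (p ℚ.* q)} (≐⇒≈ {ofℚ p * ofℚ q} {ofℚ (p ℚ.* q)} λ n → proj₁-* p q , proj₂-* p q)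
    ; ι-neg = λ p → ≐⇒≈ {ofℚ (ℚ.- p)} { - ofℚ p} λ n → ≡.refl , ≡.refl
    ; ι-0 = ≈-refl {0ℂ}
    ; ι-1 = ≈-refl {1ℂ}
    ; ‖_‖≤_ = ‖_‖≤_
    ; ‖‖-nonNeg = nonNeg
    ; ‖‖-resp = λ {x} {y} → ‖‖-resp {x} {y}
    ; ‖‖-mono = λ {x} → ‖‖-mono {x}
    ; ‖‖-+ = λ {x} {y} → ‖‖-+ {x} {y}
    ; ‖‖-* = λ {x} {y} → ‖‖-* {x} {y}
    ; ‖‖-ι = λ q → ‖‖-eventually {ofℚ q} (ℚₚ.0≤∣p∣ q) (0 , λ n _ → ℚₚ.≤-reflexive
        (≡.trans (ℚₚ.+-identityʳ (q ℚ.* q)) (≡.sym (∣∣-square q))))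
    ; ‖‖-closed = λ {x} → ‖‖-closed {x}
    ; ‖‖-finite = ‖‖-finite
    ; ‖‖-zero = λ {x} h → ‖-‖≤0⇒≈ {x} {0ℂ} (‖‖-≐ {x} {x - 0ℂ}
        (λ n → ≡.sym (ℚₚ.+-identityʳ (seq (re x) n)) , ≡.sym (ℚₚ.+-identityʳ (seq (im x) n))) h)
    ; complete = λ x h →
        let y , x⟶y = complete x λ ε 0<ε → let N , k = h ε 0<ε in N , λ m n N≤m N≤n → from-ring-difference {x m} {x n} (k m n N≤m N≤n)
        in y , λ ε 0<ε → let N , k = x⟶y ε 0<ε in N , λ n N≤n → to-ring-difference {x n} {y} (k n N≤n)
    ; Real = Real
    ; Real-resp = λ {x} {y} → Real-resp {x} {y}
    ; Real-+ = λ {x} {y} (l , h) (m , k) → l +ʳ m , +-fromℝ {x} {y} {l} {m} h k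
    ; Real-* = λ {x} {y} (l , h) (m , k) → l *ʳ m , *-fromℝ {x} {y} {l} {m} h k
    ; Real-ι = λ q → fromℚ q , ≈-refl {ofℚ q}
    ; Real-lim = λ {x} {y} h x⟶y → Real-lim {x} {y} h λ ε 0<ε →
        let N , k = x⟶y ε 0<ε in N , λ n N≤n → from-ring-difference {x n} {y} (k n N≤n)
    ; NonNeg = NonNeg
    ; NonNeg-+ = λ {x} {y} (l , h , 0≤l) (m , k , 0≤m) → l +ʳ m , +-fromℝ {x} {y} {l} {m} h k , λ n → 0≤+ (0≤l n) (0≤m n)
    ; NonNeg-* = λ {x} {y} (l , h , 0≤l) (m , k , 0≤m) → l *ʳ m , *-fromℝ {x} {y} {l} {m} h k , λ n → 0≤* (0≤l n) (0≤m n)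
    ; NonNeg-ι = λ {q} 0≤q → fromℚ q , ≈-refl {ofℚ q} , λ _ → 0≤q
    ; NonNeg-resp = λ {x} {y} x≈y (l , h , 0≤l) → l , ≈-trans {y} {x} {fromℝ l} (≈-sym {x} {y} x≈y) h , 0≤l
    ; ‖‖-NonNeg = λ {x} {y} → ‖‖-NonNeg {x} {y}
    ; Real-sign = λ {x} → Real-sign {x}
    }
    where
    proj₁-* : ∀ p q → p ℚ.* q ℚ.+ ℚ.- (0ℚ ℚ.* 0ℚ) ≡ p ℚ.* q
    proj₁-* = ℚS.solve 2 (λ p q → p :* q :+ :- (con 0ℚ :* con 0ℚ) := p :* q) ≡.refl
    proj₂-* : ∀ p q → p ℚ.* 0ℚ ℚ.+ 0ℚ ℚ.* q ≡ 0ℚ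
    proj₂-* = ℚS.solve 2 (λ p q → p :* con 0ℚ :+ con 0ℚ :* q := con 0ℚ) ≡.refl

-- Transfer between the abstract series and the definitions of the statement.

open ComplexNorm
open ComplexAlgebra

private
  module ℚS = +-*-Solver
  module A where
    open Analysis ℂ-algebra public
    open Exponential ℂ-algebra public
    open Logarithm ℂ-algebra public
    open Coefficients ℂ-algebra public
    open PowerSeries ℂ-algebra public

∣∣<⇒‖‖≤ : ∀ {z ε} → 0ℚ ℚ.< ε → ∣ z ∣< ε → ‖ z ‖≤ ε
∣∣<⇒‖‖≤ {z} {ε} 0<ε (η , 0<η , N , h) = ‖‖-eventually {z} (ℚₚ.<⇒≤ 0<ε) (N , λ n N≤n →
  ℚₚ.≤-trans (≤-by η (ℚₚ.<⇒≤ 0<η) ≡.refl) (ℚₚ.<⇒≤ (h n N≤n)))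

-- Strict inequality needs a uniform gap, hence the bound ½ ε. In units of δ = ε / 4, the sum (2 δ +
-- δ)² + δ² = 10 δ² falls short of ε² = 16 δ² by six times δ².
‖‖≤⇒∣∣< : ∀ {z ε} → 0ℚ ℚ.< ε → ‖ z ‖≤ ½ ℚ.* ε → ∣ z ∣< ε
‖‖≤⇒∣∣< {z} {ε} 0<ε h =
  let δ = ½ ℚ.* (½ ℚ.* ε)
      0<δ = 0<½* (0<½* 0<ε)
      N , k = eventually h δ 0<δ
      0<δδ = 0<* {δ} {δ} 0<δ 0<δ
  in δ ℚ.* δ , 0<δδ , N , λ n N≤n → ℚₚ.≤-<-trans (ℚₚ.+-monoˡ-≤ (δ ℚ.* δ) (k n N≤n))
       (<-by {b = ε ℚ.* ε} (six (δ ℚ.* δ)) (0<six 0<δδ) (≡.trans (identity ε) ≡.refl))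
  where
  six : ℚ → ℚ
  six q = q ℚ.+ q ℚ.+ q ℚ.+ q ℚ.+ q ℚ.+ q
  0<six : ∀ {q} → 0ℚ ℚ.< q → 0ℚ ℚ.< six q
  0<six {q} p = 0<+ {q ℚ.+ q ℚ.+ q ℚ.+ q ℚ.+ q} {q} (0<+ {q ℚ.+ q ℚ.+ q ℚ.+ q} {q} (0<+ {q ℚ.+ q ℚ.+ q} {q} (0<+ {q ℚ.+ q} {q} (0<+ {q} {q} p p′) p′) p′) p′) p′
    where p′ = ℚₚ.<⇒≤ p
  open ℚS using (_:+_; _:*_; _:-_; :-_; _:=_; con)
  identity : ∀ ε → let δ = ½ ℚ.* (½ ℚ.* ε) in
    (½ ℚ.* ε ℚ.+ δ) ℚ.* (½ ℚ.* ε ℚ.+ δ) ℚ.+ δ ℚ.* δ ℚ.+ six (δ ℚ.* δ) ≡ ε ℚ.* ε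
  identity = ℚS.solve 1 (λ e → let d = con ½ :* (con ½ :* e)
                                   q = d :* d in
    (con ½ :* e :+ d) :* (con ½ :* e :+ d) :+ q :+ (q :+ q :+ q :+ q :+ q :+ q) := e :* e) ≡.refl

-- The partial sums of the abstract theory and of the statement are separate recursive functions;
-- they agree in every rational term.
partialSum-≐ : ∀ a n → A.partialSum a n ≐ partialSum a n
partialSum-≐ a zero m = ≡.refl , ≡.refl
partialSum-≐ a (suc n) m = let p , q = partialSum-≐ a n m in
  ≡.cong (ℚ._+ seq (re (a n)) m) p , ≡.cong (ℚ._+ seq (im (a n)) m) q

^-≐ : ∀ z n → z A.^ n ≐ z ^ n
^-≐ z zero m = ≡.refl , ≡.refl
^-≐ z (suc n) m = let p , q = ^-≐ z n m in
  ≡.cong₂ (λ c d → seq (re z) m ℚ.* c ℚ.+ ℚ.- (seq (im z) m ℚ.* d)) p q ,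
  ≡.cong₂ (λ c d → seq (re z) m ℚ.* d ℚ.+ seq (im z) m ℚ.* c) p q

HasSum⇒ : ∀ {a w} → HasSum a w → A.HasSum a w
HasSum⇒ {a} {w} h = A.hasSum λ ε 0<ε → let N , k = h ε 0<ε in N , λ n N≤n →
  ‖‖-≐ {partialSum a n - w} {A.partialSum a n A.- w}
    (λ m → let p , q = partialSum-≐ a n m in
      ≡.cong (ℚ._- seq (re w) m) (≡.sym p) , ≡.cong (ℚ._- seq (im w) m) (≡.sym q))
    (∣∣<⇒‖‖≤ {partialSum a n - w} 0<ε (k n N≤n))

HasSum⇐ : ∀ {a w} → A.HasSum a w → HasSum a w
HasSum⇐ {a} {w} (A.hasSum h) ε 0<ε = let N , k = h (½ ℚ.* ε) (0<½* 0<ε) in N , λ n N≤n →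
  ‖‖≤⇒∣∣< {partialSum a n - w} 0<ε (‖‖-≐ {A.partialSum a n A.- w} {partialSum a n - w}
    (λ m → let p , q = partialSum-≐ a n m in
      ≡.cong (ℚ._- seq (re w) m) p , ≡.cong (ℚ._- seq (im w) m) q)
    (k n N≤n))

-- The hypotheses are restated with _≈_ on ℂ to keep later conversion checks shallow.
A-HasSum-cong : ∀ {a b : ℕ → ℂ} {v w} → (∀ k → a k ≈ b k) → v ≈ w → A.HasSum a v → A.HasSum b w
A-HasSum-cong {a} {b} {v} {w} = A.HasSum-cong {a} {b} {v} {w}

A-HasSum-transport : ∀ {a b : ℕ → ℂ} {w} → A.HasSum a w → (∀ k → a k ≈ b k) → A.HasSum b w
A-HasSum-transport {a} {b} {w} h a≈b = A-HasSum-cong {a} {b} {w} {w} a≈b (≈-refl {w}) h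

expSeries : ℂ → ℕ → ℂ
expSeries w k = ofℚ ((ℤ.+ 1 ℚ./ (k !)) {{k ℕₚ.!≢0}}) * w ^ k

expTerm-≈ : ∀ w k → A.expTerm w k ≈ expSeries w k
expTerm-≈ w k = ≈-trans {A.expTerm w k} {ofℚ (recip! k) A.* w A.^ k} {expSeries w k}
  (A.expTerm-≈ w k)
  (*-cong {ofℚ (recip! k)} {ofℚ ((ℤ.+ 1 ℚ./ (k !)) {{k ℕₚ.!≢0}})} {w A.^ k} {w ^ k}
    (≐⇒≈ {ofℚ (recip! k)} {ofℚ ((ℤ.+ 1 ℚ./ (k !)) {{k ℕₚ.!≢0}})} λ _ → recip-≡ (k !) {{k ℕₚ.!≢0}} , ≡.refl)
    (≐⇒≈ {w A.^ k} {w ^ k} (^-≐ w k)))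

zetaSeries : ℕ → ℕ → ℂ
zetaSeries r n = ofℚ ((ℤ.+ 1 ℚ./ (suc n ℕ.^ r)) {{ℕₚ.m^n≢0 (suc n) r}})

zetaTerm-≈ : ∀ r n → A.zetaTerm r n ≈ zetaSeries r n
zetaTerm-≈ r n = ≡.subst (_≈ zetaSeries r n) (≡.sym (A.zetaTerm-≡ r n))
  (≐⇒≈ {ofℚ (recip (suc n ℕ.^ r) {{ℕₚ.m^n≢0 (suc n) r}})} {zetaSeries r n} λ _ → recip-≡ (suc n ℕ.^ r) {{ℕₚ.m^n≢0 (suc n) r}} , ≡.refl)

ν-≈ : ∀ n → A.ν n ≈ ofℕ n
ν-≈ n = ≐⇒≈ {A.ν n} {ofℕ n} λ _ → fromℕ-≡ n , ≡.refl

IsExp⇒ : ∀ {v w p q} → v ≈ w → p ≈ q → IsExp v p → A.HasSum (A.expTerm w) q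
IsExp⇒ {v} {w} {p} {q} v≈w p≈q h = A-HasSum-cong {expSeries v} {A.expTerm w} {p} {q}
  (λ k → ≈-trans {expSeries v k} {A.expTerm v k} {A.expTerm w k}
    (≈-sym {A.expTerm v k} {expSeries v k} (expTerm-≈ v k)) (A.expTerm-cong {v} {w} v≈w k))
  p≈q (HasSum⇒ {expSeries v} {p} h)

IsExp⇐ : ∀ {v w p q} → v ≈ w → p ≈ q → A.HasSum (A.expTerm v) p → IsExp w q
IsExp⇐ {v} {w} {p} {q} v≈w p≈q h = HasSum⇐ {expSeries w} {q} (A-HasSum-cong {A.expTerm v} {expSeries w} {p} {q}
  (λ k → ≈-trans {A.expTerm v k} {A.expTerm w k} {expSeries w k} (A.expTerm-cong {v} {w} v≈w k) (expTerm-≈ w k))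
  p≈q h)

IsCoeff⇒≈coeff : ∀ s r {c} → IsCoeff s (2 ℕ.+ r) c → c ≈ A.coeff s r
IsCoeff⇒≈coeff s r {c} (ζ , p , isZeta , (l , isLog , isExp) , cp≈ζ) = A.coeff-unique {s} {r} {c} {fromℝ l} {p} {ζ}
  (l , ≈-refl {fromℝ l})
  (IsExp⇒ {fromℝ l} {fromℝ l} {ofℕ (2 ℕ.+ r)} {A.ν (2 ℕ.+ r)} (≈-refl {fromℝ l}) (≈-sym {A.ν (2 ℕ.+ r)} {ofℕ (2 ℕ.+ r)} (ν-≈ (2 ℕ.+ r))) isLog)
  (IsExp⇒ {s * fromℝ l} {s A.* fromℝ l} {p} {p} (≈-refl {s * fromℝ l}) (≈-refl {p}) isExp)
  (A-HasSum-cong {zetaSeries (2 ℕ.+ r)} {A.zetaTerm (2 ℕ.+ r)} {ζ} {ζ} (λ n → ≈-sym {A.zetaTerm (2 ℕ.+ r) n} {zetaSeries (2 ℕ.+ r) n} (zetaTerm-≈ (2 ℕ.+ r) n)) (≈-refl {ζ}) (HasSum⇒ {zetaSeries (2 ℕ.+ r)} {ζ} isZeta))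
  cp≈ζ

exp-IsExp : ∀ w → IsExp w (A.exp w)
exp-IsExp w = IsExp⇐ {w} {w} {A.exp w} {A.exp w} (≈-refl {w}) (≈-refl {A.exp w}) (A.exp-HasSum w)

exp-IsLog : ∀ r L l → L ≈ fromℝ l → A.exp L ≈ ofℕ r → IsLog r l
exp-IsLog r L l L≈l exp-L = IsExp⇐ {L} {fromℝ l} {A.exp L} {ofℕ r} L≈l exp-L (A.exp-HasSum L)

zeta-IsZeta : ∀ r → IsZeta (2 ℕ.+ r) (A.zeta2+ r)
zeta-IsZeta r = HasSum⇐ {zetaSeries (2 ℕ.+ r)} {A.zeta2+ r}
  (A-HasSum-cong {A.zetaTerm (2 ℕ.+ r)} {zetaSeries (2 ℕ.+ r)} {A.zeta2+ r} {A.zeta2+ r} (zetaTerm-≈ (2 ℕ.+ r)) (≈-refl {A.zeta2+ r}) (A.zeta-HasSum r))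

coeff-equation : ∀ s r l → A.log1+ (suc r) ≈ fromℝ l → A.coeff s r * A.exp (s * fromℝ l) ≈ A.zeta2+ r
coeff-equation s r l h = A.coeff-spec s r {s * fromℝ l} {A.exp (s * fromℝ l)}
  (*-cong {s} {s} {fromℝ l} {A.log1+ (suc r)} (≈-refl {s}) (≈-sym {A.log1+ (suc r)} {fromℝ l} h)) (A.exp-HasSum (s * fromℝ l))

coeff-IsCoeff′ : ∀ s r l → A.log1+ (suc r) ≈ fromℝ l → IsCoeff s (2 ℕ.+ r) (A.coeff s r)
coeff-IsCoeff′ s r l h = A.zeta2+ r , A.exp (s * fromℝ l) , zeta-IsZeta r ,
  (l , exp-IsLog (2 ℕ.+ r) (A.log1+ (suc r)) l h exp-log1+ , exp-IsExp (s * fromℝ l)) , coeff-equation s r l h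
  where
  exp-log1+ : A.exp (A.log1+ (suc r)) ≈ ofℕ (2 ℕ.+ r)
  exp-log1+ = ≈-trans {A.exp (A.log1+ (suc r))} {A.ν (2 ℕ.+ r)} {ofℕ (2 ℕ.+ r)} (A.exp-log1+ (suc r)) (ν-≈ (2 ℕ.+ r))

coeff-IsCoeff : ∀ s r → IsCoeff s (2 ℕ.+ r) (A.coeff s r)
coeff-IsCoeff s r = coeff-IsCoeff′ s r (proj₁ (A.log1+-Real (suc r))) (proj₂ (A.log1+-Real (suc r)))

logSeries : ℂ → ℂ → ℕ → ℂ
logSeries s z k = A.coeff s k * z ^ (2 ℕ.+ k)

logTerm-≈ : ∀ s z k → A.logTerm s z k ≈ logSeries s z k
logTerm-≈ s z k = ≈-trans {A.logTerm s z k} {A.coeff s k A.* z A.^ (2 ℕ.+ k)} {logSeries s z k}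
  (A.logTerm-≈ s z k)
  (*-cong {A.coeff s k} {A.coeff s k} {z A.^ (2 ℕ.+ k)} {z ^ (2 ℕ.+ k)} (≈-refl {A.coeff s k}) (≐⇒≈ {z A.^ (2 ℕ.+ k)} {z ^ (2 ℕ.+ k)} (^-≐ z (2 ℕ.+ k))))

-- From |z|² ≤ 1 - η ≤ (1 - ½ η)² one obtains a rational radius below 1 without a square root. That
-- this radius is nonnegative follows from η ≤ 1.
disc-bound : ∀ (z : 𝔻) → ∃[ θ ] θ ℚ.< 1ℚ × ‖ point z ‖≤ θ
disc-bound (mk𝔻 z (η , 0<η , N , h)) = θ , θ<1 , ‖‖-eventually {z} 0≤θ (N , bound)
  where
  open ℚS using (_:+_; _:*_; _:-_; :-_; _:=_; con)
  θ : ℚ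
  θ = 1ℚ ℚ.- ½ ℚ.* η
  θ<1 : θ ℚ.< 1ℚ
  θ<1 = <-by (½ ℚ.* η) (0<½* 0<η) (ℚS.solve 1 (λ e → con 1ℚ :- con ½ :* e :+ con ½ :* e := con 1ℚ) ≡.refl η)
  η≤1 : η ℚ.≤ 1ℚ
  η≤1 = ℚₚ.≤-trans
    (≤-by (seq ∣ z ∣² N) (0≤+ {seq (re z) N ℚ.* seq (re z) N} {seq (im z) N ℚ.* seq (im z) N} (0≤square (seq (re z) N)) (0≤square (seq (im z) N)))
      (ℚₚ.+-comm η (seq ∣ z ∣² N)))
    (ℚₚ.<⇒≤ (h N ℕₚ.≤-refl))
  0≤θ : 0ℚ ℚ.≤ θ
  0≤θ = ≤⇒0≤ (ℚₚ.≤-trans (ℚₚ.<⇒≤ (½*< 0<η)) η≤1)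
  bound : ∀ n → N ℕ.≤ n → seq ∣ z ∣² n ℚ.≤ θ ℚ.* θ
  bound n N≤n = ℚₚ.≤-trans
    (≤-by (1ℚ ℚ.- (seq ∣ z ∣² n ℚ.+ η)) (≤⇒0≤ (ℚₚ.<⇒≤ (h n N≤n)))
      (ℚS.solve 2 (λ s e → s :+ (con 1ℚ :- (s :+ e)) := con 1ℚ :- e) ≡.refl (seq ∣ z ∣² n) η))
    (≤-by (½ ℚ.* η ℚ.* (½ ℚ.* η)) (0≤square (½ ℚ.* η))
      (ℚS.solve 1 (λ e → con 1ℚ :- e :+ con ½ :* e :* (con ½ :* e) := (con 1ℚ :- con ½ :* e) :* (con 1ℚ :- con ½ :* e)) ≡.refl η))

discTerm : (ℕ → ℂ) → ℂ → ℕ → ℂ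
discTerm c z k = c (2 ℕ.+ k) * z ^ (2 ℕ.+ k)

logTerm-discTerm : ∀ {s z} c → (∀ k → A.coeff s k ≈ c (2 ℕ.+ k)) → ∀ k → A.logTerm s z k ≈ discTerm c z k
logTerm-discTerm {s} {z} c coeff≈c k = ≈-trans {A.logTerm s z k} {logSeries s z k} {discTerm c z k} (logTerm-≈ s z k)
  (*-cong {A.coeff s k} {c (2 ℕ.+ k)} {z ^ (2 ℕ.+ k)} {z ^ (2 ℕ.+ k)} (coeff≈c k) (≈-refl {z ^ (2 ℕ.+ k)}))

discTerm⇐ : ∀ {s z w} (c : ℕ → ℂ) → (∀ k → A.coeff s k ≈ c (2 ℕ.+ k)) → A.HasSum (A.logTerm s z) w →
  HasSum (discTerm c z) w
discTerm⇐ {s} {z} {w} c coeff≈c h =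
  HasSum⇐ {discTerm c z} {w} (A-HasSum-transport {A.logTerm s z} {discTerm c z} {w} h (logTerm-discTerm {s} {z} c coeff≈c))

discTerm⇒ : ∀ {s z w} (c : ℕ → ℂ) → (∀ k → A.coeff s k ≈ c (2 ℕ.+ k)) → HasSum (discTerm c z) w →
  A.HasSum (A.logTerm s z) w
discTerm⇒ {s} {z} {w} c coeff≈c h = A-HasSum-transport {discTerm c z} {A.logTerm s z} {w} (HasSum⇒ {discTerm c z} {w} h)
  (λ k → ≈-sym {A.logTerm s z k} {discTerm c z k} (logTerm-discTerm {s} {z} c coeff≈c k))

mkIsLogG : ∀ s (f : 𝔻 → ℂ) (c : ℕ → ℂ) → (∀ r → 2 ℕ.≤ r → IsCoeff s r (c r)) →
  (∀ (z : 𝔻) → HasSum (discTerm c (point z)) (f z)) → IsLogG s f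
mkIsLogG s f c i h = c , i , h

logG-exists : ∀ s → Σ[ f ∈ (𝔻 → ℂ) ] IsLogG s f
logG-exists s = f , mkIsLogG s f c c-IsCoeff (λ z → discTerm⇐ {s} {point z} {f z} c (λ k → ≈-refl {A.coeff s k}) (proj₂ (limit z)))
  where
  limit : ∀ (z : 𝔻) → ∃[ w ] A.HasSum (A.logTerm s (point z)) w
  limit z = let θ , θ<1 , hz = disc-bound z in A.logG-converges s {point z} {θ} hz θ<1
  f : 𝔻 → ℂ
  f z = proj₁ (limit z)
  c : ℕ → ℂ
  c (suc (suc r)) = A.coeff s r
  -- A default for the indices 0 and 1, which lie outside the range r ≥ 2 of the series.
  c _ = 0ℂ
  c-IsCoeff : ∀ r → 2 ℕ.≤ r → IsCoeff s r (c r)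
  c-IsCoeff (suc (suc r)) _ = coeff-IsCoeff s r
  c-IsCoeff 1 (ℕ.s≤s ())

-- Here the coefficients chosen by the hypothesis are replaced by the canonical ones, by uniqueness.
IsLogG⇒HasSum : ∀ {s f} → IsLogG s f → ∀ (z : 𝔻) → A.HasSum (A.logTerm s (point z)) (f z)
IsLogG⇒HasSum {s} {f} (c , c-IsCoeff , h) z = discTerm⇒ {s} {point z} {f z} c
  (λ k → ≈-sym {c (2 ℕ.+ k)} {A.coeff s k} (IsCoeff⇒≈coeff s k {c (2 ℕ.+ k)} (c-IsCoeff (2 ℕ.+ k) (ℕ.s≤s (ℕ.s≤s ℕ.z≤n))))) (h z)

-- Modulus comparisons, the derivative and the conclusion.

conj : ℂ → ℂ
conj z = re z +i (-ʳ im z)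

conj-cong : ∀ {z w} → z ≈ w → conj z ≈ conj w
conj-cong {z} {w} (hr , hi) = hr , proj₂ (-‿cong {z} {w} (hr , hi))

-- ∣ z ∣² is the real part of z times its conjugate, so it inherits compatibility with _≈_ from the ring structure.
∣∣²-cong : ∀ {z w} → z ≈ w → ∣ z ∣² ≈ʳ ∣ w ∣²
∣∣²-cong {z} {w} z≈w ε 0<ε =
  let N , h = proj₁ (*-cong {z} {w} {conj z} {conj w} z≈w (conj-cong {z} {w} z≈w)) ε 0<ε
  in N , λ n N≤n → ≡.subst (ℚ._< ε) (≡.cong₂ (λ s t → ∣ s ℚ.- t ∣) (expand z n) (expand w n)) (h n N≤n)
  where
  open ℚS using (_:+_; _:*_; :-_; _:=_)
  expand : ∀ z n → seq (re (z * conj z)) n ≡ seq ∣ z ∣² n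
  expand z n = ℚS.solve 2 (λ a b → a :* a :+ :- (b :* (:- b)) := a :* a :+ b :* b) ≡.refl (seq (re z) n) (seq (im z) n)

-- The terms of s obey the bound ½ ε only up to a slack, for which another ½ ε is spent. The η from
-- `_≤ʳ_` pays for replacing u by v s.
multiple-bound : ∀ {u v s ε} → 0ℚ ℚ.< ε → u ≈ v * s → ‖ s ‖≤ ½ ℚ.* ε → ∣ u ∣≤ ε ·∣ v ∣
multiple-bound {u} {v} {s} {ε} 0<ε u≈vs hs η 0<η =
  let M , close = ∣∣²-cong {u} {v * s} u≈vs η 0<η
      N , small = eventually hs (½ ℚ.* ε) (0<½* 0<ε)
  in M ⊔ N , λ n ≤n → begin-strict
    seq ∣ u ∣² n
      ≡⟨ ℚS.solve 2 (λ a b → a := b :+ (a :- b)) ≡.refl (seq ∣ u ∣² n) (seq ∣ v * s ∣² n) ⟩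
    seq ∣ v * s ∣² n ℚ.+ (seq ∣ u ∣² n ℚ.- seq ∣ v * s ∣² n)
      <⟨ ℚₚ.+-mono-≤-< (product n (small n (ℕₚ.m⊔n≤o⇒n≤o M N ≤n))) (ℚₚ.≤-<-trans (≤∣∣ _) (close n (ℕₚ.m⊔n≤o⇒m≤o M N ≤n))) ⟩
    ε ℚ.* ε ℚ.* seq ∣ v ∣² n ℚ.+ η ∎
  where
  open ℚₚ.≤-Reasoning
  open ℚS using (_:+_; _:*_; _:-_; :-_; _:=_)
  product : ∀ n → seq ∣ s ∣² n ℚ.≤ (½ ℚ.* ε ℚ.+ ½ ℚ.* ε) ℚ.* (½ ℚ.* ε ℚ.+ ½ ℚ.* ε) →
    seq ∣ v * s ∣² n ℚ.≤ ε ℚ.* ε ℚ.* seq ∣ v ∣² n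
  product n h = ≡.subst (ℚ._≤ ε ℚ.* ε ℚ.* seq ∣ v ∣² n)
    (≡.trans (ℚₚ.*-comm (seq ∣ s ∣² n) (seq ∣ v ∣² n)) (≡.sym (norm²-* (seq (re v) n) (seq (im v) n) (seq (re s) n) (seq (im s) n))))
    (*-monoʳ (seq ∣ v ∣² n) (0≤+ {seq (re v) n ℚ.* seq (re v) n} {seq (im v) n ℚ.* seq (im v) n} (0≤square (seq (re v) n)) (0≤square (seq (im v) n)))
      (≡.subst (λ e → seq ∣ s ∣² n ℚ.≤ e ℚ.* e) (½+½ ε) h))

HasDerivAt-quadratic : ∀ {f z d θ τ B} → ‖ point z ‖≤ θ → θ ℚ.< τ → 0ℚ ℚ.≤ B →
  (∀ (w : 𝔻) → ‖ point w ‖≤ τ → ∃[ t ] ‖ t ‖≤ B ×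
    (f w - f z) - d * (point w - point z) ≈ (point w - point z) * ((point w - point z) * t)) →
  HasDerivAt f z d
HasDerivAt-quadratic {f} {z} {d} {θ} {τ} {B} hz θ<τ 0≤B expansion ε 0<ε =
  let q , 0<q , eq = quotient-pos {1ℚ ℚ.+ B} (0<+ {1ℚ} {B} 0<1 0≤B) (0<½* 0<ε)
      -- The first bound keeps w in the disc of radius τ, where the expansion holds. The second, q =
      -- ½ ε / (1 + B), makes v t at most ½ ε; the summand 1 keeps the divisor positive.
      δ = (τ ℚ.- θ) ℚ.⊓ q
      0<δ = 0<⊓ (<⇒0< θ<τ) 0<q
  in δ , 0<δ , λ w close →
    let v = point w - point z
        hv = ∣∣<⇒‖‖≤ {v} 0<δ close
        t , ht , eq-w = expansion w (near w (‖‖-mono {v} (ℚₚ.p⊓q≤p (τ ℚ.- θ) q) hv))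
    in multiple-bound {(f w - f z) - d * v} {v} {v * t} 0<ε eq-w
         (≡.subst (‖ v * t ‖≤_) (≡.trans (ℚₚ.*-comm q (1ℚ ℚ.+ B)) eq)
           (‖‖-* {v} {t} (‖‖-mono {v} (ℚₚ.p⊓q≤q (τ ℚ.- θ) q) hv) (‖‖-mono {t} (≤-by 1ℚ 0≤1 (ℚₚ.+-comm B 1ℚ)) ht)))
  where
  0<⊓ : ∀ {p q} → 0ℚ ℚ.< p → 0ℚ ℚ.< q → 0ℚ ℚ.< p ℚ.⊓ q
  0<⊓ {p} {q} 0<p 0<q with ℚₚ.⊓-sel p q
  ... | inj₁ e = ≡.subst (0ℚ ℚ.<_) (≡.sym e) 0<p
  ... | inj₂ e = ≡.subst (0ℚ ℚ.<_) (≡.sym e) 0<q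
  near : ∀ (w : 𝔻) → ‖ point w - point z ‖≤ τ ℚ.- θ → ‖ point w ‖≤ τ
  near w h = ≡.subst (‖ point w ‖≤_) (ℚS.solve 2 (λ t s → (t ℚS.:- s) ℚS.:+ s ℚS.:= t) ≡.refl τ θ)
    (‖‖-≐ {(point w - point z) + point z} {point w}
      (λ n → cancel (seq (re (point w)) n) (seq (re (point z)) n) , cancel (seq (im (point w)) n) (seq (im (point z)) n))
      (‖‖-+ {point w - point z} {point z} h hz))
    where
    cancel : ∀ a b → (a ℚ.- b) ℚ.+ b ≡ a
    cancel = ℚS.solve 2 (λ a b → (a ℚS.:- b) ℚS.:+ b ℚS.:= a) ≡.refl

expansion-≈ : ∀ {u v d w z t} → (u A.- v) A.- d A.* (w A.- z) A.≈ (w A.- z) A.* ((w A.- z) A.* t) →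
  (u - v) - d * (w - z) ≈ (w - z) * ((w - z) * t)
expansion-≈ h = h

logG-expansion : ∀ s {z τ} → ‖ z ‖≤ τ → τ ℚ.< 1ℚ →
  ∃[ d ] (∃[ B ] 0ℚ ℚ.≤ B × (∀ {w fw fz} → ‖ w ‖≤ τ → A.HasSum (A.logTerm (s + 1ℂ) w) fw → A.HasSum (A.logTerm (s + 1ℂ) z) fz →
      ∃[ t ] ‖ t ‖≤ B × (fw - fz) - d * (w - z) ≈ (w - z) * ((w - z) * t))) ×
    (∀ {g} → A.HasSum (A.logTerm s z) g → z * d ≈ g)
logG-expansion s {z} {τ} hz τ<1 =
  let d , (B , 0≤B , expansion) , zd≈ = A.logG-derivative {s} {s + 1ℂ} {z} {τ} (≈-refl {s + 1ℂ}) hz τ<1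
  in d , (B , 0≤B , λ {w} {fw} {fz} hw Σw Σz →
       let t , ht , eq = expansion {w} {fw} {fz} hw Σw Σz in t , ht , expansion-≈ {fw} {fz} {d} {w} {z} {t} eq) ,
     λ {g} → zd≈ {g}

logG-derivative : ∀ (s : ℂ) (f g : 𝔻 → ℂ) → IsLogG (s + 1ℂ) f → IsLogG s g →
  ∀ (z : 𝔻) → Σ[ d ∈ ℂ ] HasDerivAt f z d × point z * d ≈ g z
logG-derivative s f g isf isg z =
  let θ , θ<1 , hz = disc-bound z
      -- A second radius between θ and 1 leaves w room to move around z while all estimates stay in
      -- one disc of radius below 1.
      τ , 0≤τ , θ<τ , τ<1 = midpoint (nonNeg hz) θ<1
      d , (B , 0≤B , expansion) , zd≈ = logG-expansion s {point z} {τ} (‖‖-mono {point z} (ℚₚ.<⇒≤ θ<τ) hz) τ<1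
  in d ,
    HasDerivAt-quadratic {f} {z} {d} {θ} {τ} {B} hz θ<τ 0≤B
      (λ w hw → expansion {point w} {f w} {f z} hw (IsLogG⇒HasSum {s + 1ℂ} {f} isf w) (IsLogG⇒HasSum {s + 1ℂ} {f} isf z)) ,
    zd≈ {g z} (IsLogG⇒HasSum {s} {g} isg z)

-- The existence half ensures that the second half, which quantifies over all f and g satisfying
-- `IsLogG`, is not vacuous.
proposition3p5 :
    (∀ (s : ℂ) → Σ[ f ∈ (𝔻 → ℂ) ] IsLogG s f) ×
    (∀ (s : ℂ) (f g : 𝔻 → ℂ) → IsLogG (s + 1ℂ) f → IsLogG s g →
      ∀ (z : 𝔻) → Σ[ d ∈ ℂ ] HasDerivAt f z d × point z * d ≈ g z)
proposition3p5 = logG-exists , logG-derivative
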